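{- Let $X$ be a smooth projective split toric variety over $\mathbb{Q}$ with $-K_X$ globally generated, of dimension $d$, with $r=\operatorname{rank}\operatorname{Pic}(X)$. For every fixed $A>0$, as $B\to\infty$, $$\#\big(\mathcal{A}(B)\setminus\mathcal{A}^{(A)\flat}(B)\big)=O_A\big(B(\log B)^{r-2}\log\log B\big).$$
   Context: $X$ is defined by a complete regular fan $\Delta$ in $N_\mathbb{R}$, $N\cong\mathbb{Z}^d$, $M=\operatorname{Hom}(N,\mathbb{Z})$; $\Delta(1)$ is the set of rays, $n=\#\Delta(1)=r+d$, $n_\rho$ the primitive generator of $\rho$, $\Delta_{\max}$ the set of maximal cones, $\sigma(1)$ the rays of $\sigma$. For $\sigma\in\Delta_{\max}$, $\{n_\rho:\rho\in\sigma(1)\}$ is a basis of $N$; let $m_\sigma\in M$ be the unique element with $\langle m_\sigma,n_\rho\rangle=1$ for all $\rho\in\sigma(1)$, and $a_\rho(\sigma)=1-\langle m_\sigma,n_\rho\rangle$ (which is $\ge0$). For $\mathbf{X}=(X_\rho)_{\rho\in\Delta(1)}$ with positive entries, $\mathbf{X}^{D_0(\sigma)}=\prod_\rho X_\rho^{a_\rho(\sigma)}$. Let $\mathcal{A}(B)=\{\mathbf{X}\in\mathbb{Z}_{\ge1}^{\Delta(1)}:\max_{\sigma\in\Delta_{\max}}\mathbf{X}^{D_0(\sigma)}\le B\}$. For $\sigma\in\Delta_{\max}$ and $\rho'\in\sigma(1)$, let $n^\vee_{\sigma,\rho'}\in M$ be the element of the dual basis with $\langle n^\vee_{\sigma,\rho'},n_\rho\rangle=\delta_{\rho\rho'}$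 for $\rho\in\sigma(1)$, and $\mathbf{X}^{E_\sigma(\rho')}=\prod_{\rho\notin\sigma(1)}X_\rho^{ -\langle n^\vee_{\sigma,\rho'},n_\rho\rangle}$. Then $\mathcal{A}^{(A)\flat}(B)=\{\mathbf{X}\in\mathcal{A}(B):\mathbf{X}^{E_\sigma(\rho')}\ge(\log B)^A\text{ for all }\sigma\in\Delta_{\max},\rho'\in\sigma(1)\}$. -}

module Defs where

open import Level using (0ℓ)
open import Data.Bool.Base using (if_then_else_)
open import Data.Nat.Base as ℕ using (ℕ; zero; suc)
open import Data.Integer.Base as ℤ using (ℤ; +_; -[1+_]; 0ℤ; 1ℤ)
import Data.Integer.Properties as ℤ
open import Data.Rational.Base as ℚ using (ℚ; 0ℚ; 1ℚ; _/_)
import Data.Rational.Properties as ℚ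
open import Data.Fin.Base using (Fin; zero; suc)
import Data.Fin.Properties as Fin
open import Data.Fin.Subset using (Subset; _∈_; _∉_; _⊆_; _∩_; ⁅_⁆)
open import Data.Fin.Subset.Properties using (_∈?_)
open import Data.Vec.Base using (Vec; lookup)
open import Data.Vec.Functional using (Vector)
open import Data.List.Base using (List; length)
open import Data.List.Relation.Unary.All using (All)
open import Data.List.Relation.Unary.Unique.Propositional using (Unique)
open import Data.Product.Base using (Σ; ∃; ∃-syntax; _×_; _,_)
open import Data.Sum.Base using (_⊎_; inj₁; inj₂)
open import Data.Empty using (⊥-elim)
open import Function.Base using (_∘_)
open import Function.Bundles using (_⇔_)
open import Algebra.Bundles using (CommutativeRing)
import Algebra.Definitions.RawSemiring
import Algebra.Properties.Semiring.Sum
open import Relation.Binary.PropositionalEquality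
  using (_≡_; _≗_; refl; sym; trans; cong; cong₂; subst; module ≡-Reasoning)
open import Relation.Nullary using (¬_; yes; no; does)
open import Relation.Unary using (Pred; Decidable)

module Σℤ = Algebra.Properties.Semiring.Sum ℤ.+-*-semiring
module Σℚ = Algebra.Properties.Semiring.Sum (CommutativeRing.semiring ℚ.+-*-commutativeRing)

open Algebra.Definitions.RawSemiring ℚ.+-*-rawSemiring public
  using (product) renaming (_^_ to _^ℚ_)

------------------------------------------------------------------------
-- Real numbers

-- A real number x is given by its two-sided Dedekind cut:
-- lower q means q < x, and upper q means x < q.  The operations are
-- defined on arbitrary pairs of predicates, so that they need no side
-- conditions; they are the expected real functions wherever those are
-- defined (log x for x > 0, and y ^ᶜ a for y > 0).

record Cut : Set₁ where
  field
    lower : ℚ → Set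
    upper : ℚ → Set

open Cut public

record IsReal (x : Cut) : Set where
  field
    lower-inhabited : ∃ (lower x)
    upper-inhabited : ∃ (upper x)
    lower-rounded   : ∀ q → lower x q ⇔ (∃[ p ] q ℚ.< p × lower x p)
    upper-rounded   : ∀ q → upper x q ⇔ (∃[ p ] p ℚ.< q × upper x p)
    disjoint        : ∀ q → ¬ (lower x q × upper x q)
    located         : ∀ p q → p ℚ.< q → lower x p ⊎ upper x q

record ℝ : Set₁ where
  field
    cut    : Cut
    isReal : IsReal cut

open ℝ public using (cut)

infix 4 _<ᶜ_ _≤ᶜ_

_<ᶜ_ : Cut → Cut → Set
x <ᶜ y = ∃[ q ] upper x q × lower y q

_≤ᶜ_ : Cut → Cut → Set
x ≤ᶜ y = ¬ (y <ᶜ x)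

fromℚ : ℚ → Cut
fromℚ p = record { lower = ℚ._< p ; upper = p ℚ.<_ }

fromℕ : ℕ → Cut
fromℕ n = fromℚ (+ n / 1)

fromℤ : ℤ → Cut
fromℤ i = fromℚ (i / 1)

fromℚ-isReal : ∀ p → IsReal (fromℚ p)
fromℚ-isReal p = record
  { lower-inhabited = p ℚ.- 1ℚ , subst (p ℚ.- 1ℚ ℚ.<_) (ℚ.+-identityʳ p)
                        (ℚ.+-monoʳ-< p {ℚ.- 1ℚ} {0ℚ} (ℚ.negative⁻¹ (ℚ.- 1ℚ)))
  ; upper-inhabited = p ℚ.+ 1ℚ , subst (ℚ._< p ℚ.+ 1ℚ) (ℚ.+-identityʳ p)
                        (ℚ.+-monoʳ-< p {0ℚ} {1ℚ} (ℚ.positive⁻¹ 1ℚ))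
  ; lower-rounded   = λ q → record
      { to = ℚ.<-dense ; from = λ (_ , q<r , r<p) → ℚ.<-trans q<r r<p
      ; to-cong = λ { refl → refl } ; from-cong = λ { refl → refl } }
  ; upper-rounded   = λ q → record
      { to = λ p<q → let (r , p<r , r<q) = ℚ.<-dense p<q in r , r<q , p<r
      ; from = λ (_ , r<q , p<r) → ℚ.<-trans p<r r<q
      ; to-cong = λ { refl → refl } ; from-cong = λ { refl → refl } }
  ; disjoint        = λ q (q<p , p<q) → ℚ.<-asym q<p p<q
  ; located         = λ q r q<r → locate q r q<r
  }
  where
  locate : ∀ q r → q ℚ.< r → q ℚ.< p ⊎ p ℚ.< r
  locate q r q<r with q ℚ.<? p
  ... | yes q<p = inj₁ q<p
  ... | no  q≮p = inj₂ (ℚ.≤-<-trans (ℚ.≮⇒≥ q≮p) q<r)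

infixl 7 _*ᶜ_
infixr 8 _^ᶜ_

-- Interval multiplication: a < x < b and c < y < d confine x y to the
-- interval between the least and the greatest of ac, ad, bc, bd.
_*ᶜ_ : Cut → Cut → Cut
x *ᶜ y = record
  { lower = λ q → ∃[ a ] ∃[ b ] ∃[ c ] ∃[ d ] Encloses a b c d ×
      q ℚ.< a ℚ.* c × q ℚ.< a ℚ.* d × q ℚ.< b ℚ.* c × q ℚ.< b ℚ.* d
  ; upper = λ q → ∃[ a ] ∃[ b ] ∃[ c ] ∃[ d ] Encloses a b c d ×
      a ℚ.* c ℚ.< q × a ℚ.* d ℚ.< q × b ℚ.* c ℚ.< q × b ℚ.* d ℚ.< q
  }
  where
  Encloses : (a b c d : ℚ) → Set
  Encloses a b c d = lower x a × upper x b × lower y c × upper y d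

-- For rational t, e^t is the supremum of (1 + t/k)^k over those k ≥ 1
-- with 1 + t/k > 0, and it is not attained unless t = 0, when every
-- term equals 1.  Since the comparison with q is strict, q < e^t holds
-- exactly when q lies below one of these terms.
_<exp_ : ℚ → ℚ → Set
q <exp t = ∃[ j ] 0ℚ ℚ.< base j × q ℚ.< base j ^ℚ suc j
  where
  base : ℕ → ℚ
  base j = 1ℚ ℚ.+ t ℚ.* (1ℤ / suc j)

-- e^t < q if and only if q > 0 and 1/q < e^(-t).
_>exp_ : ℚ → ℚ → Set
q >exp t = Σ (ℚ.Positive q) λ q>0 →
  (ℚ.1/ q) {{ℚ.pos⇒nonZero q {{q>0}}}} <exp (ℚ.- t)

exp : Cut → Cut
exp x = record
  { lower = λ q → ∃[ t ] lower x t × q <exp t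
  ; upper = λ q → ∃[ t ] upper x t × q >exp t
  }

-- The natural logarithm: t < log x if and only if e^t < x.
log : Cut → Cut
log x = record
  { lower = λ t → ∃[ p ] p >exp t × lower x p
  ; upper = λ t → ∃[ p ] p <exp t × upper x p
  }

_^ᶜ_ : Cut → Cut → Cut
y ^ᶜ a = exp (a *ᶜ log y)

------------------------------------------------------------------------
-- Lattices

-- N = ℤ^d, and M = Hom(N, ℤ) is identified with ℤ^d by the standard
-- dual basis.
Lattice : ℕ → Set
Lattice d = Vector ℤ d

⟨_,_⟩ : ∀ {d} → Lattice d → Lattice d → ℤ
⟨ m , v ⟩ = Σℤ.sum (λ i → m i ℤ.* v i)

lincomb : ∀ {n d} → (Fin n → Lattice d) → Vector ℤ n → Lattice d
lincomb u c i = Σℤ.sum (λ ρ → c ρ ℤ.* u ρ i)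

δ : ∀ {n} → Fin n → Fin n → ℤ
δ i j = if does (i Fin.≟ j) then 1ℤ else 0ℤ

Supported : ∀ {n} → Subset n → Vector ℤ n → Set
Supported σ c = ∀ ρ → ρ ∉ σ → c ρ ≡ 0ℤ

-- The vectors u ρ with ρ ∈ σ form a ℤ-basis of ℤ^d.
record IsBasis {n d} (u : Fin n → Lattice d) (σ : Subset n) : Set where
  field
    coord     : Lattice d → Vector ℤ n
    supported : ∀ v → Supported σ (coord v)
    expand    : ∀ v → lincomb u (coord v) ≗ v
    unique    : ∀ c c′ → Supported σ c → Supported σ c′ →
                lincomb u c ≗ lincomb u c′ → c ≗ c′

δ-sum : ∀ {n} (f : Vector ℤ n) j → Σℤ.sum (λ i → f i ℤ.* δ i j) ≡ f j
δ-sum {suc n} f zero = begin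
  f zero ℤ.* 1ℤ ℤ.+ Σℤ.sum (λ i → f (suc i) ℤ.* 0ℤ)
    ≡⟨ cong₂ ℤ._+_ (ℤ.*-identityʳ (f zero)) (Σℤ.sum-cong-≗ (λ i → ℤ.*-zeroʳ (f (suc i)))) ⟩
  f zero ℤ.+ Σℤ.sum {n} (λ _ → 0ℤ)
    ≡⟨ cong (ℤ._+_ (f zero)) (Σℤ.sum-replicate-zero n) ⟩
  f zero ℤ.+ 0ℤ
    ≡⟨ ℤ.+-identityʳ (f zero) ⟩
  f zero ∎
  where open ≡-Reasoning
δ-sum {suc n} f (suc j) = begin
  f zero ℤ.* 0ℤ ℤ.+ Σℤ.sum (λ i → f (suc i) ℤ.* δ i j)
    ≡⟨ cong₂ ℤ._+_ (ℤ.*-zeroʳ (f zero)) (δ-sum (f ∘ suc) j) ⟩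
  0ℤ ℤ.+ f (suc j)
    ≡⟨ ℤ.+-identityˡ (f (suc j)) ⟩
  f (suc j) ∎
  where open ≡-Reasoning

δ-sym : ∀ {n} (i j : Fin n) → δ i j ≡ δ j i
δ-sym i j with i Fin.≟ j | j Fin.≟ i
... | yes _   | yes _   = refl
... | no _    | no _    = refl
... | yes i≡j | no j≢i  = ⊥-elim (j≢i (sym i≡j))
... | no i≢j  | yes j≡i = ⊥-elim (i≢j (sym j≡i))

module DualBasis {n d} {u : Fin n → Lattice d} {σ : Subset n} (b : IsBasis u σ) where
  open IsBasis b
  open ≡-Reasoning

  -- dual ρ′ is the linear form that reads off the ρ′-coordinate.
  dual : Fin n → Lattice d
  dual ρ′ i = coord (δ i) ρ′

  ones : Lattice d
  ones i = Σℤ.sum (λ ρ′ → dual ρ′ i)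

  ⟨dual,-⟩ : ∀ ρ′ v → ⟨ dual ρ′ , v ⟩ ≡ coord v ρ′
  ⟨dual,-⟩ ρ′ v = unique (λ ρ → ⟨ dual ρ , v ⟩) (coord v) supp (supported v) same ρ′
    where
    supp : Supported σ (λ ρ → ⟨ dual ρ , v ⟩)
    supp ρ ρ∉σ = trans
      (Σℤ.sum-cong-≗ (λ i → trans (cong (ℤ._* v i) (supported (δ i) ρ ρ∉σ)) (ℤ.*-zeroˡ (v i))))
      (Σℤ.sum-replicate-zero d)

    same : lincomb u (λ ρ → ⟨ dual ρ , v ⟩) ≗ lincomb u (coord v)
    same j = begin
      Σℤ.sum (λ ρ → Σℤ.sum (λ i → dual ρ i ℤ.* v i) ℤ.* u ρ j)
        ≡⟨ Σℤ.sum-cong-≗ (λ ρ → Σℤ.*-distribʳ-sum (u ρ j) (λ i → dual ρ i ℤ.* v i)) ⟩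
      Σℤ.sum (λ ρ → Σℤ.sum (λ i → dual ρ i ℤ.* v i ℤ.* u ρ j))
        ≡⟨ Σℤ.∑-comm (λ ρ i → dual ρ i ℤ.* v i ℤ.* u ρ j) ⟩
      Σℤ.sum (λ i → Σℤ.sum (λ ρ → dual ρ i ℤ.* v i ℤ.* u ρ j))
        ≡⟨ Σℤ.sum-cong-≗ (λ i → Σℤ.sum-cong-≗ (λ ρ → trans
             (cong (ℤ._* u ρ j) (ℤ.*-comm (dual ρ i) (v i)))
             (ℤ.*-assoc (v i) (dual ρ i) (u ρ j)))) ⟩
      Σℤ.sum (λ i → Σℤ.sum (λ ρ → v i ℤ.* (dual ρ i ℤ.* u ρ j)))
        ≡⟨ Σℤ.sum-cong-≗ (λ i → sym (Σℤ.*-distribˡ-sum (v i) (λ ρ → dual ρ i ℤ.* u ρ j))) ⟩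
      Σℤ.sum (λ i → v i ℤ.* lincomb u (coord (δ i)) j)
        ≡⟨ Σℤ.sum-cong-≗ (λ i → cong (ℤ._*_ (v i)) (expand (δ i) j)) ⟩
      Σℤ.sum (λ i → v i ℤ.* δ i j)
        ≡⟨ δ-sum v j ⟩
      v j
        ≡⟨ sym (expand v j) ⟩
      lincomb u (coord v) j ∎

  dual-spec : ∀ ρ′ ρ → ρ ∈ σ → ⟨ dual ρ′ , u ρ ⟩ ≡ δ ρ′ ρ
  dual-spec ρ′ ρ ρ∈σ = trans (⟨dual,-⟩ ρ′ (u ρ))
    (unique (coord (u ρ)) (λ τ → δ τ ρ) (supported (u ρ)) supp same ρ′)
    where
    supp : Supported σ (λ τ → δ τ ρ)
    supp τ τ∉σ with τ Fin.≟ ρ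
    ... | yes refl = ⊥-elim (τ∉σ ρ∈σ)
    ... | no _     = refl

    same : lincomb u (coord (u ρ)) ≗ lincomb u (λ τ → δ τ ρ)
    same j = begin
      lincomb u (coord (u ρ)) j
        ≡⟨ expand (u ρ) j ⟩
      u ρ j
        ≡⟨ sym (δ-sum (λ τ → u τ j) ρ) ⟩
      Σℤ.sum (λ τ → u τ j ℤ.* δ τ ρ)
        ≡⟨ Σℤ.sum-cong-≗ (λ τ → ℤ.*-comm (u τ j) (δ τ ρ)) ⟩
      lincomb u (λ τ → δ τ ρ) j ∎

  ones-spec : ∀ ρ → ρ ∈ σ → ⟨ ones , u ρ ⟩ ≡ 1ℤ
  ones-spec ρ ρ∈σ = begin
    Σℤ.sum (λ i → Σℤ.sum (λ ρ′ → dual ρ′ i) ℤ.* u ρ i)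
      ≡⟨ Σℤ.sum-cong-≗ (λ i → Σℤ.*-distribʳ-sum (u ρ i) (λ ρ′ → dual ρ′ i)) ⟩
    Σℤ.sum (λ i → Σℤ.sum (λ ρ′ → dual ρ′ i ℤ.* u ρ i))
      ≡⟨ Σℤ.∑-comm (λ i ρ′ → dual ρ′ i ℤ.* u ρ i) ⟩
    Σℤ.sum (λ ρ′ → ⟨ dual ρ′ , u ρ ⟩)
      ≡⟨ Σℤ.sum-cong-≗ (λ ρ′ → trans (dual-spec ρ′ ρ ρ∈σ) (sym (ℤ.*-identityˡ (δ ρ′ ρ)))) ⟩
    Σℤ.sum (λ ρ′ → 1ℤ ℤ.* δ ρ′ ρ)
      ≡⟨ δ-sum (λ _ → 1ℤ) ρ ⟩
    1ℤ ∎

------------------------------------------------------------------------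
-- Fans

-- A cone is recorded by the set of its rays σ(1) ⊆ Δ(1) = Fin n.
-- Cones are rational polyhedral, so every condition on cones of N_ℝ
-- below holds over ℝ if and only if it holds on N_ℚ = ℚ^d.

InCone : ∀ {n d} → (Fin n → Lattice d) → Subset n → Vector ℚ d → Set
InCone {n} u σ v = Σ (Vector ℚ n) λ c →
  (∀ ρ → 0ℚ ℚ.≤ c ρ) × (∀ ρ → ρ ∉ σ → c ρ ≡ 0ℚ) ×
  (∀ i → Σℚ.sum (λ ρ → c ρ ℚ.* (u ρ i / 1)) ≡ v i)

-- The face of σ cut out by a supporting hyperplane m = 0.
IsFace : ∀ {n d} → (Fin n → Lattice d) → Subset n → Subset n → Set
IsFace u τ σ = τ ⊆ σ × ∃[ m ]
  (∀ ρ → ρ ∈ σ → 0ℤ ℤ.≤ ⟨ m , u ρ ⟩) ×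
  (∀ ρ → ρ ∈ σ → ρ ∈ τ ⇔ ⟨ m , u ρ ⟩ ≡ 0ℤ)

record Fan (d n : ℕ) : Set₁ where
  field
    ray           : Fin n → Lattice d
    ray-injective : ∀ ρ ρ′ → ray ρ ≗ ray ρ′ → ρ ≡ ρ′
    ray-primitive : ∀ ρ k (v : Lattice d) → (∀ i → ray ρ i ≡ k ℤ.* v i) → ℤ.∣ k ∣ ≡ 1

    Cone          : Pred (Subset n) 0ℓ
    cone?         : Decidable Cone
    ray-cone      : ∀ ρ → Cone ⁅ ρ ⁆

    ray-face      : ∀ {σ} → Cone σ → ∀ ρ → ρ ∈ σ → IsFace ray ⁅ ρ ⁆ σ
    pointed       : ∀ {σ} → Cone σ → ∀ v → InCone ray σ v → InCone ray σ (ℚ.-_ ∘ v) →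
                    ∀ i → v i ≡ 0ℚ
    face-closed   : ∀ {σ τ} → Cone σ → IsFace ray τ σ → Cone τ
    ∩-face        : ∀ {σ τ} → Cone σ → Cone τ →
                    IsFace ray (σ ∩ τ) σ × IsFace ray (σ ∩ τ) τ
    ∩-cone        : ∀ {σ τ} → Cone σ → Cone τ → ∀ v →
                    InCone ray σ v → InCone ray τ v → InCone ray (σ ∩ τ) v

module _ {d n : ℕ} (Δ : Fan d n) where
  open Fan Δ

  Complete : Set
  Complete = ∀ v → ∃[ σ ] Cone σ × InCone ray σ v

  Maximal : Pred (Subset n) 0ℓ
  Maximal σ = Cone σ × (∀ τ → Cone τ → σ ⊆ τ → σ ≡ τ)

  -- For a complete fan, every cone is a face of a d-dimensional one, so
  -- this says that every cone is generated by part of a ℤ-basis of N.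
  Regular : Set
  Regular = ∀ σ → Maximal σ → IsBasis ray σ

  -- The coefficients of the torus-invariant divisor Σ_ρ a_ρ D_ρ.
  Divisor : Set
  Divisor = Vector ℤ n

  -K : Divisor
  -K _ = 1ℤ

  -- The global sections of 𝒪(D) are spanned by the characters χ^m with
  -- ⟨ m , n_ρ ⟩ ≥ - a_ρ for all ρ.
  GlobalSection : Divisor → Pred (Lattice d) 0ℓ
  GlobalSection a m = ∀ ρ → ℤ.- a ρ ℤ.≤ ⟨ m , ray ρ ⟩

  -- χ^m generates 𝒪(D) on the affine chart U_σ.
  Generates : Divisor → Subset n → Pred (Lattice d) 0ℓ
  Generates a σ m = ∀ ρ → ρ ∈ σ → ⟨ m , ray ρ ⟩ ≡ ℤ.- a ρ

  GloballyGenerated : Pred Divisor 0ℓ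
  GloballyGenerated a = ∀ σ → Maximal σ → ∃[ m ] GlobalSection a m × Generates a σ m

  -- The support function of D is strictly convex.
  Ample : Pred Divisor 0ℓ
  Ample a = ∀ σ → Maximal σ → ∃[ m ]
    Generates a σ m × (∀ ρ → ρ ∉ σ → ℤ.- a ρ ℤ.< ⟨ m , ray ρ ⟩)

  Projective : Set
  Projective = ∃ Ample

  -- Pic X is the cokernel of M → ℤ^Δ(1), m ↦ (⟨ m , n_ρ ⟩)_ρ, and it is
  -- free for X smooth and complete.  The isomorphism Pic X ≅ ℤ^r is
  -- given by the images of the classes [D_ρ].
  record PicardRank (r : ℕ) : Set where
    field
      class      : Fin n → Lattice r
      surjective : ∀ w → ∃[ a ] lincomb class a ≗ w
      exact      : ∀ a → (∀ i → lincomb class a i ≡ 0ℤ) ⇔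
                         (∃[ m ] ∀ ρ → a ρ ≡ ⟨ m , ray ρ ⟩)

------------------------------------------------------------------------
-- Monomials

-- The inverse of a positive integer; the value at 0 is never used.
recip : ℕ → ℚ
recip zero    = 0ℚ
recip (suc k) = 1ℤ / suc k

_^ℤ_ : ℕ → ℤ → ℚ
x ^ℤ (+ k)    = (+ x / 1) ^ℚ k
x ^ℤ -[1+ k ] = recip x ^ℚ suc k

monomial : ∀ {n} → Vec ℕ n → Vector ℤ n → ℚ
monomial X e = product (λ ρ → lookup X ρ ^ℤ e ρ)

------------------------------------------------------------------------
-- The counting problem

module _ {d n : ℕ} (Δ : Fan d n) (regular : Regular Δ) where
  open Fan Δ
  open DualBasis

  m[_] : ∀ {σ} → Maximal Δ σ → Lattice d
  m[_] {σ} σ-max = ones (regular σ σ-max)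

  n^∨ : ∀ {σ} → Maximal Δ σ → Fin n → Lattice d
  n^∨ {σ} σ-max = dual (regular σ σ-max)

  D₀ : ∀ {σ} → Maximal Δ σ → Vector ℤ n
  D₀ σ-max ρ = 1ℤ ℤ.- ⟨ m[ σ-max ] , ray ρ ⟩

  E : ∀ {σ} → Maximal Δ σ → Fin n → Vector ℤ n
  E {σ} σ-max ρ′ ρ = if does (ρ ∈? σ) then 0ℤ else ℤ.- ⟨ n^∨ σ-max ρ′ , ray ρ ⟩

  -- max_σ X^{D₀(σ)} ≤ B is stated for each σ separately.
  𝒜 : Cut → Pred (Vec ℕ n) 0ℓ
  𝒜 B X = (∀ ρ → 1 ℕ.≤ lookup X ρ) ×
           (∀ σ (σ-max : Maximal Δ σ) → fromℚ (monomial X (D₀ σ-max)) ≤ᶜ B)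

  𝒜♭ : Cut → Cut → Pred (Vec ℕ n) 0ℓ
  𝒜♭ A B X = 𝒜 B X ×
    (∀ σ (σ-max : Maximal Δ σ) ρ′ → ρ′ ∈ σ →
       log B ^ᶜ A ≤ᶜ fromℚ (monomial X (E σ-max ρ′)))

-- Membership in P need not be decidable, so the bound #P ≤ x is
-- expressed by bounding every finite list of distinct elements of P.
#_≤_ : {S : Set} → Pred S 0ℓ → Cut → Set
#_≤_ {S} P x = (L : List S) → Unique L → All P L → fromℕ (length L) ≤ᶜ x

module Submission where

-- Put x_ρ = ⌊log₂ X_ρ⌋, so that each x ∈ ℕⁿ comes from 2^|x| vectors X.  By completeness the point
-- - Σ x_ρ n_ρ lies in a maximal cone σ, with coordinates c ≥ 0, and t = x + c satisfies Σ t_ρ n_ρ = 0.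
-- Pairing with m_σ gives |t| = D₀(σ) x, so X^D₀(σ) ≤ B bounds |t| by log₂ B, while pairing with a dual
-- basis vector turns X^E_σ′(ρ′) < (log B)^A into t_ρ′ ≤ O(log log B) + K |c|.  The relations t form a
-- cone of rank r.  Those with |t| = k and t_ρ′ ≤ μ number O((k + 1)^(r-2) (μ + 1)): take a maximal cone
-- that contains - n_ρ′ and hence not n_ρ′; then t is determined by its coordinates off that cone, of which
-- one is t_ρ′ and, in general, another is determined by |t| = k.  Summing 2^(|t| - |c|) over k, over c
-- (where 2^-|c| beats the factor |c|) and over ρ′ gives the bound.

open import Defs
open import Data.Nat.Base using (ℕ)
open import Data.Integer.Base using (+_; _-_)
open import Data.Product.Base using (∃-syntax; _×_)
open import Relation.Nullary using (¬_)
open import Data.Bool.Base using (if_then_else_)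
open import Data.Nat.Base as ℕ using (zero; suc; pred; z≤n; s≤s)
import Data.Nat.Properties as ℕ
open import Data.Nat.Tactic.RingSolver using (solve-∀)
import Data.Nat.Coprimality as Coprime
open import Data.Integer.Base as ℤ using (ℤ; -[1+_]; 0ℤ; 1ℤ)
import Data.Integer.Properties as ℤ
open import Data.Integer.Tactic.RingSolver using () renaming (solve-∀ to ℤ-solve-∀)
open import Data.Rational.Base as ℚ using (ℚ; mkℚ; 0ℚ; 1ℚ; _/_)
import Data.Rational.Properties as ℚ
open import Data.Rational.Solver using () renaming (module +-*-Solver to ℚ-Solver)
open import Data.Fin.Base using (Fin; zero; suc)
import Data.Fin.Properties as Fin
open import Data.Fin.Subset using (Subset; inside; outside; _∈_; _∉_; _⊆_; _⊂_; ∣_∣; ∁) renaming (_-_ to _∖_)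
open import Data.Fin.Subset.Properties
open import Data.Vec.Base as Vec using (Vec; []; _∷_; lookup; tabulate; zipWith; here; there)
import Data.Vec.Properties as Vec
open import Data.Vec.Functional using (Vector)
open import Data.List.Base as List using (List; []; _∷_; length; map; deduplicate; downFrom; allFin)
import Data.List.Properties as List
open import Data.List.Relation.Unary.All as All using (All; []; _∷_)
import Data.List.Relation.Unary.All.Properties as All
open import Data.List.Relation.Unary.Any using (here; there)
open import Data.List.Relation.Unary.AllPairs using ([]; _∷_)
open import Data.List.Relation.Unary.Unique.Propositional using (Unique)
import Data.List.Relation.Unary.Unique.DecPropositional.Properties as DecUnique
open import Data.List.Membership.Propositional using () renaming (_∈_ to _∈ˡ_)
import Data.List.Membership.Propositional.Properties as Mem
open import Data.Product.Base using (Σ; ∃; _,_; proj₁; proj₂)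
open import Data.Sum.Base using (_⊎_; inj₁; inj₂; [_,_]′)
open import Data.Empty using (⊥-elim)
open import Function.Base using (_∘_; id; case_of_)
open import Function.Bundles using (Equivalence)
open import Algebra.Bundles using (CommutativeRing)
import Algebra.Properties.Semiring.Exp
open import Relation.Nullary using (Dec; yes; no; contradiction; ¬?; does)
open import Relation.Nullary.Decidable using (_×-dec_; from-yes)
open import Relation.Unary using (Pred)
open import Relation.Binary.Definitions using (DecidableEquality)
open import Relation.Binary.PropositionalEquality hiding (J)

-- The cone adapted to `x` varies with `x`, but it need not be remembered: only its coordinates `c`
-- enter, every `c` in a box is paired with every k, and the weight 2^-|c| makes the overcount
-- harmless. The two savings over (k + 1)^r should come from two different coordinates off the
-- chosen cone. They collide when ρ′ is the only ray there with D₀ ≠ 0; then |t| = k reads k = a_ρ′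
-- t_ρ′, so k itself is O(μ) and the second power of k + 1 is paid for by μ + 1. Containing - n_ρ′
-- thus serves twice: it puts ρ′ off the cone and makes a_ρ′ nonzero. Since r - 2 is negative for r
-- = 1, counts are estimated in ℕ after multiplying by powers of k + 1 or m + 1; the division
-- happens only against the real number (log B)^(r-2). All numerics rest on 2 < e < 4, so B is
-- located between powers of 4. Membership in `𝒜♭` is not decided, but the final inequality is a
-- negation and can be proved under a double negation.

module ^ℚ = Algebra.Properties.Semiring.Exp (CommutativeRing.semiring ℚ.+-*-commutativeRing)

-- Rational approximations of the exponential function

/1≡mkℚ : ∀ i → i / 1 ≡ mkℚ i 0 (Coprime.sym (Coprime.1-coprimeTo ℤ.∣ i ∣))
/1≡mkℚ (+ n)      = ℚ.normalize-coprime _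
/1≡mkℚ (-[1+ n ]) = cong ℚ.-_
  (ℚ.normalize-coprime (Coprime.sym (Coprime.1-coprimeTo (suc n))))

/1-homo-+ : ∀ i j → (i ℤ.+ j) / 1 ≡ i / 1 ℚ.+ j / 1
/1-homo-+ i j = sym (trans (cong₂ ℚ._+_ (/1≡mkℚ i) (/1≡mkℚ j))
  (cong (_/ 1) (cong₂ ℤ._+_ (ℤ.*-identityʳ i) (ℤ.*-identityʳ j))))

/1-homo-* : ∀ i j → (i ℤ.* j) / 1 ≡ i / 1 ℚ.* (j / 1)
/1-homo-* i j = sym (cong₂ ℚ._*_ (/1≡mkℚ i) (/1≡mkℚ j))

/1-mono-≤ : ∀ {i j} → i ℤ.≤ j → i / 1 ℚ.≤ j / 1
/1-mono-≤ {i} {j} i≤j = subst₂ ℚ._≤_ (sym (/1≡mkℚ i)) (sym (/1≡mkℚ j))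
  (ℚ.*≤* (ℤ.*-monoʳ-≤-nonNeg 1ℤ i≤j))

/1-cancel-≤ : ∀ {i j} → i / 1 ℚ.≤ j / 1 → i ℤ.≤ j
/1-cancel-≤ {i} {j} i≤j = subst₂ ℤ._≤_ (ℤ.*-identityʳ i) (ℤ.*-identityʳ j)
  (ℚ.drop-*≤* (subst₂ ℚ._≤_ (/1≡mkℚ i) (/1≡mkℚ j) i≤j))

-- Opaque, so that unification can read n off ι n.
opaque
  ι : ℕ → ℚ
  ι n = + n / 1

  ι≡/1 : ∀ n → ι n ≡ + n / 1
  ι≡/1 n = refl

ι0 : ι 0 ≡ 0ℚ
ι0 = ι≡/1 0

ι1 : ι 1 ≡ 1ℚ
ι1 = ι≡/1 1

ι-homo-+ : ∀ m n → ι (m ℕ.+ n) ≡ ι m ℚ.+ ι n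
ι-homo-+ m n = trans (ι≡/1 (m ℕ.+ n)) (trans (/1-homo-+ (+ m) (+ n))
  (sym (cong₂ ℚ._+_ (ι≡/1 m) (ι≡/1 n))))

ι-homo-* : ∀ m n → ι (m ℕ.* n) ≡ ι m ℚ.* ι n
ι-homo-* m n = trans (trans (ι≡/1 (m ℕ.* n)) (cong (_/ 1) (ℤ.pos-* m n)))
  (trans (/1-homo-* (+ m) (+ n)) (sym (cong₂ ℚ._*_ (ι≡/1 m) (ι≡/1 n))))

ι-suc : ∀ n → ι (suc n) ≡ 1ℚ ℚ.+ ι n
ι-suc n = trans (ι-homo-+ 1 n) (cong (ℚ._+ ι n) ι1)

ι-homo-^ : ∀ m n → ι (m ℕ.^ n) ≡ ι m ^ℚ n
ι-homo-^ m zero    = ι1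
ι-homo-^ m (suc n) = trans (ι-homo-* m (m ℕ.^ n)) (cong (ι m ℚ.*_) (ι-homo-^ m n))

ι-mono-≤ : ∀ {m n} → m ℕ.≤ n → ι m ℚ.≤ ι n
ι-mono-≤ {m} {n} m≤n = subst₂ ℚ._≤_ (sym (ι≡/1 m)) (sym (ι≡/1 n)) (/1-mono-≤ (ℤ.+≤+ m≤n))

ι-cancel-≤ : ∀ {m n} → ι m ℚ.≤ ι n → m ℕ.≤ n
ι-cancel-≤ {m} {n} m≤n = ℤ.drop‿+≤+ (/1-cancel-≤ (subst₂ ℚ._≤_ (ι≡/1 m) (ι≡/1 n) m≤n))

ι-mono-< : ∀ {m n} → m ℕ.< n → ι m ℚ.< ι n
ι-mono-< m<n = ℚ.≰⇒> (ℕ.<⇒≱ m<n ∘ ι-cancel-≤)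

<⇒≱ℚ : ∀ {p q} → p ℚ.< q → ¬ q ℚ.≤ p
<⇒≱ℚ p<q q≤p = ℚ.<-irrefl refl (ℚ.<-≤-trans p<q q≤p)

0≤ι : ∀ n → 0ℚ ℚ.≤ ι n
0≤ι n = subst (ℚ._≤ ι n) ι0 (ι-mono-≤ ℕ.z≤n)

0<ι : ∀ n → 0ℚ ℚ.< ι (suc n)
0<ι n = subst (ℚ._< ι (suc n)) ι0 (ι-mono-< (ℕ.s≤s ℕ.z≤n))

recip-inverse : ∀ j → ι (suc j) ℚ.* (1ℤ / suc j) ≡ 1ℚ
recip-inverse j = trans
  (cong₂ ℚ._*_ (trans (ι≡/1 (suc j)) (/1≡mkℚ (+ suc j))) (ℚ.normalize-coprime (Coprime.1-coprimeTo (suc j))))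
  (ℚ.*-inverseʳ (mkℚ (+ suc j) 0 (Coprime.sym (Coprime.1-coprimeTo (suc j)))))

*-mono-≤ℚ : ∀ {a b c d} → 0ℚ ℚ.≤ a → 0ℚ ℚ.≤ d → a ℚ.≤ b → c ℚ.≤ d → a ℚ.* c ℚ.≤ b ℚ.* d
*-mono-≤ℚ {a} {b} {c} {d} 0≤a 0≤d a≤b c≤d = ℚ.≤-trans
  (ℚ.*-monoˡ-≤-nonNeg a {{ℚ.nonNegative 0≤a}} c≤d)
  (ℚ.*-monoʳ-≤-nonNeg d {{ℚ.nonNegative 0≤d}} a≤b)

*-mono-<ℚ : ∀ {a b c d} → 0ℚ ℚ.< a → 0ℚ ℚ.< d → a ℚ.≤ b → c ℚ.< d → a ℚ.* c ℚ.< b ℚ.* d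
*-mono-<ℚ {a} {b} {c} {d} 0<a 0<d a≤b c<d = ℚ.<-≤-trans
  (ℚ.*-monoʳ-<-pos a {{ℚ.positive 0<a}} c<d)
  (ℚ.*-monoʳ-≤-nonNeg d {{ℚ.nonNegative (ℚ.<⇒≤ 0<d)}} a≤b)

0≤*ℚ : ∀ {a b} → 0ℚ ℚ.≤ a → 0ℚ ℚ.≤ b → 0ℚ ℚ.≤ a ℚ.* b
0≤*ℚ {a} {b} 0≤a 0≤b = subst (ℚ._≤ a ℚ.* b) (ℚ.*-zeroˡ b) (*-mono-≤ℚ ℚ.≤-refl 0≤b 0≤a ℚ.≤-refl)

0<*ℚ : ∀ {a b} → 0ℚ ℚ.< a → 0ℚ ℚ.< b → 0ℚ ℚ.< a ℚ.* b
0<*ℚ {a} {b} 0<a 0<b = subst (ℚ._< a ℚ.* b) (ℚ.*-zeroʳ a) (*-mono-<ℚ 0<a 0<b ℚ.≤-refl 0<b)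

0≤^ℚ : ∀ {x} n → 0ℚ ℚ.≤ x → 0ℚ ℚ.≤ x ^ℚ n
0≤^ℚ zero    0≤x = ℚ.<⇒≤ (ℚ.positive⁻¹ 1ℚ)
0≤^ℚ (suc n) 0≤x = 0≤*ℚ 0≤x (0≤^ℚ n 0≤x)

0<^ℚ : ∀ {x} n → 0ℚ ℚ.< x → 0ℚ ℚ.< x ^ℚ n
0<^ℚ zero    0<x = ℚ.positive⁻¹ 1ℚ
0<^ℚ (suc n) 0<x = 0<*ℚ 0<x (0<^ℚ n 0<x)

^ℚ-mono-≤ : ∀ {x y} n → 0ℚ ℚ.≤ x → x ℚ.≤ y → x ^ℚ n ℚ.≤ y ^ℚ n
^ℚ-mono-≤ zero    0≤x x≤y = ℚ.≤-refl
^ℚ-mono-≤ (suc n) 0≤x x≤y =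
  *-mono-≤ℚ 0≤x (0≤^ℚ n (ℚ.≤-trans 0≤x x≤y)) x≤y (^ℚ-mono-≤ n 0≤x x≤y)

^ℚ-mono-< : ∀ {x y} n → 0ℚ ℚ.≤ x → x ℚ.< y → x ^ℚ suc n ℚ.< y ^ℚ suc n
^ℚ-mono-< {x} {y} n 0≤x x<y = ℚ.≤-<-trans
  (ℚ.*-monoˡ-≤-nonNeg x {{ℚ.nonNegative 0≤x}} (^ℚ-mono-≤ n 0≤x (ℚ.<⇒≤ x<y)))
  (ℚ.*-monoˡ-<-pos (y ^ℚ n) {{ℚ.positive (0<^ℚ n (ℚ.≤-<-trans 0≤x x<y))}} x<y)

^ℚ-distrib-* : ∀ x y n → (x ℚ.* y) ^ℚ n ≡ x ^ℚ n ℚ.* y ^ℚ n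
^ℚ-distrib-* x y zero    = refl
^ℚ-distrib-* x y (suc n) = trans (cong (x ℚ.* y ℚ.*_) (^ℚ-distrib-* x y n))
  (solve 4 (λ x y u v → x :* y :* (u :* v) := x :* u :* (y :* v)) refl x y (x ^ℚ n) (y ^ℚ n))
  where open ℚ-Solver

1^ℚ : ∀ n → 1ℚ ^ℚ n ≡ 1ℚ
1^ℚ zero    = refl
1^ℚ (suc n) = trans (ℚ.*-identityˡ (1ℚ ^ℚ n)) (1^ℚ n)

0≤square : ∀ x → 0ℚ ℚ.≤ x ℚ.* x
0≤square x with ℚ.≤-total 0ℚ x
... | inj₁ 0≤x = 0≤*ℚ 0≤x 0≤x
... | inj₂ x≤0 = subst (0ℚ ℚ.≤_)
  (solve 1 (λ x → (:- x) :* (:- x) := x :* x) refl x) (0≤*ℚ 0≤-x 0≤-x)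
  where
  open ℚ-Solver
  0≤-x = ℚ.neg-antimono-≤ x≤0

bernoulli : ∀ n {z} → 0ℚ ℚ.≤ 1ℚ ℚ.+ z → 1ℚ ℚ.+ ι n ℚ.* z ℚ.≤ (1ℚ ℚ.+ z) ^ℚ n
bernoulli zero    {z} _     = ℚ.≤-reflexive (cong (ℚ._+_ 1ℚ) (trans (cong (ℚ._* z) ι0) (ℚ.*-zeroˡ z)))
bernoulli (suc n) {z} 0≤1+z = begin
  1ℚ ℚ.+ ι (suc n) ℚ.* z
    ≡⟨ cong (λ m → 1ℚ ℚ.+ m ℚ.* z) (ι-suc n) ⟩
  1ℚ ℚ.+ (1ℚ ℚ.+ ι n) ℚ.* z
    ≡⟨ sym (ℚ.+-identityʳ _) ⟩
  1ℚ ℚ.+ (1ℚ ℚ.+ ι n) ℚ.* z ℚ.+ 0ℚ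
    ≤⟨ ℚ.+-monoʳ-≤ (1ℚ ℚ.+ (1ℚ ℚ.+ ι n) ℚ.* z) (0≤*ℚ (0≤ι n) (0≤square z)) ⟩
  1ℚ ℚ.+ (1ℚ ℚ.+ ι n) ℚ.* z ℚ.+ ι n ℚ.* (z ℚ.* z)
    ≡⟨ solve 2 (λ m z → con 1ℚ :+ (con 1ℚ :+ m) :* z :+ m :* (z :* z)
         := (con 1ℚ :+ z) :* (con 1ℚ :+ m :* z)) refl (ι n) z ⟩
  (1ℚ ℚ.+ z) ℚ.* (1ℚ ℚ.+ ι n ℚ.* z)
    ≤⟨ ℚ.*-monoˡ-≤-nonNeg (1ℚ ℚ.+ z) {{ℚ.nonNegative 0≤1+z}} (bernoulli n 0≤1+z) ⟩
  (1ℚ ℚ.+ z) ^ℚ suc n ∎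
  where
  open ℚ.≤-Reasoning
  open ℚ-Solver

-- The rational (1 + t/k)^k that occurs in the definition of e^t, for k = suc j.
term : ℚ → ℕ → ℚ
term t j = (1ℚ ℚ.+ t ℚ.* (1ℤ / suc j)) ^ℚ suc j

recip-* : ∀ i j → ι (suc i) ℚ.* (1ℤ / (suc i ℕ.* suc j)) ≡ 1ℤ / suc j
recip-* i j = begin
  I ℚ.* K⁻¹
    ≡⟨ sym (ℚ.*-identityˡ _) ⟩
  1ℚ ℚ.* (I ℚ.* K⁻¹)
    ≡⟨ cong (ℚ._* (I ℚ.* K⁻¹)) (sym (recip-inverse j)) ⟩
  J ℚ.* J⁻¹ ℚ.* (I ℚ.* K⁻¹)
    ≡⟨ solve 4 (λ J J′ I K → J :* J′ :* (I :* K) := J′ :* (I :* J :* K)) refl J J⁻¹ I K⁻¹ ⟩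
  J⁻¹ ℚ.* (I ℚ.* J ℚ.* K⁻¹)
    ≡⟨ cong (λ x → J⁻¹ ℚ.* (x ℚ.* K⁻¹)) (sym (ι-homo-* (suc i) (suc j))) ⟩
  J⁻¹ ℚ.* (ι (suc i ℕ.* suc j) ℚ.* K⁻¹)
    ≡⟨ cong (J⁻¹ ℚ.*_) (recip-inverse (j ℕ.+ i ℕ.* suc j)) ⟩
  J⁻¹ ℚ.* 1ℚ
    ≡⟨ ℚ.*-identityʳ _ ⟩
  J⁻¹ ∎
  where
  open ≡-Reasoning
  open ℚ-Solver
  I   = ι (suc i)
  J   = ι (suc j)
  J⁻¹ = 1ℤ / suc j
  K⁻¹ = 1ℤ / (suc i ℕ.* suc j)

-- Bernoulli's inequality makes (1 + t/k)^k increase along multiples of k.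
term-refine : ∀ t i j → 0ℚ ℚ.< 1ℚ ℚ.+ t ℚ.* (1ℤ / suc j) →
  let z = t ℚ.* (1ℤ / (suc i ℕ.* suc j)) in
  0ℚ ℚ.≤ 1ℚ ℚ.+ z × term t j ℚ.≤ (1ℚ ℚ.+ z) ^ℚ (suc i ℕ.* suc j)
term-refine t i j 0<b = 0≤1+z , (begin
  term t j
    ≡⟨ cong (λ x → (1ℚ ℚ.+ x) ^ℚ suc j) (sym Iz) ⟩
  (1ℚ ℚ.+ I ℚ.* z) ^ℚ suc j
    ≤⟨ ^ℚ-mono-≤ (suc j) (subst (λ x → 0ℚ ℚ.≤ 1ℚ ℚ.+ x) (sym Iz) (ℚ.<⇒≤ 0<b)) (bernoulli (suc i) 0≤1+z) ⟩
  ((1ℚ ℚ.+ z) ^ℚ suc i) ^ℚ suc j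
    ≡⟨ ^ℚ.^-assocʳ (1ℚ ℚ.+ z) (suc i) (suc j) ⟩
  (1ℚ ℚ.+ z) ^ℚ (suc i ℕ.* suc j) ∎)
  where
  open ℚ.≤-Reasoning
  open ℚ-Solver
  I = ι (suc i)
  z = t ℚ.* (1ℤ / (suc i ℕ.* suc j))
  Iz : I ℚ.* z ≡ t ℚ.* (1ℤ / suc j)
  Iz = trans (solve 3 (λ I t r → I :* (t :* r) := t :* (I :* r)) refl I t (1ℤ / (suc i ℕ.* suc j)))
         (cong (t ℚ.*_) (recip-* i j))
  -- (i + 1)(1 + z) is `i` plus the coarser base 1 + t/(j + 1), which is positive by hypothesis.
  0≤I[1+z] : I ℚ.* 0ℚ ℚ.≤ I ℚ.* (1ℚ ℚ.+ z)
  0≤I[1+z] = begin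
    I ℚ.* 0ℚ
      ≡⟨ ℚ.*-zeroʳ I ⟩
    0ℚ
      ≤⟨ ℚ.+-mono-≤ (0≤ι i) (ℚ.<⇒≤ 0<b) ⟩
    ι i ℚ.+ (1ℚ ℚ.+ t ℚ.* (1ℤ / suc j))
      ≡⟨ cong (λ x → ι i ℚ.+ (1ℚ ℚ.+ x)) (sym Iz) ⟩
    ι i ℚ.+ (1ℚ ℚ.+ I ℚ.* z)
      ≡⟨ solve 3 (λ i o x → i :+ (o :+ x) := o :+ i :+ x) refl (ι i) 1ℚ (I ℚ.* z) ⟩
    1ℚ ℚ.+ ι i ℚ.+ I ℚ.* z
      ≡⟨ cong₂ ℚ._+_ (trans (sym (ι-suc i)) (sym (ℚ.*-identityʳ I))) refl ⟩
    I ℚ.* 1ℚ ℚ.+ I ℚ.* z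
      ≡⟨ sym (ℚ.*-distribˡ-+ I 1ℚ z) ⟩
    I ℚ.* (1ℚ ℚ.+ z) ∎
  0≤1+z : 0ℚ ℚ.≤ 1ℚ ℚ.+ z
  0≤1+z = ℚ.*-cancelˡ-≤-pos I {{ℚ.positive (0<ι i)}} 0≤I[1+z]

-- The half of e^t e^(-t) = 1 that survives truncation: the factors pair up as (1 + z)(1 - z) = 1 -
-- z² ≤ 1.
term-*-term≤1 : ∀ z k → 0ℚ ℚ.≤ 1ℚ ℚ.+ z → 0ℚ ℚ.≤ 1ℚ ℚ.+ ℚ.- z →
  (1ℚ ℚ.+ z) ^ℚ k ℚ.* (1ℚ ℚ.+ ℚ.- z) ^ℚ k ℚ.≤ 1ℚ
term-*-term≤1 z k 0≤1+z 0≤1-z = begin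
  (1ℚ ℚ.+ z) ^ℚ k ℚ.* (1ℚ ℚ.+ ℚ.- z) ^ℚ k
    ≡⟨ sym (^ℚ-distrib-* (1ℚ ℚ.+ z) (1ℚ ℚ.+ ℚ.- z) k) ⟩
  ((1ℚ ℚ.+ z) ℚ.* (1ℚ ℚ.+ ℚ.- z)) ^ℚ k
    ≤⟨ ^ℚ-mono-≤ k (0≤*ℚ 0≤1+z 0≤1-z) [1+z][1-z]≤1 ⟩
  1ℚ ^ℚ k
    ≡⟨ 1^ℚ k ⟩
  1ℚ ∎
  where
  open ℚ.≤-Reasoning
  open ℚ-Solver
  [1+z][1-z]≤1 : (1ℚ ℚ.+ z) ℚ.* (1ℚ ℚ.+ ℚ.- z) ℚ.≤ 1ℚ
  [1+z][1-z]≤1 = begin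
    (1ℚ ℚ.+ z) ℚ.* (1ℚ ℚ.+ ℚ.- z)
      ≡⟨ solve 1 (λ z → (con 1ℚ :+ z) :* (con 1ℚ :+ :- z) := con 1ℚ :+ :- (z :* z)) refl z ⟩
    1ℚ ℚ.+ ℚ.- (z ℚ.* z)
      ≤⟨ ℚ.+-monoʳ-≤ 1ℚ (ℚ.neg-antimono-≤ (0≤square z)) ⟩
    1ℚ ∎

inv : ∀ q → ℚ.Positive q → ℚ
inv q q>0 = (ℚ.1/ q) {{ℚ.pos⇒nonZero q {{q>0}}}}

inv-inverse : ∀ q (q>0 : ℚ.Positive q) → inv q q>0 ℚ.* q ≡ 1ℚ
inv-inverse q q>0 = ℚ.*-inverseˡ q {{ℚ.pos⇒nonZero q {{q>0}}}}

0<inv : ∀ q (q>0 : ℚ.Positive q) → 0ℚ ℚ.< inv q q>0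
0<inv q q>0 = ℚ.positive⁻¹ (inv q q>0) {{ℚ.1/pos⇒pos q {{q>0}}}}

inv-unique : ∀ {p q} (q>0 : ℚ.Positive q) → p ℚ.* q ≡ 1ℚ → p ≡ inv q q>0
inv-unique {p} {q} q>0 pq≡1 = begin
  p                    ≡⟨ sym (ℚ.*-identityʳ p) ⟩
  p ℚ.* 1ℚ             ≡⟨ cong (p ℚ.*_) (sym (inv-inverse q q>0)) ⟩
  p ℚ.* (inv q q>0 ℚ.* q) ≡⟨ solve 3 (λ p i q → p :* (i :* q) := p :* q :* i) refl p (inv q q>0) q ⟩
  p ℚ.* q ℚ.* inv q q>0   ≡⟨ cong (ℚ._* inv q q>0) pq≡1 ⟩
  1ℚ ℚ.* inv q q>0     ≡⟨ ℚ.*-identityˡ _ ⟩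
  inv q q>0 ∎
  where
  open ≡-Reasoning
  open ℚ-Solver

recip-comm : ∀ i j → 1ℤ / (suc j ℕ.* suc i) ≡ 1ℤ / (suc i ℕ.* suc j)
recip-comm i j = ℚ./-cong {1ℤ} {suc j ℕ.* suc i} {1ℤ} {suc i ℕ.* suc j} refl (ℕ.*-comm (suc j) (suc i))

-- `p` and `1/q` are witnessed by terms of different lengths j + 1 and i + 1. Both are refined to
-- the common length (i + 1)(j + 1), where the product of opposite terms is at most 1; hence p/q <
-- 1.
0<⇒<exp⇒<>exp : ∀ {p q x y} → 0ℚ ℚ.< p → p <exp x → q >exp y → x ℚ.≤ y → p ℚ.< q
0<⇒<exp⇒<>exp {p} {q} {x} {y} 0<p (j , 0<b , p<t) (q>0 , i , 0<b′ , q⁻¹<t′) x≤y = subst₂ ℚ._<_ [pq⁻¹]q≡p (ℚ.*-identityˡ q) (ℚ.*-monoˡ-<-pos q {{q>0}} pq⁻¹<1)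
  where
  open ℚ-Solver
  q⁻¹ = inv q q>0
  k   = suc i ℕ.* suc j
  z   = x ℚ.* (1ℤ / k)

  b≤b : 1ℚ ℚ.+ (ℚ.- y) ℚ.* (1ℤ / suc i) ℚ.≤ 1ℚ ℚ.+ (ℚ.- x) ℚ.* (1ℤ / suc i)
  b≤b = ℚ.+-monoʳ-≤ 1ℚ (ℚ.*-monoʳ-≤-nonNeg (1ℤ / suc i)
    {{ℚ.normalize-nonNeg 1 (suc i)}} (ℚ.neg-antimono-≤ x≤y))

  refine⁺ = term-refine x i j 0<b
  refine⁻ = term-refine (ℚ.- x) j i (ℚ.<-≤-trans 0<b′ b≤b)

  -z≡ : (ℚ.- x) ℚ.* (1ℤ / (suc j ℕ.* suc i)) ≡ ℚ.- z
  -z≡ = trans (cong (ℚ.- x ℚ.*_) (recip-comm i j)) (sym (ℚ.neg-distribˡ-* x (1ℤ / k)))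

  0≤1-z : 0ℚ ℚ.≤ 1ℚ ℚ.+ ℚ.- z
  0≤1-z = subst (λ w → 0ℚ ℚ.≤ 1ℚ ℚ.+ w) -z≡ (proj₁ refine⁻)

  q⁻¹< : q⁻¹ ℚ.< (1ℚ ℚ.+ ℚ.- z) ^ℚ k
  q⁻¹< = ℚ.<-≤-trans q⁻¹<t′ (ℚ.≤-trans
    (^ℚ-mono-≤ (suc i) (ℚ.<⇒≤ 0<b′) b≤b)
    (subst₂ (λ w l → term (ℚ.- x) i ℚ.≤ (1ℚ ℚ.+ w) ^ℚ l) -z≡ (ℕ.*-comm (suc j) (suc i)) (proj₂ refine⁻)))

  pq⁻¹<1 : p ℚ.* q⁻¹ ℚ.< 1ℚ
  pq⁻¹<1 = ℚ.<-≤-trans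
    (*-mono-<ℚ 0<p (ℚ.<-trans (0<inv q q>0) q⁻¹<) (ℚ.<⇒≤ (ℚ.<-≤-trans p<t (proj₂ refine⁺))) q⁻¹<)
    (term-*-term≤1 z k (proj₁ refine⁺) 0≤1-z)

  [pq⁻¹]q≡p : p ℚ.* q⁻¹ ℚ.* q ≡ p
  [pq⁻¹]q≡p = trans (ℚ.*-assoc p q⁻¹ q) (trans (cong (p ℚ.*_) (inv-inverse q q>0)) (ℚ.*-identityʳ p))

<exp⇒<>exp : ∀ {p q x y} → p <exp x → q >exp y → x ℚ.≤ y → p ℚ.< q
<exp⇒<>exp {p} {q} p<eˣ eʸ<q x≤y = case p ℚ.≤? 0ℚ of λ where
  (yes p≤0) → ℚ.≤-<-trans p≤0 (ℚ.positive⁻¹ q {{proj₁ eʸ<q}})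
  (no p≰0)  → 0<⇒<exp⇒<>exp (ℚ.≰⇒> p≰0) p<eˣ eʸ<q x≤y

-- The witness for `p` also serves for its power: multiplying both the argument and the number of
-- factors by i + 1 leaves the base 1 + x/(j + 1) unchanged.
<exp-^ : ∀ {p x} i → 0ℚ ℚ.≤ p → p <exp x → (p ^ℚ suc i) <exp (ι (suc i) ℚ.* x)
<exp-^ {p} {x} i 0≤p (j , 0<b , p<t) =
  j ℕ.+ i ℕ.* suc j , subst (0ℚ ℚ.<_) b≡ 0<b , (begin-strict
    p ^ℚ suc i
      <⟨ ^ℚ-mono-< i 0≤p p<t ⟩
    (b ^ℚ suc j) ^ℚ suc i
      ≡⟨ ^ℚ.^-assocʳ b (suc j) (suc i) ⟩
    b ^ℚ (suc j ℕ.* suc i)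
      ≡⟨ cong₂ _^ℚ_ b≡ (ℕ.*-comm (suc j) (suc i)) ⟩
    (1ℚ ℚ.+ ι (suc i) ℚ.* x ℚ.* K⁻¹) ^ℚ (suc i ℕ.* suc j) ∎)
  where
  open ℚ.≤-Reasoning
  open ℚ-Solver
  b   = 1ℚ ℚ.+ x ℚ.* (1ℤ / suc j)
  K⁻¹ = 1ℤ / (suc i ℕ.* suc j)
  b≡ : b ≡ 1ℚ ℚ.+ ι (suc i) ℚ.* x ℚ.* K⁻¹
  b≡ = cong (1ℚ ℚ.+_) (trans (cong (x ℚ.*_) (sym (recip-* i j)))
    (solve 3 (λ x I K → x :* (I :* K) := I :* x :* K) refl x (ι (suc i)) K⁻¹))

>exp-^ : ∀ {q x} i → q >exp x → (q ^ℚ suc i) >exp (ι (suc i) ℚ.* x)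
>exp-^ {q} {x} i (q>0 , q⁻¹<) = q^>0 , subst₂ _<exp_ q⁻¹^≡ (sym (ℚ.neg-distribʳ-* (ι (suc i)) x))
  (<exp-^ i (ℚ.<⇒≤ (0<inv q q>0)) q⁻¹<)
  where
  q^>0 : ℚ.Positive (q ^ℚ suc i)
  q^>0 = ℚ.positive (0<^ℚ (suc i) (ℚ.positive⁻¹ q {{q>0}}))
  q⁻¹^≡ : inv q q>0 ^ℚ suc i ≡ inv (q ^ℚ suc i) q^>0
  q⁻¹^≡ = inv-unique q^>0 (trans (sym (^ℚ-distrib-* (inv q q>0) q (suc i)))
    (trans (cong (_^ℚ suc i) (inv-inverse q q>0)) (1^ℚ (suc i))))

2<exp1 : ι 2 <exp 1ℚ
2<exp1 = subst (_<exp 1ℚ) (sym (ι≡/1 2))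
  (1 , from-yes (0ℚ ℚ.<? + 3 / 2) , from-yes (+ 2 / 1 ℚ.<? + 9 / 4))

4>exp1 : ι 4 >exp 1ℚ
4>exp1 = subst (_>exp 1ℚ) (sym (ι≡/1 4))
  -- 1/4 < e^(-1) by the term for k = 3; for k = 1 the base is 0, and for k = 2 the term is exactly
  -- 1/4.
  (_ , 2 , from-yes (0ℚ ℚ.<? + 2 / 3) , from-yes (+ 1 / 4 ℚ.<? + 8 / 27))

-- Together with the next lemma this reduces all numerics to powers of 2 and 4: e^n < 4^n here, 2^n
-- < e^n there.
<exp⇒<4^ : ∀ {q t} n → q <exp t → t ℚ.≤ ι (suc n) → q ℚ.< ι (4 ℕ.^ suc n)
<exp⇒<4^ {q} {t} n q<eᵗ t≤n = <exp⇒<>exp {q} {ι (4 ℕ.^ suc n)} {t} {ι (suc n)} q<eᵗ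
  (subst₂ _>exp_ (sym (ι-homo-^ 4 (suc n))) (ℚ.*-identityʳ (ι (suc n))) (>exp-^ {ι 4} {1ℚ} n 4>exp1)) t≤n

>exp⇒<ι : ∀ {q t} n → q >exp t → q ℚ.≤ ι (2 ℕ.^ suc n) → t ℚ.< ι (suc n)
>exp⇒<ι {q} {t} n q>eᵗ q≤2^n = ℚ.≰⇒> λ n≤t → <⇒≱ℚ
  (<exp⇒<>exp {ι (2 ℕ.^ suc n)} {q} {ι (suc n)} {t}
    (subst₂ _<exp_ (sym (ι-homo-^ 2 (suc n))) (ℚ.*-identityʳ (ι (suc n))) (<exp-^ {ι 2} {1ℚ} n (0≤ι 2) 2<exp1))
    q>eᵗ n≤t) q≤2^n

-- Weighted sums and bounds on the number of elements of a predicate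

module BoundedCounts where
  open import Data.Nat.Base
  open import Data.Nat.Properties
  open import Data.Nat.DivMod using (m/n*n≤m; m*n/n≡m) renaming (_/_ to _div_)

  private variable
    A B S : Set

  ∑ : List S → (S → ℕ) → ℕ
  ∑ []       f = 0
  ∑ (x ∷ xs) f = f x + ∑ xs f

  ∑-mono : ∀ (xs : List S) {f g : S → ℕ} → (∀ x → x ∈ˡ xs → f x ≤ g x) → ∑ xs f ≤ ∑ xs g
  ∑-mono []       f≤g = z≤n
  ∑-mono (x ∷ xs) f≤g = +-mono-≤ (f≤g x (here refl)) (∑-mono xs (λ y → f≤g y ∘ there))

  ∑-*ˡ : ∀ (xs : List S) c (f : S → ℕ) → ∑ xs (λ x → c * f x) ≡ c * ∑ xs f
  ∑-*ˡ []       c f = sym (*-zeroʳ c)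
  ∑-*ˡ (x ∷ xs) c f = trans (cong (_+_ (c * f x)) (∑-*ˡ xs c f)) (sym (*-distribˡ-+ c (f x) (∑ xs f)))

  ∑-const : ∀ (xs : List S) c → ∑ xs (λ _ → c) ≡ length xs * c
  ∑-const []       c = refl
  ∑-const (x ∷ xs) c = cong (_+_ c) (∑-const xs c)

  ∑-map : ∀ (h : A → B) xs (f : B → ℕ) → ∑ (map h xs) f ≡ ∑ xs (f ∘ h)
  ∑-map h []       f = refl
  ∑-map h (x ∷ xs) f = cong (_+_ (f (h x))) (∑-map h xs f)

  ∑-++ : ∀ (xs ys : List S) f → ∑ (xs List.++ ys) f ≡ ∑ xs f + ∑ ys f
  ∑-++ []       ys f = refl
  ∑-++ (x ∷ xs) ys f = trans (cong (_+_ (f x)) (∑-++ xs ys f)) (sym (+-assoc (f x) (∑ xs f) (∑ ys f)))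

  ∑-cartesianProductWith : ∀ {C : Set} (h : A → B → C) xs ys (f : C → ℕ) →
    ∑ (List.cartesianProductWith h xs ys) f ≡ ∑ xs (λ x → ∑ ys (λ y → f (h x y)))
  ∑-cartesianProductWith h []       ys f = refl
  ∑-cartesianProductWith h (x ∷ xs) ys f = trans
    (∑-++ (map (h x) ys) _ f)
    (cong₂ _+_ (∑-map (h x) ys f) (∑-cartesianProductWith h xs ys f))

  Bounded : Pred S _ → ℕ → Set
  Bounded {S} P N = (L : List S) → Unique L → All P L → length L ≤ N

  bounded-mono : ∀ {P Q : S → Set} {M N} → (∀ {x} → P x → Q x) → M ≤ N → Bounded Q M → Bounded P N
  bounded-mono P⊆Q M≤N bQ L uL pL = ≤-trans (bQ L uL (All.map P⊆Q pL)) M≤N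

  bounded-∅ : ∀ {P : S → Set} → (∀ x → ¬ P x) → Bounded P 0
  bounded-∅ ∅ []      _  _        = z≤n
  bounded-∅ ∅ (x ∷ L) _  (px ∷ _) = contradiction px (∅ x)

  bounded-injection : ∀ {P : A → Set} {Q : B → Set} {N} (f : A → B) → (∀ {x} → P x → Q (f x)) →
    (∀ {x y} → P x → P y → f x ≡ f y → x ≡ y) → Bounded Q N → Bounded P N
  bounded-injection {P = P} f P⇒Q inj bQ L uL pL =
    subst (_≤ _) (List.length-map f L) (bQ (map f L) (unique uL pL) (All.map⁺ (All.map P⇒Q pL)))
    where
    unique : ∀ {L} → Unique L → All P L → Unique (map f L)
    unique []         []         = []
    unique (x≢ ∷ uL) (px ∷ pL) =
      All.map⁺ (All.zipWith (λ (x≢y , py) fx≡fy → x≢y (inj px py fx≡fy)) (x≢ , pL)) ∷ unique uL pL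

  -- The last component, for arbitrary `R`, says that both parts come from `L`. It carries the
  -- freshness condition of `Unique` through the recursion.
  partition⊎ : ∀ {P Q : S → Set} {L} → Unique L → All (λ x → P x ⊎ Q x) L →
    ∃[ L₁ ] ∃[ L₂ ] Unique L₁ × All P L₁ × Unique L₂ × All Q L₂ ×
      length L ≡ length L₁ + length L₂ × (∀ {R : S → Set} → All R L → All R L₁ × All R L₂)
  partition⊎ [] [] = [] , [] , [] , [] , [] , [] , refl , λ _ → [] , []
  partition⊎ (x≢ ∷ uL) (inj₁ px ∷ pqL) =
    let L₁ , L₂ , u₁ , p₁ , u₂ , q₂ , eq , sub = partition⊎ uL pqL in
    _ ∷ L₁ , L₂ , proj₁ (sub x≢) ∷ u₁ , px ∷ p₁ , u₂ , q₂ , cong suc eq ,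
    λ { (rx ∷ rL) → rx ∷ proj₁ (sub rL) , proj₂ (sub rL) }
  partition⊎ (x≢ ∷ uL) (inj₂ qx ∷ pqL) =
    let L₁ , L₂ , u₁ , p₁ , u₂ , q₂ , eq , sub = partition⊎ uL pqL in
    L₁ , _ ∷ L₂ , u₁ , p₁ , proj₂ (sub x≢) ∷ u₂ , qx ∷ q₂ ,
    trans (cong suc eq) (sym (+-suc (length L₁) (length L₂))) ,
    λ { (rx ∷ rL) → proj₁ (sub rL) , rx ∷ proj₂ (sub rL) }

  bounded-⋃ : ∀ {P : A → Set} (ys : List B) (R : B → A → Set) (w : B → ℕ) →
    (∀ y → y ∈ˡ ys → Bounded (R y) (w y)) → (∀ {x} → P x → ∃[ y ] y ∈ˡ ys × R y x) → Bounded P (∑ ys w)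
  bounded-⋃ [] R w bR P⇒R = bounded-∅ λ x px → case proj₁ (proj₂ (P⇒R px)) of λ ()
  bounded-⋃ {A = A} {P = P} (y ∷ ys) R w bR P⇒R L uL pL =
    let L₁ , L₂ , u₁ , p₁ , u₂ , q₂ , eq , _ = partition⊎ uL (All.map split pL) in
    subst (_≤ w y + ∑ ys w) (sym eq) (+-mono-≤
      (bR y (here refl) L₁ u₁ p₁)
      (bounded-⋃ ys R w (λ z → bR z ∘ there) id L₂ u₂ q₂))
    where
    split : ∀ {x} → P x → R y x ⊎ ∃[ z ] z ∈ˡ ys × R z x
    split px with P⇒R px
    ... | _ , here refl , r = inj₁ r
    ... | z , there z∈ , r = inj₂ (z , z∈ , r)

  -- The union runs only over the values that `f` takes on the given list, so `Q` is never
  -- enumerated; removing duplicates from these values lets the bound for `Q` apply.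
  bounded-fibres : ∀ {P : A → Set} {Q : B → Set} {M N} (_≟_ : DecidableEquality B) (f : A → B) →
    (∀ {x} → P x → Q (f x)) → Bounded Q M →
    (∀ y → Bounded (λ x → P x × f x ≡ y) N) → Bounded P (M * N)
  bounded-fibres {P = P} {M = M} {N} _≟_ f P⇒Q bQ bN L uL pL = begin
    length L          ≤⟨ bounded-⋃ ys (λ y x → P x × f x ≡ y) (λ _ → N) (λ y _ → bN y)
                           (λ (x∈ , px) → f _ , Mem.∈-deduplicate⁺ _≟_ (Mem.∈-map⁺ f x∈) , px , refl)
                           L uL (All.tabulate (λ x∈ → x∈ , All.lookup pL x∈)) ⟩
    ∑ ys (λ _ → N)    ≡⟨ ∑-const ys N ⟩
    length ys * N     ≤⟨ *-monoˡ-≤ N (bQ ys (DecUnique.deduplicate-! _≟_ (map f L))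
                           (All.deduplicate⁺ _≟_ (All.map⁺ (All.map P⇒Q pL)))) ⟩
    M * N             ∎
    where
    open ≤-Reasoning
    ys = deduplicate _≟_ (map f L)

  bounded-interval : ∀ a N → Bounded (λ x → a ≤ x × x < a + N) N
  bounded-interval a zero = bounded-∅ λ x (a≤x , x<a) → <⇒≱ x<a (subst (_≤ x) (sym (+-identityʳ a)) a≤x)
  bounded-interval a (suc N) = subst (Bounded _) eq (bounded-⋃ (downFrom (suc N))
    (λ i x → x ≡ a + i) (λ _ → 1) (λ i _ → single (a + i)) cover)
    where
    single : ∀ y → Bounded (_≡ y) 1
    single y []          _                 _                   = z≤n
    single y (x ∷ [])    _                 _                   = s≤s z≤n
    single y (x ∷ z ∷ L) ((x≢z ∷ _) ∷ _) (refl ∷ refl ∷ _) = contradiction refl x≢z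
    eq : ∑ (downFrom (suc N)) (λ _ → 1) ≡ suc N
    eq = trans (∑-const (downFrom (suc N)) 1)
           (trans (*-identityʳ _) (List.length-downFrom (suc N)))
    cover : ∀ {x} → a ≤ x × x < a + suc N → ∃[ i ] i ∈ˡ downFrom (suc N) × x ≡ a + i
    cover {x} (a≤x , x<) = x ∸ a ,
      Mem.∈-downFrom⁺ (+-cancelˡ-< a _ _ (subst (_< a + suc N) (sym (m+[n∸m]≡n a≤x)) x<)) ,
      sym (m+[n∸m]≡n a≤x)

  ∏ : ∀ {n} → (Fin n → ℕ) → ℕ
  ∏ {zero}  f = 1
  ∏ {suc n} f = f zero * ∏ (f ∘ suc)

  bounded-Vec : ∀ {n} (P : Fin n → A → Set) (N : Fin n → ℕ) → DecidableEquality A → (∀ i → Bounded (P i) (N i)) →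
    Bounded (λ v → ∀ i → P i (lookup v i)) (∏ N)
  bounded-Vec {n = zero}  P N _≟_ b = bounded-mono (λ {v} _ → refl) ≤-refl single
    where
    single : Bounded {Vec _ 0} (λ v → v ≡ v) 1
    single []          _                _ = z≤n
    single (x ∷ [])    _                _ = s≤s z≤n
    single ([] ∷ [] ∷ L) ((x≢z ∷ _) ∷ _) _ = contradiction refl x≢z
  bounded-Vec {n = suc n} P N _≟_ b = bounded-fibres _≟_ Vec.head
    (λ { {x ∷ v} p → p zero }) (b zero)
    (λ y → bounded-injection Vec.tail
      (λ { {x ∷ v} (p , _) → p ∘ suc })
      (λ { {x ∷ v} {x′ ∷ v′} (_ , refl) (_ , refl) refl → refl })
      (bounded-Vec (P ∘ suc) (N ∘ suc) _≟_ (b ∘ suc)))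

  dyadic : ∀ X → ∃[ x ] 2 ^ x ≤ suc X × suc X < 2 ^ suc x
  dyadic zero    = 0 , ≤-refl , ≤-refl
  dyadic (suc X) with dyadic X
  ... | x , 2^x≤ , <2^ with suc (suc X) <? 2 ^ suc x
  ... | yes <2^′ = x , ≤-trans 2^x≤ (n≤1+n _) , <2^′
  ... | no ≮2^   = suc x , ≮⇒≥ ≮2^ ,
    <-≤-trans (s≤s <2^) (≤-trans (+-monoʳ-≤ 1 (≤-refl {2 ^ suc x}))
      (≤-trans (+-monoˡ-≤ (2 ^ suc x) (m^n>0 2 (suc x))) (≤-reflexive (cong (_+_ (2 ^ suc x)) (sym (+-identityʳ _))))))

  lg : ℕ → ℕ
  lg X = proj₁ (dyadic (pred X))

  2^lg≤ : ∀ {X} → 1 ≤ X → 2 ^ lg X ≤ X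
  2^lg≤ {suc X} _ = proj₁ (proj₂ (dyadic X))

  <2^1+lg : ∀ {X} → 1 ≤ X → X < 2 ^ suc (lg X)
  <2^1+lg {suc X} _ = proj₂ (proj₂ (dyadic X))

  ∏-cong : ∀ {n} {f g : Fin n → ℕ} → (∀ i → f i ≡ g i) → ∏ f ≡ ∏ g
  ∏-cong {zero}  f≡g = refl
  ∏-cong {suc n} f≡g = cong₂ _*_ (f≡g zero) (∏-cong (f≡g ∘ suc))

  ∏-* : ∀ {n} (f g : Fin n → ℕ) → ∏ f * ∏ g ≡ ∏ (λ i → f i * g i)
  ∏-* {zero}  f g = refl
  ∏-* {suc n} f g = trans (assoc (f zero) (∏ (f ∘ suc)) (g zero) (∏ (g ∘ suc)))
    (cong (f zero * g zero *_) (∏-* (f ∘ suc) (g ∘ suc)))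
    where
    assoc : ∀ a b c d → a * b * (c * d) ≡ a * c * (b * d)
    assoc = solve-∀

  ∏-const : ∀ n c → ∏ {n} (λ _ → c) ≡ c ^ n
  ∏-const zero    c = refl
  ∏-const (suc n) c = cong (c *_) (∏-const n c)

  ∏2^≡2^sum : ∀ {n} (v : Vec ℕ n) → ∏ (λ i → 2 ^ lookup v i) ≡ 2 ^ Vec.sum v
  ∏2^≡2^sum []      = refl
  ∏2^≡2^sum (x ∷ v) = trans (cong (2 ^ x *_) (∏2^≡2^sum v)) (sym (^-distribˡ-+-* 2 x (Vec.sum v)))

  -- Turns the weight 1 + |c| into a product over coordinates, so that the sum over the box of all
  -- `c` factors.
  1+sum≤∏ : ∀ {n} (v : Vec ℕ n) → suc (Vec.sum v) ≤ ∏ (λ i → suc (lookup v i))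
  1+sum≤∏ []      = ≤-refl
  1+sum≤∏ (x ∷ v) = ≤-trans
    (≤-trans (m≤m+n _ (x * Vec.sum v)) (≤-reflexive (expand x (Vec.sum v))))
    (*-monoʳ-≤ (suc x) (1+sum≤∏ v))
    where
    expand : ∀ x s → suc (x + s) + x * s ≡ suc x * suc s
    expand = solve-∀

  ^-distribʳ-* : ∀ n a b → (a * b) ^ n ≡ a ^ n * b ^ n
  ^-distribʳ-* n a b = trans (sym (∏-const n (a * b)))
    (trans (sym (∏-* {n} (λ _ → a) (λ _ → b))) (cong₂ _*_ (∏-const n a) (∏-const n b)))

  box : ℕ → ∀ n → List (Vec ℕ n)
  box m zero    = [] ∷ []
  box m (suc n) = List.cartesianProductWith _∷_ (downFrom (suc m)) (box m n)

  ∈-box : ∀ {m n} (c : Vec ℕ n) → (∀ i → lookup c i ≤ m) → c ∈ˡ box m n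
  ∈-box []      c≤m = here refl
  ∈-box (x ∷ c) c≤m = Mem.∈-cartesianProductWith⁺ _∷_
    (Mem.∈-downFrom⁺ (s≤s (c≤m zero))) (∈-box c (c≤m ∘ suc))

  box-≤ : ∀ {m n} {c : Vec ℕ n} → c ∈ˡ box m n → ∀ i → lookup c i ≤ m
  box-≤ {m} {suc n} c∈ i with Mem.∈-cartesianProductWith⁻ _∷_ (downFrom (suc m)) (box m n) c∈
  box-≤ {m} {suc n} c∈ zero    | x , c , x∈ , c∈′ , refl = s≤s⁻¹ (Mem.∈-downFrom⁻ x∈)
  box-≤ {m} {suc n} c∈ (suc i) | x , c , x∈ , c∈′ , refl = box-≤ c∈′ i

  ∑-box : ∀ m n (g : ℕ → ℕ) → ∑ (box m n) (λ c → ∏ (λ i → g (lookup c i))) ≡ ∑ (downFrom (suc m)) g ^ n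
  ∑-box m zero    g = refl
  ∑-box m (suc n) g = begin
    ∑ (box m (suc n)) (λ c → ∏ (λ i → g (lookup c i)))
      ≡⟨ ∑-cartesianProductWith _∷_ xs (box m n) _ ⟩
    ∑ xs (λ x → ∑ (box m n) (λ c → g x * ∏ (λ i → g (lookup c i))))
      ≡⟨ ∑-cong xs (λ x → trans (∑-*ˡ (box m n) (g x) _) (*-comm (g x) _)) ⟩
    ∑ xs (λ x → ∑ (box m n) (λ c → ∏ (λ i → g (lookup c i))) * g x)
      ≡⟨ ∑-*ˡ xs (∑ (box m n) (λ c → ∏ (λ i → g (lookup c i)))) g ⟩
    ∑ (box m n) (λ c → ∏ (λ i → g (lookup c i))) * ∑ xs g
      ≡⟨ cong (_* ∑ xs g) (∑-box m n g) ⟩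
    ∑ xs g ^ n * ∑ xs g
      ≡⟨ *-comm (∑ xs g ^ n) (∑ xs g) ⟩
    ∑ xs g ^ suc n ∎
    where
    open ≡-Reasoning
    xs = downFrom (suc m)
    ∑-cong : ∀ (ys : List ℕ) {f h : ℕ → ℕ} → (∀ y → f y ≡ h y) → ∑ ys f ≡ ∑ ys h
    ∑-cong []       f≡h = refl
    ∑-cong (y ∷ ys) f≡h = cong₂ _+_ (f≡h y) (∑-cong ys f≡h)

  -- The finite form of Σ (c + 1) / 2^c = 4.
  ∑[1+c]2^[m∸c] : ∀ m → ∑ (downFrom (suc m)) (λ c → suc c * 2 ^ (m ∸ c)) ≤ 4 * 2 ^ m
  ∑[1+c]2^[m∸c] m = ≤-trans (m≤m+n _ (3 + m)) (strengthened m)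
    where
    open ≤-Reasoning
    weight : ℕ → ℕ → ℕ
    weight m c = suc c * 2 ^ (m ∸ c)
    rearrange₁ : ∀ m s → (2 + m) * 1 + 2 * s + (4 + m) ≡ 2 * (s + (3 + m))
    rearrange₁ = solve-∀
    rearrange₂ : ∀ a b → a * (2 * b) ≡ 2 * (a * b)
    rearrange₂ = solve-∀
    double : ∀ m c → c ∈ˡ downFrom (suc m) → weight (suc m) c ≤ 2 * weight m c
    double m c c∈ = ≤-reflexive (trans
      (cong (λ e → suc c * 2 ^ e) (+-∸-assoc 1 (s≤s⁻¹ (Mem.∈-downFrom⁻ c∈))))
      (rearrange₂ (suc c) (2 ^ (m ∸ c))))
    -- The term 3 + m makes the induction exact: passing to m + 1 doubles the sum and adds the
    -- summand m + 2, and (m + 2) + (m + 4) = 2 (m + 3).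
    strengthened : ∀ m → ∑ (downFrom (suc m)) (weight m) + (3 + m) ≤ 4 * 2 ^ m
    strengthened zero    = ≤-refl
    strengthened (suc m) = begin
      (2 + m) * 2 ^ (m ∸ m) + ∑ (downFrom (suc m)) (weight (suc m)) + (4 + m)
        ≤⟨ +-monoˡ-≤ (4 + m) (+-mono-≤
             (≤-reflexive (cong (λ e → (2 + m) * 2 ^ e) (n∸n≡0 m)))
             (≤-trans (∑-mono (downFrom (suc m)) (double m)) (≤-reflexive (∑-*ˡ (downFrom (suc m)) 2 (weight m))))) ⟩
      (2 + m) * 1 + 2 * ∑ (downFrom (suc m)) (weight m) + (4 + m)
        ≡⟨ rearrange₁ m (∑ (downFrom (suc m)) (weight m)) ⟩
      2 * (∑ (downFrom (suc m)) (weight m) + (3 + m))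
        ≤⟨ *-monoʳ-≤ 2 (strengthened m) ⟩
      2 * (4 * 2 ^ m)
        ≡⟨ sym (rearrange₂ 4 (2 ^ m)) ⟩
      4 * 2 ^ suc m ∎

  -- The weight 2^k concentrates at k near m, so the bound `M / (k + 1)` on `g k` acts like
  -- `M / (m + 1)` up to a constant. This is what preserves the saving of a logarithm when k is
  -- summed.
  ∑2^k-harmonic : ∀ (g : ℕ → ℕ) M m → (∀ k → k ≤ m → g k * suc k ≤ M) →
    ∑ (downFrom (suc m)) (λ k → 2 ^ k * g k) * suc m ≤ 4 * 2 ^ m * M
  ∑2^k-harmonic g M zero g≤ = ≤-trans (≤-reflexive (rearrange (g 0)))
    (≤-trans (g≤ 0 z≤n) (m≤n*m M 4))
    where
    rearrange : ∀ a → (1 * a + 0) * 1 ≡ a * 1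
    rearrange = solve-∀
  ∑2^k-harmonic g M (suc zero) g≤ = ≤-trans (≤-reflexive (rearrange₁ (g 0) (g 1)))
    (≤-trans (+-mono-≤ (*-monoʳ-≤ 2 (g≤ 1 ≤-refl)) (*-monoʳ-≤ 2 (g≤ 0 z≤n)))
    (≤-trans (m≤m+n _ (4 * M)) (≤-reflexive (rearrange₂ M))))
    where
    rearrange₁ : ∀ a b → (2 * b + (1 * a + 0)) * 2 ≡ 2 * (b * 2) + 2 * (a * 1)
    rearrange₁ = solve-∀
    rearrange₂ : ∀ M → 2 * M + 2 * M + 4 * M ≡ 4 * 2 * M
    rearrange₂ = solve-∀
  -- The induction uses 2 (m + 2) ≤ 3 (m + 1), which fails for m = 0; hence the separate clause for
  -- 1 above.
  ∑2^k-harmonic g M (suc m@(suc m′)) g≤ = *-cancelˡ-≤ 2 (begin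
    2 * ((2 ^ suc m * g (suc m) + s) * (2 + m))
      ≡⟨ rearrange₁ (2 ^ m) (g (suc m)) s m ⟩
    4 * 2 ^ m * (g (suc m) * (2 + m)) + s * (4 + 2 * m)
      ≤⟨ +-mono-≤ (*-monoʳ-≤ (4 * 2 ^ m) (g≤ (suc m) ≤-refl)) (*-monoʳ-≤ s 4+2m≤3+3m) ⟩
    4 * 2 ^ m * M + s * (3 * suc m)
      ≡⟨ cong (_+_ (4 * 2 ^ m * M)) (rearrange₂ s m) ⟩
    4 * 2 ^ m * M + 3 * (s * suc m)
      ≤⟨ +-monoʳ-≤ (4 * 2 ^ m * M) (*-monoʳ-≤ 3 (∑2^k-harmonic g M m (λ k k≤m → g≤ k (m≤n⇒m≤1+n k≤m)))) ⟩
    4 * 2 ^ m * M + 3 * (4 * 2 ^ m * M)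
      ≡⟨ rearrange₃ (2 ^ m) M ⟩
    2 * (4 * 2 ^ suc m * M) ∎)
    where
    open ≤-Reasoning
    s = ∑ (downFrom (suc m)) (λ k → 2 ^ k * g k)
    rearrange₁ : ∀ p b s m → 2 * ((2 * p * b + s) * (2 + m)) ≡ 4 * p * (b * (2 + m)) + s * (4 + 2 * m)
    rearrange₁ = solve-∀
    rearrange₂ : ∀ s m → s * (3 * suc m) ≡ 3 * (s * suc m)
    rearrange₂ = solve-∀
    rearrange₃ : ∀ p M → 4 * p * M + 3 * (4 * p * M) ≡ 2 * (4 * (2 * p) * M)
    rearrange₃ = solve-∀
    rearrange₄ : ∀ m → 4 + 2 * suc m + m ≡ 3 * suc (suc m)
    rearrange₄ = solve-∀
    4+2m≤3+3m : 4 + 2 * m ≤ 3 * suc m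
    4+2m≤3+3m = ≤-trans (m≤m+n _ m′) (≤-reflexive (rearrange₄ m′))

  -- The integer part of 2^(k - j): the power itself for j ≤ k, and 0 for j > k. With k = |t| and j
  -- = |c| it is 2^|x|.
  2^_/2^_ : ℕ → ℕ → ℕ
  2^ k /2^ j = (2 ^ k div 2 ^ j) {{m^n≢0 2 j}}

  2^/2^-* : ∀ k j → 2 ^ j * (2^ k /2^ j) ≤ 2 ^ k
  2^/2^-* k j = ≤-trans (≤-reflexive (*-comm (2 ^ j) _)) (m/n*n≤m (2 ^ k) (2 ^ j) {{m^n≢0 2 j}})

  2^/2^-+ : ∀ i j → 2^ (i + j) /2^ j ≡ 2 ^ i
  2^/2^-+ i j = trans (cong (λ e → (e div 2 ^ j) {{m^n≢0 2 j}}) (^-distribˡ-+-* 2 i j))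
    (m*n/n≡m (2 ^ i) (2 ^ j) {{m^n≢0 2 j}})

  -- The count for one ray ρ′: `F k μ` stands for the relations `t` with |t| = k and t_ρ′ ≤ μ, the
  -- quotient for the vectors `X` above each of them, and Λ + K |c| for the bound on t_ρ′.
  weightedSum : (F : ℕ → ℕ → ℕ) (n m K Λ : ℕ) → ℕ
  weightedSum F n m K Λ = ∑ (box m n) (λ c →
    ∑ (downFrom (suc m)) (λ k → F k (Λ + K * Vec.sum c) * (2^ k /2^ Vec.sum c)))

  -- Multiplying by (2^m)^n clears the denominators 2^|c|, since every entry of c is at most m.
  weightedSum-≤ : ∀ F n m K Λ κ r → (∀ k μ → F k μ * suc k ≤ κ * suc k ^ r * suc μ) →
    weightedSum F n m K Λ * suc m ≤ 4 ^ suc n * κ * (suc Λ + K) * (2 ^ m * suc m ^ r)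
  weightedSum-≤ F n m K Λ κ r F≤ = *-cancelˡ-≤ ((2 ^ m) ^ n) {{m^n≢0 (2 ^ m) n {{m^n≢0 2 m}}}} (begin
    Q * (∑ (box m n) inner * suc m)
      ≡⟨ trans (reorder₁ Q (∑ (box m n) inner) (suc m)) (sym (∑-*ˡ (box m n) (Q * suc m) inner)) ⟩
    ∑ (box m n) (λ c → Q * suc m * inner c)
      ≤⟨ ∑-mono (box m n) per-c ⟩
    ∑ (box m n) (λ c → D * ∏ (λ i → suc (lookup c i) * 2 ^ (m ∸ lookup c i)))
      ≡⟨ ∑-*ˡ (box m n) D _ ⟩
    D * ∑ (box m n) (λ c → ∏ (λ i → suc (lookup c i) * 2 ^ (m ∸ lookup c i)))
      ≡⟨ cong (D *_) (∑-box m n (λ c → suc c * 2 ^ (m ∸ c))) ⟩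
    D * ∑ (downFrom (suc m)) (λ c → suc c * 2 ^ (m ∸ c)) ^ n
      ≤⟨ *-monoʳ-≤ D (^-monoˡ-≤ n (∑[1+c]2^[m∸c] m)) ⟩
    D * (4 * 2 ^ m) ^ n
      ≡⟨ cong (D *_) (^-distribʳ-* n 4 (2 ^ m)) ⟩
    D * (4 ^ n * Q)
      ≡⟨ reorder₂ (2 ^ m) κ (suc m ^ r) (suc Λ + K) (4 ^ n) Q ⟩
    Q * (4 ^ suc n * κ * (suc Λ + K) * (2 ^ m * suc m ^ r)) ∎)
    where
    open ≤-Reasoning
    Q = (2 ^ m) ^ n
    D = 4 * 2 ^ m * (κ * suc m ^ r * (suc Λ + K))
    ks = downFrom (suc m)
    inner : Vec ℕ n → ℕ
    inner c = ∑ ks (λ k → F k (Λ + K * Vec.sum c) * (2^ k /2^ Vec.sum c))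
    reorder₁ : ∀ a b c → a * (b * c) ≡ a * c * b
    reorder₁ = solve-∀
    reorder₂ : ∀ p κ q l f Q → 4 * p * (κ * q * l) * (f * Q) ≡ Q * (4 * f * κ * l * (p * q))
    reorder₂ = solve-∀
    reorder₃ : ∀ a b c d → a * b * c * d ≡ a * (b * d) * c
    reorder₃ = solve-∀
    reorder₅ : ∀ w p κ q l u → w * (4 * p * (κ * q * (l * u))) ≡ 4 * p * (κ * q * l) * (u * w)
    reorder₅ = solve-∀
    expand : ∀ Λ K s → suc (Λ + K * s) + (s + Λ * s + K) ≡ (suc Λ + K) * suc s
    expand = solve-∀

    per-c : ∀ c → c ∈ˡ box m n →
      Q * suc m * inner c ≤ D * ∏ (λ i → suc (lookup c i) * 2 ^ (m ∸ lookup c i))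
    per-c c c∈ = begin
      Q * suc m * inner c
        ≡⟨ cong (λ q → q * suc m * inner c) Q≡ ⟩
      W * 2 ^ s * suc m * inner c
        ≡⟨ trans (reorder₃ W (2 ^ s) (suc m) (inner c)) (cong (λ e → W * e * suc m) (sym (∑-*ˡ ks (2 ^ s) _))) ⟩
      W * ∑ ks (λ k → 2 ^ s * (F k μ * (2^ k /2^ s))) * suc m
        ≤⟨ *-monoˡ-≤ (suc m) (*-monoʳ-≤ W (∑-mono ks (λ k _ → ≤-trans
             (≤-reflexive (reorder₆ (2 ^ s) (F k μ) (2^ k /2^ s)))
             (*-monoˡ-≤ (F k μ) (2^/2^-* k s))))) ⟩
      W * ∑ ks (λ k → 2 ^ k * F k μ) * suc m
        ≡⟨ *-assoc W _ (suc m) ⟩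
      W * (∑ ks (λ k → 2 ^ k * F k μ) * suc m)
        ≤⟨ *-monoʳ-≤ W (∑2^k-harmonic (λ k → F k μ) M m F≤M) ⟩
      W * (4 * 2 ^ m * M)
        ≤⟨ *-monoʳ-≤ W (*-monoʳ-≤ (4 * 2 ^ m) (*-monoʳ-≤ (κ * suc m ^ r) μ≤)) ⟩
      W * (4 * 2 ^ m * (κ * suc m ^ r * ((suc Λ + K) * U)))
        ≡⟨ reorder₅ W (2 ^ m) κ (suc m ^ r) (suc Λ + K) U ⟩
      D * (U * W)
        ≡⟨ cong (D *_) (∏-* (λ i → suc (lookup c i)) (λ i → 2 ^ (m ∸ lookup c i))) ⟩
      D * ∏ (λ i → suc (lookup c i) * 2 ^ (m ∸ lookup c i)) ∎
      where
      s = Vec.sum c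
      μ = Λ + K * s
      M = κ * suc m ^ r * suc μ
      W = ∏ (λ i → 2 ^ (m ∸ lookup c i))
      U = ∏ (λ i → suc (lookup c i))
      reorder₆ : ∀ a f h → a * (f * h) ≡ (a * h) * f
      reorder₆ = solve-∀
      Q≡ : Q ≡ W * 2 ^ s
      Q≡ = sym (trans (cong (W *_) (sym (∏2^≡2^sum c))) (trans
        (∏-* (λ i → 2 ^ (m ∸ lookup c i)) (λ i → 2 ^ lookup c i)) (trans
        (∏-cong (λ i → trans (sym (^-distribˡ-+-* 2 (m ∸ lookup c i) (lookup c i)))
          (cong (2 ^_) (m∸n+n≡m (box-≤ c∈ i)))))
        (∏-const n (2 ^ m)))))
      F≤M : ∀ k → k ≤ m → F k μ * suc k ≤ M
      F≤M k k≤m = ≤-trans (F≤ k μ) (*-monoˡ-≤ (suc μ) (*-monoʳ-≤ κ (^-monoˡ-≤ r (s≤s k≤m))))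
      μ≤ : suc μ ≤ (suc Λ + K) * U
      μ≤ = ≤-trans (≤-trans (m≤m+n _ _) (≤-reflexive (expand Λ K s))) (*-monoʳ-≤ (suc Λ + K) (1+sum≤∏ c))

open BoundedCounts

-- Lattices and fans

sum-zero : ∀ {n} (f : Vector ℤ n) → (∀ i → f i ≡ 0ℤ) → Σℤ.sum f ≡ 0ℤ
sum-zero {n} f f≡0 = trans (Σℤ.sum-cong-≗ f≡0) (Σℤ.sum-replicate-zero n)

sum-linear : ∀ {n} x y (f g : Vector ℤ n) →
  Σℤ.sum (λ i → x ℤ.* f i ℤ.+ y ℤ.* g i) ≡ x ℤ.* Σℤ.sum f ℤ.+ y ℤ.* Σℤ.sum g
sum-linear x y f g = trans (Σℤ.∑-distrib-+ (λ i → x ℤ.* f i) (λ i → y ℤ.* g i))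
  (sym (cong₂ ℤ._+_ (Σℤ.*-distribˡ-sum x f) (Σℤ.*-distribˡ-sum y g)))

lincomb-linear : ∀ {n d} (u : Fin n → Lattice d) x y (a b : Vector ℤ n) i →
  lincomb u (λ ρ → x ℤ.* a ρ ℤ.+ y ℤ.* b ρ) i ≡ x ℤ.* lincomb u a i ℤ.+ y ℤ.* lincomb u b i
lincomb-linear u x y a b i = trans
  (Σℤ.sum-cong-≗ (λ ρ → distrib x y (a ρ) (b ρ) (u ρ i)))
  (sum-linear x y (λ ρ → a ρ ℤ.* u ρ i) (λ ρ → b ρ ℤ.* u ρ i))
  where
  distrib : ∀ x y a b c → (x ℤ.* a ℤ.+ y ℤ.* b) ℤ.* c ≡ x ℤ.* (a ℤ.* c) ℤ.+ y ℤ.* (b ℤ.* c)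
  distrib = ℤ-solve-∀

lincomb-δ : ∀ {n d} (u : Fin n → Lattice d) ρ i → lincomb u (λ ρ′ → δ ρ′ ρ) i ≡ u ρ i
lincomb-δ u ρ i = trans (Σℤ.sum-cong-≗ (λ ρ′ → ℤ.*-comm (δ ρ′ ρ) (u ρ′ i))) (δ-sum (λ ρ′ → u ρ′ i) ρ)

⟨,lincomb⟩ : ∀ {n d} (m : Lattice d) (u : Fin n → Lattice d) c →
  ⟨ m , lincomb u c ⟩ ≡ Σℤ.sum (λ ρ → c ρ ℤ.* ⟨ m , u ρ ⟩)
⟨,lincomb⟩ m u c = begin
  Σℤ.sum (λ i → m i ℤ.* Σℤ.sum (λ ρ → c ρ ℤ.* u ρ i))
    ≡⟨ Σℤ.sum-cong-≗ (λ i → Σℤ.*-distribˡ-sum (m i) (λ ρ → c ρ ℤ.* u ρ i)) ⟩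
  Σℤ.sum (λ i → Σℤ.sum (λ ρ → m i ℤ.* (c ρ ℤ.* u ρ i)))
    ≡⟨ Σℤ.∑-comm (λ i ρ → m i ℤ.* (c ρ ℤ.* u ρ i)) ⟩
  Σℤ.sum (λ ρ → Σℤ.sum (λ i → m i ℤ.* (c ρ ℤ.* u ρ i)))
    ≡⟨ Σℤ.sum-cong-≗ (λ ρ → trans (Σℤ.sum-cong-≗ (λ i → swap (m i) (c ρ) (u ρ i)))
         (sym (Σℤ.*-distribˡ-sum (c ρ) (λ i → m i ℤ.* u ρ i)))) ⟩
  Σℤ.sum (λ ρ → c ρ ℤ.* ⟨ m , u ρ ⟩) ∎
  where
  open ≡-Reasoning
  swap : ∀ a b c → a ℤ.* (b ℤ.* c) ≡ b ℤ.* (a ℤ.* c)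
  swap = ℤ-solve-∀

⟨,⟩-congʳ : ∀ {d} (m : Lattice d) {v w} → v ≗ w → ⟨ m , v ⟩ ≡ ⟨ m , w ⟩
⟨,⟩-congʳ m v≗w = Σℤ.sum-cong-≗ (λ i → cong (m i ℤ.*_) (v≗w i))

∣p∣≡1+∣p∖x∣ : ∀ {n} {x : Fin n} {p : Subset n} → x ∈ p → ∣ p ∣ ≡ suc ∣ p ∖ x ∣
∣p∣≡1+∣p∖x∣ {x = zero}  {p = _ ∷ p}       here       = cong suc (cong ∣_∣ (sym (p─⊥≡p p)))
∣p∣≡1+∣p∖x∣ {x = suc x} {p = inside ∷ p}  (there x∈p) = cong suc (∣p∣≡1+∣p∖x∣ x∈p)
∣p∣≡1+∣p∖x∣ {x = suc x} {p = outside ∷ p} (there x∈p) = ∣p∣≡1+∣p∖x∣ x∈p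

Supported-δ : ∀ {n} {σ : Subset n} {ρ} → ρ ∈ σ → Supported σ (λ ρ′ → δ ρ′ ρ)
Supported-δ {ρ = ρ} ρ∈σ ρ′ ρ′∉σ with ρ′ Fin.≟ ρ
... | yes refl = contradiction ρ∈σ ρ′∉σ
... | no _     = refl

δ-refl : ∀ {n} (ρ : Fin n) → δ ρ ρ ≡ 1ℤ
δ-refl ρ with ρ Fin.≟ ρ
... | yes _  = refl
... | no ρ≢ρ = contradiction refl ρ≢ρ

δ-≢ : ∀ {n} {ρ ρ′ : Fin n} → ρ ≢ ρ′ → δ ρ ρ′ ≡ 0ℤ
δ-≢ {ρ = ρ} {ρ′} ρ≢ρ′ with ρ Fin.≟ ρ′
... | yes eq = contradiction eq ρ≢ρ′
... | no _   = refl

*-nonZero : ∀ {i j} → i ≢ 0ℤ → j ≢ 0ℤ → i ℤ.* j ≢ 0ℤ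
*-nonZero {i} i≢0 j≢0 ij≡0 = [ i≢0 , j≢0 ]′ (ℤ.i*j≡0⇒i≡0∨j≡0 i ij≡0)

-- Gaussian elimination on the first coordinate.
dependent : ∀ r {n} (v : Fin n → Lattice r) (τ : Subset n) → r ℕ.< ∣ τ ∣ →
  ∃[ b ] Supported τ b × (∀ i → lincomb v b i ≡ 0ℤ) × ∃[ ρ ] b ρ ≢ 0ℤ
dependent zero {n} v τ 0<∣τ∣ = case nonempty? τ of λ where
  (yes (ρ , ρ∈τ)) → (λ ρ′ → δ ρ′ ρ) , Supported-δ ρ∈τ , (λ ()) , ρ ,
    λ δ≡0 → contradiction (trans (sym (δ-refl ρ)) δ≡0) λ ()
  (no τ-empty) → contradiction
    (subst (0 ℕ.<_) (trans (cong ∣_∣ (Empty-unique τ-empty)) (∣⊥∣≡0 n)) 0<∣τ∣) λ ()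
dependent (suc r) v τ r<∣τ∣
  with Fin.any? (λ ρ → (ρ ∈? τ) ×-dec ¬? (v ρ zero ℤ.≟ 0ℤ))
... | no no-pivot =
  let b , supp , b-rel , nz = dependent r (λ ρ i → v ρ (suc i)) τ (ℕ.<-trans (ℕ.n<1+n r) r<∣τ∣) in
  b , supp , (λ { zero → sum-zero _ (first b supp) ; (suc i) → b-rel i }) , nz
  where
  first : ∀ b → Supported τ b → ∀ ρ → b ρ ℤ.* v ρ zero ≡ 0ℤ
  first b supp ρ with ρ ∈? τ
  ... | no ρ∉τ = trans (cong (ℤ._* v ρ zero) (supp ρ ρ∉τ)) (ℤ.*-zeroˡ (v ρ zero))
  ... | yes ρ∈τ with v ρ zero ℤ.≟ 0ℤ
  ...   | yes v≡0 = trans (cong (b ρ ℤ.*_) v≡0) (ℤ.*-zeroʳ (b ρ))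
  ...   | no v≢0  = contradiction (ρ , ρ∈τ , v≢0) no-pivot
... | yes (p , p∈τ , vp≢0) =
  b , supp , relation , ρ₀ , bρ₀≢0
  where
  x = v p zero
  v′ : _ → Lattice r
  v′ ρ i = x ℤ.* v ρ (suc i) ℤ.+ (ℤ.- v p (suc i)) ℤ.* v ρ zero
  ih = dependent r v′ (τ ∖ p) (ℕ.s<s⁻¹ (subst (suc r ℕ.<_) (∣p∣≡1+∣p∖x∣ p∈τ) r<∣τ∣))
  b′ = proj₁ ih
  supp′ = proj₁ (proj₂ ih)
  ρ₀ = proj₁ (proj₂ (proj₂ (proj₂ ih)))
  -- Elimination without fractions: `b′` is scaled by the pivot entry `x`, and `y` is the
  -- coefficient of the pivot vector that cancels the first coordinate. Since `b′` vanishes at `p`,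
  -- its nonzero entry at `ρ₀` survives.
  y = ℤ.- lincomb v b′ zero
  b : Vector ℤ _
  b ρ = x ℤ.* b′ ρ ℤ.+ y ℤ.* δ ρ p

  lincomb-b : ∀ i → lincomb v b i ≡ x ℤ.* lincomb v b′ i ℤ.+ y ℤ.* v p i
  lincomb-b i = trans (lincomb-linear v x y b′ (λ ρ → δ ρ p) i)
    (cong (λ w → x ℤ.* lincomb v b′ i ℤ.+ y ℤ.* w) (lincomb-δ v p i))

  lincomb-v′ : ∀ i → lincomb v′ b′ i ≡ x ℤ.* lincomb v b′ (suc i) ℤ.+ (ℤ.- v p (suc i)) ℤ.* lincomb v b′ zero
  lincomb-v′ i = trans
    (Σℤ.sum-cong-≗ (λ ρ → distrib (b′ ρ) x (v ρ (suc i)) (ℤ.- v p (suc i)) (v ρ zero)))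
    (sum-linear x (ℤ.- v p (suc i)) (λ ρ → b′ ρ ℤ.* v ρ (suc i)) (λ ρ → b′ ρ ℤ.* v ρ zero))
    where
    distrib : ∀ b x s y t → b ℤ.* (x ℤ.* s ℤ.+ y ℤ.* t) ≡ x ℤ.* (b ℤ.* s) ℤ.+ y ℤ.* (b ℤ.* t)
    distrib = ℤ-solve-∀

  relation : ∀ i → lincomb v b i ≡ 0ℤ
  relation zero = trans (lincomb-b zero) (cancel x (lincomb v b′ zero))
    where
    cancel : ∀ x l → x ℤ.* l ℤ.+ (ℤ.- l) ℤ.* x ≡ 0ℤ
    cancel = ℤ-solve-∀
  relation (suc i) = trans (lincomb-b (suc i)) (trans
    (swap x (lincomb v b′ (suc i)) (lincomb v b′ zero) (v p (suc i)))
    (trans (sym (lincomb-v′ i)) (proj₁ (proj₂ (proj₂ ih)) i)))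
    where
    swap : ∀ x l l₀ w → x ℤ.* l ℤ.+ (ℤ.- l₀) ℤ.* w ≡ x ℤ.* l ℤ.+ (ℤ.- w) ℤ.* l₀
    swap = ℤ-solve-∀

  supp : Supported τ b
  supp ρ ρ∉τ = trans
    (cong₂ (λ s t → x ℤ.* s ℤ.+ y ℤ.* t) (supp′ ρ (ρ∉τ ∘ p─q⊆p τ _)) (Supported-δ p∈τ ρ ρ∉τ))
    (vanish x y)
    where
    vanish : ∀ x y → x ℤ.* 0ℤ ℤ.+ y ℤ.* 0ℤ ≡ 0ℤ
    vanish = ℤ-solve-∀

  b′ρ₀≢0 = proj₂ (proj₂ (proj₂ (proj₂ ih)))

  ρ₀≢p : ρ₀ ≢ p
  ρ₀≢p ρ₀≡p = b′ρ₀≢0 (supp′ ρ₀ λ ρ₀∈ → x∉p∖x (subst (_∈ τ ∖ p) ρ₀≡p ρ₀∈))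
    where
    x∉p∖x : ∀ {n} {x : Fin n} {p : Subset n} → x ∉ p ∖ x
    x∉p∖x {x = zero}  {inside ∷ p}  ()
    x∉p∖x {x = zero}  {outside ∷ p} ()
    x∉p∖x {x = suc x} {s ∷ p} (there x∈) = x∉p∖x x∈

  bρ₀≢0 : b ρ₀ ≢ 0ℤ
  bρ₀≢0 bρ₀≡0 = *-nonZero vp≢0 b′ρ₀≢0 (trans (sym (trans
    (cong (λ t → x ℤ.* b′ ρ₀ ℤ.+ y ℤ.* t) (δ-≢ ρ₀≢p)) (drop (x ℤ.* b′ ρ₀) y))) bρ₀≡0)
    where
    drop : ∀ s y → s ℤ.+ y ℤ.* 0ℤ ≡ s
    drop = ℤ-solve-∀

module _ {n d} {u : Fin n → Lattice d} {σ : Subset n} (b : IsBasis u σ) where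
  open IsBasis b
  open DualBasis b

  Supported-relation : ∀ c → Supported σ c → (∀ i → lincomb u c i ≡ 0ℤ) → ∀ ρ → c ρ ≡ 0ℤ
  Supported-relation c supp rel = unique c (λ _ → 0ℤ) supp (λ _ _ → refl)
    λ i → trans (rel i) (sym (sum-zero _ λ ρ → ℤ.*-zeroˡ (u ρ i)))

  ⟨,⟩-coord : ∀ m v → ⟨ m , v ⟩ ≡ Σℤ.sum (λ ρ → coord v ρ ℤ.* ⟨ m , u ρ ⟩)
  ⟨,⟩-coord m v = trans (⟨,⟩-congʳ m (λ i → sym (expand v i))) (⟨,lincomb⟩ m u (coord v))

  form-ext : ∀ m m′ → (∀ ρ → ρ ∈ σ → ⟨ m , u ρ ⟩ ≡ ⟨ m′ , u ρ ⟩) → ∀ v → ⟨ m , v ⟩ ≡ ⟨ m′ , v ⟩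
  form-ext m m′ eq v = trans (⟨,⟩-coord m v) (trans (Σℤ.sum-cong-≗ same) (sym (⟨,⟩-coord m′ v)))
    where
    same : ∀ ρ → coord v ρ ℤ.* ⟨ m , u ρ ⟩ ≡ coord v ρ ℤ.* ⟨ m′ , u ρ ⟩
    same ρ with ρ ∈? σ
    ... | yes ρ∈σ = cong (coord v ρ ℤ.*_) (eq ρ ρ∈σ)
    ... | no ρ∉σ  = trans (cong (ℤ._* ⟨ m , u ρ ⟩) (supported v ρ ρ∉σ))
                      (sym (cong (ℤ._* ⟨ m′ , u ρ ⟩) (supported v ρ ρ∉σ)))

  ⟨ones,⟩ : ∀ v → ⟨ ones , v ⟩ ≡ Σℤ.sum (coord v)
  ⟨ones,⟩ v = trans (⟨,⟩-coord ones v) (Σℤ.sum-cong-≗ same)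
    where
    same : ∀ ρ → coord v ρ ℤ.* ⟨ ones , u ρ ⟩ ≡ coord v ρ
    same ρ with ρ ∈? σ
    ... | yes ρ∈σ = trans (cong (coord v ρ ℤ.*_) (ones-spec ρ ρ∈σ)) (ℤ.*-identityʳ (coord v ρ))
    ... | no ρ∉σ  = trans (cong (ℤ._* ⟨ ones , u ρ ⟩) (supported v ρ ρ∉σ)) (sym (supported v ρ ρ∉σ))

  coord-neg : ∀ v w → (∀ i → v i ≡ ℤ.- w i) → ∀ ρ → coord v ρ ≡ ℤ.- coord w ρ
  coord-neg v w v≡-w = unique (coord v) (λ ρ → ℤ.- coord w ρ) (supported v)
    (λ ρ ρ∉σ → cong ℤ.-_ (supported w ρ ρ∉σ))
    λ i → trans (expand v i) (trans (v≡-w i) (sym (trans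
      (Σℤ.sum-cong-≗ (λ ρ → pointwise (coord w ρ) (u ρ i)))
      (trans (sum-linear (ℤ.- 1ℤ) 0ℤ (λ ρ → coord w ρ ℤ.* u ρ i) (λ _ → 0ℤ))
        (trans (collapse (lincomb u (coord w) i) (Σℤ.sum {n} (λ _ → 0ℤ)))
          (cong ℤ.-_ (expand w i)))))))
    where
    pointwise : ∀ a b → (ℤ.- a) ℤ.* b ≡ (ℤ.- 1ℤ) ℤ.* (a ℤ.* b) ℤ.+ 0ℤ ℤ.* 0ℤ
    pointwise = ℤ-solve-∀
    collapse : ∀ a z → (ℤ.- 1ℤ) ℤ.* a ℤ.+ 0ℤ ℤ.* z ≡ ℤ.- a
    collapse = ℤ-solve-∀

  coord-u : ∀ {ρ} → ρ ∈ σ → coord (u ρ) ρ ≡ 1ℤ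
  coord-u {ρ} ρ∈σ = trans (sym (⟨dual,-⟩ ρ (u ρ))) (trans (dual-spec ρ ρ ρ∈σ) (δ-refl ρ))

  private
    sum-/1 : ∀ {k} (f : Vector ℤ k) → Σℤ.sum f / 1 ≡ Σℚ.sum (λ i → f i / 1)
    sum-/1 {zero}  f = refl
    sum-/1 {suc k} f = trans (/1-homo-+ (f zero) (Σℤ.sum (f ∘ suc))) (cong (f zero / 1 ℚ.+_) (sum-/1 (f ∘ suc)))

    0≤sum : ∀ {k} (f : Vector ℚ k) → (∀ i → 0ℚ ℚ.≤ f i) → 0ℚ ℚ.≤ Σℚ.sum f
    0≤sum {zero}  f 0≤f = ℚ.≤-refl
    0≤sum {suc k} f 0≤f = ℚ.+-mono-≤ (0≤f zero) (0≤sum (f ∘ suc) (0≤f ∘ suc))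

  -- Membership in the cone supplies rational coefficients, while `coord` is integral. Pairing with
  -- a dual basis vector avoids identifying the two: it writes `coord v ρ′` as a sum of nonnegative
  -- rationals.
  coord-nonNeg : ∀ v → InCone u σ (λ i → v i / 1) → ∀ ρ → 0ℤ ℤ.≤ coord v ρ
  coord-nonNeg v (c , 0≤c , c-supp , expand-c) ρ′ = /1-cancel-≤ (subst (0ℚ ℚ.≤_) (sym coord≡) (0≤sum _ nonNeg))
    where
    open ≡-Reasoning
    m = dual ρ′
    coord≡ : coord v ρ′ / 1 ≡ Σℚ.sum (λ ρ → c ρ ℚ.* (⟨ m , u ρ ⟩ / 1))
    coord≡ = begin
      coord v ρ′ / 1
        ≡⟨ cong (_/ 1) (sym (⟨dual,-⟩ ρ′ v)) ⟩
      ⟨ m , v ⟩ / 1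
        ≡⟨ sum-/1 (λ i → m i ℤ.* v i) ⟩
      Σℚ.sum (λ i → (m i ℤ.* v i) / 1)
        ≡⟨ Σℚ.sum-cong-≗ (λ i → trans (/1-homo-* (m i) (v i)) (cong (m i / 1 ℚ.*_) (sym (expand-c i)))) ⟩
      Σℚ.sum (λ i → m i / 1 ℚ.* Σℚ.sum (λ ρ → c ρ ℚ.* (u ρ i / 1)))
        ≡⟨ Σℚ.sum-cong-≗ (λ i → Σℚ.*-distribˡ-sum (m i / 1) (λ ρ → c ρ ℚ.* (u ρ i / 1))) ⟩
      Σℚ.sum (λ i → Σℚ.sum (λ ρ → m i / 1 ℚ.* (c ρ ℚ.* (u ρ i / 1))))
        ≡⟨ Σℚ.∑-comm (λ i ρ → m i / 1 ℚ.* (c ρ ℚ.* (u ρ i / 1))) ⟩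
      Σℚ.sum (λ ρ → Σℚ.sum (λ i → m i / 1 ℚ.* (c ρ ℚ.* (u ρ i / 1))))
        ≡⟨ Σℚ.sum-cong-≗ (λ ρ → trans
             (Σℚ.sum-cong-≗ (λ i → trans (swap (m i / 1) (c ρ) (u ρ i / 1))
               (cong (c ρ ℚ.*_) (sym (/1-homo-* (m i) (u ρ i))))))
             (trans (sym (Σℚ.*-distribˡ-sum (c ρ) (λ i → (m i ℤ.* u ρ i) / 1)))
               (cong (c ρ ℚ.*_) (sym (sum-/1 (λ i → m i ℤ.* u ρ i)))))) ⟩
      Σℚ.sum (λ ρ → c ρ ℚ.* (⟨ m , u ρ ⟩ / 1)) ∎
      where
      swap : ∀ a b c → a ℚ.* (b ℚ.* c) ≡ b ℚ.* (a ℚ.* c)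
      swap a b c = trans (sym (ℚ.*-assoc a b c)) (trans (cong (ℚ._* c) (ℚ.*-comm a b)) (ℚ.*-assoc b a c))
    nonNeg : ∀ ρ → 0ℚ ℚ.≤ c ρ ℚ.* (⟨ m , u ρ ⟩ / 1)
    nonNeg ρ with ρ ∈? σ
    ... | no ρ∉σ  = ℚ.≤-reflexive (sym (trans (cong (ℚ._* (⟨ m , u ρ ⟩ / 1)) (c-supp ρ ρ∉σ)) (ℚ.*-zeroˡ (⟨ m , u ρ ⟩ / 1))))
    ... | yes ρ∈σ = 0≤*ℚ (0≤c ρ) (/1-mono-≤ {0ℤ} (subst (0ℤ ℤ.≤_) (sym (dual-spec ρ′ ρ ρ∈σ)) 0≤δ))
      where
      0≤δ : 0ℤ ℤ.≤ δ ρ′ ρ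
      0≤δ with ρ′ Fin.≟ ρ
      ... | yes _ = ℤ.+≤+ ℕ.z≤n
      ... | no _  = ℤ.≤-refl

module _ {d n : ℕ} (Δ : Fan d n) where
  open Fan Δ

  private
    Bigger : Subset n → Subset n → Set
    Bigger σ τ = Cone τ × σ ⊂ τ

    bigger? : ∀ σ τ → Dec (Bigger σ τ)
    bigger? σ τ = cone? τ ×-dec σ ⊂? τ

    no-bigger⇒maximal : ∀ {σ} → Cone σ → ¬ ∃ (Bigger σ) → Maximal Δ σ
    no-bigger⇒maximal {σ} cσ none = cσ , λ τ cτ σ⊆τ → ⊆-antisym σ⊆τ λ {ρ} ρ∈τ →
      case ρ ∈? σ of λ where
        (yes ρ∈σ) → ρ∈σ
        (no ρ∉σ)  → ⊥-elim (none (τ , cτ , σ⊆τ , ρ , ρ∈τ , ρ∉σ))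

  maximal? : ∀ σ → Dec (Maximal Δ σ)
  maximal? σ with cone? σ | anySubset? (bigger? σ)
  ... | no ¬cσ | _      = no (¬cσ ∘ proj₁)
  ... | yes cσ | no none = yes (no-bigger⇒maximal cσ none)
  ... | yes cσ | yes (τ , cτ , σ⊆τ , ρ , ρ∈τ , ρ∉σ) =
    no λ (_ , max) → ρ∉σ (subst (ρ ∈_) (sym (max τ cτ σ⊆τ)) ρ∈τ)

  -- `k` is fuel: each step enlarges the cone strictly, and no cone has more than `n` rays.
  extend-maximal : ∀ k σ → n ℕ.≤ k ℕ.+ ∣ σ ∣ → Cone σ → ∃[ τ ] Maximal Δ τ × σ ⊆ τ
  extend-maximal k σ n≤ cσ with anySubset? (bigger? σ)
  ... | no none = σ , no-bigger⇒maximal cσ none , id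
  extend-maximal zero σ n≤ cσ | yes (τ , cτ , σ⊂τ) =
    contradiction (ℕ.≤-trans (p⊂q⇒∣p∣<∣q∣ σ⊂τ) (ℕ.≤-trans (∣p∣≤n τ) n≤)) (ℕ.<-irrefl refl)
  extend-maximal (suc k) σ n≤ cσ | yes (τ , cτ , σ⊂τ) =
    let υ , υ-max , τ⊆υ = extend-maximal k τ
          (ℕ.≤-trans n≤ (ℕ.≤-trans (ℕ.≤-reflexive (sym (ℕ.+-suc k ∣ σ ∣))) (ℕ.+-monoʳ-≤ k (p⊂q⇒∣p∣<∣q∣ σ⊂τ)))) cτ
    in υ , υ-max , τ⊆υ ∘ proj₁ σ⊂τ

  InCone-mono : ∀ {σ τ v} → σ ⊆ τ → InCone ray σ v → InCone ray τ v
  InCone-mono σ⊆τ (c , 0≤c , supp , exp-c) = c , 0≤c , (λ ρ ρ∉τ → supp ρ (ρ∉τ ∘ σ⊆τ)) , exp-c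

  module _ (regular : Regular Δ) where
    open IsBasis
    open DualBasis

    maximal-cover : Complete Δ → ∀ v → ∃[ σ ] Σ (Maximal Δ σ) λ σ-max → ∀ ρ → 0ℤ ℤ.≤ coord (regular σ σ-max) v ρ
    maximal-cover complete v =
      let σ , cσ , v∈σ = complete (λ i → v i / 1)
          τ , τ-max , σ⊆τ = extend-maximal n σ (ℕ.m≤m+n n ∣ σ ∣) cσ
      in τ , τ-max , coord-nonNeg (regular τ τ-max) v (InCone-mono σ⊆τ v∈σ)

    D₀-zero : ∀ {σ} (σ-max : Maximal Δ σ) {ρ} → ρ ∈ σ → D₀ Δ regular σ-max ρ ≡ 0ℤ
    D₀-zero {σ} σ-max {ρ} ρ∈σ = cong (ℤ._-_ 1ℤ) (ones-spec (regular σ σ-max) ρ ρ∈σ)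

    -- Both m_σ and the negative of the generating section take the value 1 on the basis given by σ,
    -- so they agree as forms; the section inequality at each ray then gives the claim.
    D₀-nonNeg : GloballyGenerated Δ (-K Δ) → ∀ {σ} (σ-max : Maximal Δ σ) ρ → 0ℤ ℤ.≤ D₀ Δ regular σ-max ρ
    D₀-nonNeg gg {σ} σ-max ρ = ℤ.i≤j⇒0≤j-i (begin
      ⟨ ones b , ray ρ ⟩
        ≡⟨ form-ext b (ones b) (λ i → ℤ.- m i) agree (ray ρ) ⟩
      ⟨ (λ i → ℤ.- m i) , ray ρ ⟩
        ≡⟨ neg-pair (ray ρ) ⟩
      ℤ.- ⟨ m , ray ρ ⟩
        ≤⟨ ℤ.neg-mono-≤ (section ρ) ⟩
      1ℤ ∎)
      where
      open ℤ.≤-Reasoning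
      b = regular σ σ-max
      m = proj₁ (gg σ σ-max)
      section = proj₁ (proj₂ (gg σ σ-max))
      generates = proj₂ (proj₂ (gg σ σ-max))
      neg-pair : ∀ v → ⟨ (λ i → ℤ.- m i) , v ⟩ ≡ ℤ.- ⟨ m , v ⟩
      neg-pair v = trans (Σℤ.sum-cong-≗ (λ i → pointwise (m i) (v i)))
        (trans (sum-linear (ℤ.- 1ℤ) 0ℤ (λ i → m i ℤ.* v i) (λ _ → 0ℤ)) (collapse ⟨ m , v ⟩ (Σℤ.sum {d} (λ _ → 0ℤ))))
        where
        pointwise : ∀ a b → (ℤ.- a) ℤ.* b ≡ (ℤ.- 1ℤ) ℤ.* (a ℤ.* b) ℤ.+ 0ℤ ℤ.* 0ℤ
        pointwise = ℤ-solve-∀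
        collapse : ∀ a z → (ℤ.- 1ℤ) ℤ.* a ℤ.+ 0ℤ ℤ.* z ≡ ℤ.- a
        collapse = ℤ-solve-∀
      agree : ∀ ρ → ρ ∈ σ → ⟨ ones b , ray ρ ⟩ ≡ ⟨ (λ i → ℤ.- m i) , ray ρ ⟩
      agree ρ ρ∈σ = trans (ones-spec b ρ ρ∈σ)
        (sym (trans (neg-pair (ray ρ)) (cong ℤ.-_ (generates ρ ρ∈σ))))

    -- A linear form pairs to zero with a relation, so coefficients that differ by a form give the
    -- same sum. Applied to m_σ and to dual basis vectors, this evaluates D₀ and E on relations.
    sum-form : ∀ m (t e : Vector ℤ n) (s : Vector ℤ n) → (∀ i → lincomb ray t i ≡ 0ℤ) →
      (∀ ρ → e ρ ≡ s ρ ℤ.- ⟨ m , ray ρ ⟩) → Σℤ.sum (λ ρ → e ρ ℤ.* t ρ) ≡ Σℤ.sum (λ ρ → t ρ ℤ.* s ρ)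
    sum-form m t e s rel e≡ = begin
      Σℤ.sum (λ ρ → e ρ ℤ.* t ρ)
        ≡⟨ Σℤ.sum-cong-≗ (λ ρ → trans (cong (ℤ._* t ρ) (e≡ ρ)) (expand′ (s ρ) ⟨ m , ray ρ ⟩ (t ρ))) ⟩
      Σℤ.sum (λ ρ → 1ℤ ℤ.* (t ρ ℤ.* s ρ) ℤ.+ (ℤ.- 1ℤ) ℤ.* (t ρ ℤ.* ⟨ m , ray ρ ⟩))
        ≡⟨ sum-linear 1ℤ (ℤ.- 1ℤ) (λ ρ → t ρ ℤ.* s ρ) (λ ρ → t ρ ℤ.* ⟨ m , ray ρ ⟩) ⟩
      1ℤ ℤ.* S ℤ.+ (ℤ.- 1ℤ) ℤ.* Σℤ.sum (λ ρ → t ρ ℤ.* ⟨ m , ray ρ ⟩)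
        ≡⟨ cong (λ z → 1ℤ ℤ.* S ℤ.+ (ℤ.- 1ℤ) ℤ.* z) (trans (sym (⟨,lincomb⟩ m ray t))
             (trans (⟨,⟩-congʳ m rel) (sum-zero {d} _ (λ i → ℤ.*-zeroʳ (m i))))) ⟩
      1ℤ ℤ.* S ℤ.+ (ℤ.- 1ℤ) ℤ.* 0ℤ
        ≡⟨ collapse S ⟩
      S ∎
      where
      open ≡-Reasoning
      S = Σℤ.sum (λ ρ → t ρ ℤ.* s ρ)
      expand′ : ∀ s m t → (s ℤ.- m) ℤ.* t ≡ 1ℤ ℤ.* (t ℤ.* s) ℤ.+ (ℤ.- 1ℤ) ℤ.* (t ℤ.* m)
      expand′ = ℤ-solve-∀
      collapse : ∀ s → 1ℤ ℤ.* s ℤ.+ (ℤ.- 1ℤ) ℤ.* 0ℤ ≡ s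
      collapse = ℤ-solve-∀

    D₀-sum : ∀ {σ} (σ-max : Maximal Δ σ) t → (∀ i → lincomb ray t i ≡ 0ℤ) →
      Σℤ.sum (λ ρ → D₀ Δ regular σ-max ρ ℤ.* t ρ) ≡ Σℤ.sum t
    D₀-sum {σ} σ-max t rel = trans (sum-form (ones (regular σ σ-max)) t (D₀ Δ regular σ-max) (λ _ → 1ℤ) rel (λ _ → refl))
      (Σℤ.sum-cong-≗ (λ ρ → ℤ.*-identityʳ (t ρ)))

    E-sum : ∀ {σ} (σ-max : Maximal Δ σ) {ρ′} → ρ′ ∈ σ → ∀ t → (∀ i → lincomb ray t i ≡ 0ℤ) →
      Σℤ.sum (λ ρ → E Δ regular σ-max ρ′ ρ ℤ.* t ρ) ≡ t ρ′
    E-sum {σ} σ-max {ρ′} ρ′∈σ t rel = trans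
      (sum-form (dual b ρ′) t (E Δ regular σ-max ρ′) (λ ρ → δ ρ ρ′) rel E≡) (δ-sum t ρ′)
      where
      b = regular σ σ-max
      E≡ : ∀ ρ → E Δ regular σ-max ρ′ ρ ≡ δ ρ ρ′ ℤ.- ⟨ dual b ρ′ , ray ρ ⟩
      E≡ ρ with ρ ∈? σ
      ... | yes ρ∈σ = sym (trans
        (cong₂ ℤ._-_ (δ-sym ρ ρ′) (dual-spec b ρ′ ρ ρ∈σ)) (ℤ.+-inverseʳ (δ ρ′ ρ)))
      ... | no ρ∉σ  = sym (trans
        (cong (ℤ._- ⟨ dual b ρ′ , ray ρ ⟩) (δ-≢ {ρ = ρ} {ρ′} (λ { refl → ρ∉σ ρ′∈σ })))
        (ℤ.+-identityˡ (ℤ.- ⟨ dual b ρ′ , ray ρ ⟩)))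

    -- If more than r rays lay off σ, their classes in ℤ^r would be dependent. Such a dependency is
    -- the divisor of some m ∈ M that vanishes on the basis given by σ, so m pairs to zero with
    -- every ray and the dependency is trivial.
    ∣∁σ∣≤r : ∀ {r} → PicardRank Δ r → ∀ {σ} → Maximal Δ σ → ∣ ∁ σ ∣ ℕ.≤ r
    ∣∁σ∣≤r {r} pic {σ} σ-max = ℕ.≮⇒≥ λ r<∣∁σ∣ →
      let c , supp , rel , ρ , cρ≢0 = dependent r class (∁ σ) r<∣∁σ∣
          m , c≡ = Equivalence.to (exact c) rel
      in cρ≢0 (trans (c≡ ρ) (trans
        (form-ext b m (λ _ → 0ℤ) (λ ρ′ ρ′∈σ → trans
          (trans (sym (c≡ ρ′)) (supp ρ′ (x∈p⇒x∉∁p ρ′∈σ))) (sym (zero-pair (ray ρ′)))) (ray ρ))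
        (zero-pair (ray ρ))))
      where
      open PicardRank pic
      b = regular σ σ-max
      zero-pair : ∀ (v : Lattice d) → ⟨ (λ _ → 0ℤ) , v ⟩ ≡ 0ℤ
      zero-pair v = sum-zero _ (λ i → ℤ.*-zeroˡ (v i))

-- Relations among the rays with prescribed total and one small coordinate

update : ∀ {n} → (Fin n → ℕ) → Fin n → ℕ → Fin n → ℕ
update f i v j = if does (j Fin.≟ i) then v else f j

update-≢ : ∀ {n} (f : Fin n → ℕ) {i j} v → j ≢ i → update f i v j ≡ f j
update-≢ f {i} {j} v j≢i with j Fin.≟ i
... | yes j≡i = contradiction j≡i j≢i
... | no _    = refl

update-elim : ∀ {n} (P : Fin n → ℕ → Set) f i v → P i v → (∀ j → j ≢ i → P j (f j)) → ∀ j → P j (update f i v j)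
update-elim P f i v pi pj j with j Fin.≟ i
... | yes refl = pi
... | no j≢i   = pj j j≢i

∏-update : ∀ {n} (f : Fin n → ℕ) i v → ∏ (update f i v) ℕ.* f i ≡ ∏ f ℕ.* v
∏-update {suc n} f zero v = swap v (∏ (f ∘ suc)) (f zero)
  where
  swap : ∀ v p f → v ℕ.* p ℕ.* f ≡ f ℕ.* p ℕ.* v
  swap = solve-∀
∏-update {suc n} f (suc i) v = trans
  (ℕ.*-assoc (f zero) (∏ (update (f ∘ suc) i v)) (f (suc i)))
  (trans (cong (f zero ℕ.*_) (∏-update (f ∘ suc) i v)) (sym (ℕ.*-assoc (f zero) (∏ (f ∘ suc)) v)))

∏-outside : ∀ {n} (σ : Subset n) k → ∏ (λ ρ → if does (ρ ∈? σ) then 1 else k) ≡ k ℕ.^ ∣ ∁ σ ∣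
∏-outside []            k = refl
∏-outside (inside ∷ σ)  k = trans (ℕ.+-identityʳ _) (∏-outside σ k)
∏-outside (outside ∷ σ) k = cong (k ℕ.*_) (∏-outside σ k)

⟦_⟧ : ∀ {n} → Vec ℕ n → Vector ℤ n
⟦ t ⟧ ρ = + lookup t ρ

sum-⟦⟧ : ∀ {n} (t : Vec ℕ n) → Σℤ.sum ⟦ t ⟧ ≡ + Vec.sum t
sum-⟦⟧ []      = refl
sum-⟦⟧ (x ∷ t) = cong (ℤ._+_ (+ x)) (sum-⟦⟧ t)

lookup≤sum : ∀ {n} (t : Vec ℕ n) i → lookup t i ℕ.≤ Vec.sum t
lookup≤sum (x ∷ t) zero    = ℕ.m≤m+n x (Vec.sum t)
lookup≤sum (x ∷ t) (suc i) = ℕ.≤-trans (lookup≤sum t i) (ℕ.m≤n+m (Vec.sum t) x)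

lookup-injective : ∀ {n} {s t : Vec ℕ n} → (∀ i → lookup s i ≡ lookup t i) → s ≡ t
lookup-injective {s = s} {t} eq =
  trans (sym (Vec.tabulate∘lookup s)) (trans (Vec.tabulate-cong eq) (Vec.tabulate∘lookup t))

sum-single : ∀ {n} (f : Vector ℤ n) i → (∀ j → j ≢ i → f j ≡ 0ℤ) → Σℤ.sum f ≡ f i
sum-single f i f≡0 = trans (Σℤ.sum-cong-≗ pointwise) (δ-sum f i)
  where
  pointwise : ∀ j → f j ≡ f j ℤ.* δ j i
  pointwise j with j Fin.≟ i
  ... | yes _  = sym (ℤ.*-identityʳ (f j))
  ... | no j≢i = trans (f≡0 j j≢i) (sym (ℤ.*-zeroʳ (f j)))

sum-nonPos : ∀ {n} (f : Vector ℤ n) → (∀ i → f i ℤ.≤ 0ℤ) → Σℤ.sum f ℤ.≤ 0ℤ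
sum-nonPos {zero}  f f≤0 = ℤ.≤-refl
sum-nonPos {suc n} f f≤0 = ℤ.+-mono-≤ (f≤0 zero) (sum-nonPos (f ∘ suc) (f≤0 ∘ suc))

module Relations {d n : ℕ} (Δ : Fan d n) (regular : Regular Δ) where
  open Fan Δ
  open IsBasis
  open DualBasis

  IsRelation : Vec ℕ n → Set
  IsRelation t = ∀ i → lincomb ray ⟦ t ⟧ i ≡ 0ℤ

  Slice : Fin n → ℕ → ℕ → Vec ℕ n → Set
  Slice ρ k μ t = IsRelation t × Vec.sum t ≡ k × lookup t ρ ℕ.≤ μ

  module _ {σ} (σ-max : Maximal Δ σ) where
    private
      b = regular σ σ-max
      a = D₀ Δ regular σ-max

    -- The difference `u` vanishes off σ except perhaps at `ρ₀`. Its total is 0 and equals Σ a_ρ u_ρ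
    -- = a_ρ₀ u_ρ₀, because a vanishes on σ. So `u` is a relation supported on a basis, hence 0.
    relation-determined : ∀ {ρ₀} → ρ₀ ∉ σ → a ρ₀ ≢ 0ℤ → ∀ {s t} → IsRelation s → IsRelation t →
      Vec.sum s ≡ Vec.sum t → (∀ ρ → ρ ∉ σ → ρ ≢ ρ₀ → lookup s ρ ≡ lookup t ρ) → s ≡ t
    relation-determined {ρ₀} ρ₀∉σ aρ₀≢0 {s} {t} s-rel t-rel sum≡ agree =
      lookup-injective (λ ρ → ℤ.+-injective (ℤ.i-j≡0⇒i≡j (⟦ s ⟧ ρ) (⟦ t ⟧ ρ)
        (trans (sym (u≡ (⟦ s ⟧ ρ) (⟦ t ⟧ ρ))) (Supported-relation b u u-supp u-rel ρ))))
      where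
      u : Vector ℤ n
      u ρ = 1ℤ ℤ.* ⟦ s ⟧ ρ ℤ.+ (ℤ.- 1ℤ) ℤ.* ⟦ t ⟧ ρ
      u≡ : ∀ x y → 1ℤ ℤ.* x ℤ.+ (ℤ.- 1ℤ) ℤ.* y ≡ x ℤ.- y
      u≡ = ℤ-solve-∀
      u-rel : ∀ i → lincomb ray u i ≡ 0ℤ
      u-rel i = trans (lincomb-linear ray 1ℤ (ℤ.- 1ℤ) ⟦ s ⟧ ⟦ t ⟧ i)
        (trans (u≡ (lincomb ray ⟦ s ⟧ i) (lincomb ray ⟦ t ⟧ i)) (cong₂ ℤ._-_ (s-rel i) (t-rel i)))
      u-zero : ∀ ρ → ρ ∉ σ → ρ ≢ ρ₀ → u ρ ≡ 0ℤ
      u-zero ρ ρ∉σ ρ≢ρ₀ = trans (u≡ (⟦ s ⟧ ρ) (⟦ t ⟧ ρ))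
        (ℤ.i≡j⇒i-j≡0 {⟦ s ⟧ ρ} {⟦ t ⟧ ρ} (cong +_ (agree ρ ρ∉σ ρ≢ρ₀)))
      au≡0 : ∀ ρ → ρ ≢ ρ₀ → a ρ ℤ.* u ρ ≡ 0ℤ
      au≡0 ρ ρ≢ρ₀ with ρ ∈? σ
      ... | yes ρ∈σ = trans (cong (ℤ._* u ρ) (D₀-zero Δ regular σ-max ρ∈σ)) (ℤ.*-zeroˡ (u ρ))
      ... | no ρ∉σ  = trans (cong (a ρ ℤ.*_) (u-zero ρ ρ∉σ ρ≢ρ₀)) (ℤ.*-zeroʳ (a ρ))
      uρ₀≡0 : u ρ₀ ≡ 0ℤ
      uρ₀≡0 with u ρ₀ ℤ.≟ 0ℤ
      ... | yes eq = eq
      ... | no uρ₀≢0 = contradiction (begin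
        a ρ₀ ℤ.* u ρ₀
          ≡⟨ sym (sum-single (λ ρ → a ρ ℤ.* u ρ) ρ₀ au≡0) ⟩
        Σℤ.sum (λ ρ → a ρ ℤ.* u ρ)
          ≡⟨ D₀-sum Δ regular σ-max u u-rel ⟩
        Σℤ.sum u
          ≡⟨ sum-linear 1ℤ (ℤ.- 1ℤ) ⟦ s ⟧ ⟦ t ⟧ ⟩
        1ℤ ℤ.* Σℤ.sum ⟦ s ⟧ ℤ.+ (ℤ.- 1ℤ) ℤ.* Σℤ.sum ⟦ t ⟧
          ≡⟨ u≡ (Σℤ.sum ⟦ s ⟧) (Σℤ.sum ⟦ t ⟧) ⟩
        Σℤ.sum ⟦ s ⟧ ℤ.- Σℤ.sum ⟦ t ⟧
          ≡⟨ ℤ.i≡j⇒i-j≡0 {Σℤ.sum ⟦ s ⟧} {Σℤ.sum ⟦ t ⟧} (trans (sum-⟦⟧ s) (trans (cong +_ sum≡) (sym (sum-⟦⟧ t)))) ⟩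
        0ℤ ∎) (*-nonZero aρ₀≢0 uρ₀≢0)
        where open ≡-Reasoning
      u-supp : Supported σ u
      u-supp ρ ρ∉σ with ρ Fin.≟ ρ₀
      ... | yes refl = uρ₀≡0
      ... | no ρ≢ρ₀  = u-zero ρ ρ∉σ ρ≢ρ₀

    relations-bounded : ∀ {ρ₀} → ρ₀ ∉ σ → a ρ₀ ≢ 0ℤ → ∀ {P : Vec ℕ n → Set} {k} (f : Fin n → ℕ) →
      (∀ {t} → P t → IsRelation t × Vec.sum t ≡ k) → (∀ ρ → 1 ℕ.≤ f ρ) →
      (∀ {t} → P t → ∀ ρ → ρ ∉ σ → ρ ≢ ρ₀ → lookup t ρ ℕ.< f ρ) → Bounded P (∏ f)
    relations-bounded {ρ₀} ρ₀∉σ aρ₀≢0 {P} f P⇒rel 1≤f t<f = bounded-injection (tabulate ∘ mask)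
      (λ {t} pt ρ → z≤n , subst (ℕ._< f ρ) (sym (Vec.lookup∘tabulate (mask t) ρ)) (mask<f pt ρ))
      (λ {s} {t} ps pt eq → relation-determined ρ₀∉σ aρ₀≢0 (proj₁ (P⇒rel ps)) (proj₁ (P⇒rel pt))
        (trans (proj₂ (P⇒rel ps)) (sym (proj₂ (P⇒rel pt))))
        λ ρ ρ∉σ ρ≢ρ₀ → trans (sym (mask-free s ρ ρ∉σ ρ≢ρ₀)) (trans
          (trans (sym (Vec.lookup∘tabulate (mask s) ρ))
            (trans (cong (λ v → lookup v ρ) eq) (Vec.lookup∘tabulate (mask t) ρ)))
          (mask-free t ρ ρ∉σ ρ≢ρ₀)))
      (bounded-Vec (λ ρ x → 0 ℕ.≤ x × x ℕ.< f ρ) f ℕ._≟_ (λ ρ → bounded-interval 0 (f ρ)))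
      where
      -- Keeps only the coordinates that determine `t`. The others become 0, which fits below `f`
      -- because `f` is at least 1.
      mask : Vec ℕ n → Fin n → ℕ
      mask t ρ = if does (ρ ∈? σ) then 0 else (if does (ρ Fin.≟ ρ₀) then 0 else lookup t ρ)
      mask-free : ∀ t ρ → ρ ∉ σ → ρ ≢ ρ₀ → mask t ρ ≡ lookup t ρ
      mask-free t ρ ρ∉σ ρ≢ρ₀ with ρ ∈? σ | ρ Fin.≟ ρ₀
      ... | yes ρ∈σ | _         = contradiction ρ∈σ ρ∉σ
      ... | no _    | yes ρ≡ρ₀  = contradiction ρ≡ρ₀ ρ≢ρ₀
      ... | no _    | no _      = refl
      mask<f : ∀ {t} → P t → ∀ ρ → mask t ρ ℕ.< f ρ
      mask<f pt ρ with ρ ∈? σ | ρ Fin.≟ ρ₀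
      ... | yes _  | _        = 1≤f ρ
      ... | no _   | yes _    = 1≤f ρ
      ... | no ρ∉σ | no ρ≢ρ₀  = t<f pt ρ ρ∉σ ρ≢ρ₀

  module _ (complete : Complete Δ) {r} (pic : PicardRank Δ r) (ρ′ : Fin n) where
    private
      -ray : Lattice d
      -ray i = ℤ.- ray ρ′ i

      cover = maximal-cover Δ regular complete -ray
      σ     = proj₁ cover
      σ-max = proj₁ (proj₂ cover)
      b     = regular σ σ-max
      a     = D₀ Δ regular σ-max

      coord≤0 : ∀ ρ → coord b (ray ρ′) ρ ℤ.≤ 0ℤ
      coord≤0 ρ = ℤ.neg-cancel-≤ (subst (0ℤ ℤ.≤_) (coord-neg b -ray (ray ρ′) (λ _ → refl) ρ) (proj₂ (proj₂ cover) ρ))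

      ρ′∉σ : ρ′ ∉ σ
      ρ′∉σ ρ′∈σ = contradiction (subst (ℤ._≤ 0ℤ) (coord-u b ρ′∈σ) (coord≤0 ρ′)) λ { (ℤ.+≤+ ()) }

      -- a_ρ′ = 0 would mean that the coordinates of n_ρ′, all at most 0, add up to 1.
      aρ′≢0 : a ρ′ ≢ 0ℤ
      aρ′≢0 a≡0 = contradiction
        (subst (ℤ._≤ 0ℤ) (trans (sym (⟨ones,⟩ b (ray ρ′))) (sym (ℤ.i-j≡0⇒i≡j 1ℤ ⟨ ones b , ray ρ′ ⟩ a≡0)))
          (sum-nonPos _ coord≤0)) λ { (ℤ.+≤+ ()) }

      -- Comes from the case without a second ray, where k + 1 ≤ a_ρ′ μ + 1 ≤ (a_ρ′ + 1)(μ + 1).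
      κ : ℕ
      κ = suc ℤ.∣ a ρ′ ∣

      base : ℕ → Fin n → ℕ
      base k ρ = if does (ρ ∈? σ) then 1 else suc k

      base-∉ : ∀ k {ρ} → ρ ∉ σ → base k ρ ≡ suc k
      base-∉ k {ρ} ρ∉σ with ρ ∈? σ
      ... | yes ρ∈σ = contradiction ρ∈σ ρ∉σ
      ... | no _    = refl

      1≤base : ∀ k ρ → 1 ℕ.≤ base k ρ
      1≤base k ρ with ρ ∈? σ
      ... | yes _ = ℕ.≤-refl
      ... | no _  = s≤s z≤n

      ∏base≤ : ∀ k → ∏ (base k) ℕ.≤ suc k ℕ.^ r
      ∏base≤ k = subst (ℕ._≤ suc k ℕ.^ r) (sym (∏-outside σ (suc k)))
        (ℕ.^-monoʳ-≤ (suc k) (∣∁σ∣≤r Δ regular pic σ-max))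

      t≤k : ∀ k t → Vec.sum t ≡ k → ∀ {ρ} → ρ ∉ σ → lookup t ρ ℕ.< base k ρ
      t≤k k t sum≡ {ρ} ρ∉σ = subst (lookup t ρ ℕ.<_) (sym (base-∉ k ρ∉σ))
        (s≤s (subst (lookup t ρ ℕ.≤_) sum≡ (lookup≤sum t ρ)))

      Other : Fin n → Set
      Other ρ = ρ ∉ σ × ρ ≢ ρ′ × a ρ ≢ 0ℤ

      other? : Dec (∃ Other)
      other? = Fin.any? (λ ρ → ¬? (ρ ∈? σ) ×-dec ¬? (ρ Fin.≟ ρ′) ×-dec ¬? (a ρ ℤ.≟ 0ℤ))

      -- F = O((k + 1)^(r-2) (μ + 1)), multiplied out so that no negative power occurs for r = 1.
      Result : ℕ → ℕ → Set
      Result k μ = ∃[ F ] Bounded (Slice ρ′ k μ) F × F ℕ.* (suc k ℕ.* suc k) ℕ.≤ κ ℕ.* suc k ℕ.^ r ℕ.* suc μ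

      -- ρ₀ is determined by the equation Σ a_ρ t_ρ = k, and ρ′ takes at most μ + 1 values.
      with-other : ∀ k μ → ∃ Other → Result k μ
      with-other k μ (ρ₀ , ρ₀∉σ , ρ₀≢ρ′ , aρ₀≢0) = ∏ f₂ ,
        relations-bounded σ-max ρ₀∉σ aρ₀≢0 f₂ (λ (rel , sum≡ , _) → rel , sum≡) 1≤f₂
          (λ { {t} (_ , sum≡ , t≤μ) ρ ρ∉σ ρ≢ρ₀ →
            update-elim (λ ρ v → ρ ∉ σ → ρ ≢ ρ₀ → lookup t ρ ℕ.< v) f₁ ρ′ (suc μ) (λ _ _ → s≤s t≤μ)
              (λ ρ _ ρ∉σ ρ≢ρ₀ → subst (lookup t ρ ℕ.<_) (sym (update-≢ (base k) 1 ρ≢ρ₀)) (t≤k k t sum≡ ρ∉σ))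
              ρ ρ∉σ ρ≢ρ₀ }) ,
        (begin
          ∏ f₂ ℕ.* (suc k ℕ.* suc k)
            ≡⟨ sym (ℕ.*-assoc (∏ f₂) (suc k) (suc k)) ⟩
          ∏ f₂ ℕ.* suc k ℕ.* suc k
            ≡⟨ cong (λ e → ∏ f₂ ℕ.* e ℕ.* suc k) (sym (trans (update-≢ (base k) 1 (ρ₀≢ρ′ ∘ sym)) (base-∉ k ρ′∉σ))) ⟩
          ∏ f₂ ℕ.* f₁ ρ′ ℕ.* suc k
            ≡⟨ cong (ℕ._* suc k) (∏-update f₁ ρ′ (suc μ)) ⟩
          ∏ f₁ ℕ.* suc μ ℕ.* suc k
            ≡⟨ trans (swap (∏ f₁) (suc μ) (suc k)) (cong (λ e → ∏ f₁ ℕ.* e ℕ.* suc μ) (sym (base-∉ k ρ₀∉σ))) ⟩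
          ∏ f₁ ℕ.* base k ρ₀ ℕ.* suc μ
            ≡⟨ cong (ℕ._* suc μ) (trans (∏-update (base k) ρ₀ 1) (ℕ.*-identityʳ (∏ (base k)))) ⟩
          ∏ (base k) ℕ.* suc μ
            ≤⟨ ℕ.*-monoˡ-≤ (suc μ) (ℕ.≤-trans (∏base≤ k) (ℕ.m≤n*m (suc k ℕ.^ r) κ)) ⟩
          κ ℕ.* suc k ℕ.^ r ℕ.* suc μ ∎)
        where
        open ℕ.≤-Reasoning
        f₁ = update (base k) ρ₀ 1
        f₂ = update f₁ ρ′ (suc μ)
        1≤f₂ : ∀ ρ → 1 ℕ.≤ f₂ ρ
        1≤f₂ = update-elim (λ _ v → 1 ℕ.≤ v) f₁ ρ′ (suc μ) (s≤s z≤n)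
          (λ ρ _ → update-elim (λ _ v → 1 ℕ.≤ v) (base k) ρ₀ 1 ℕ.≤-refl (λ ρ _ → 1≤base k ρ) ρ)
        swap : ∀ a b c → a ℕ.* b ℕ.* c ≡ a ℕ.* c ℕ.* b
        swap = solve-∀

      -- Here k = a_ρ′ t_ρ′, which bounds k linearly in μ.
      without-other : ∀ k μ → ¬ ∃ Other → Result k μ
      without-other k μ none with k ℕ.≤? ℤ.∣ a ρ′ ∣ ℕ.* μ
      ... | no k≰ = 0 , bounded-∅ (λ t (rel , sum≡ , t≤μ) → k≰ (begin
          k                              ≡⟨ sym sum≡ ⟩
          Vec.sum t                      ≡⟨ cong ℤ.∣_∣ (sym (sum-⟦⟧ t)) ⟩
          ℤ.∣ Σℤ.sum ⟦ t ⟧ ∣             ≡⟨ cong ℤ.∣_∣ (sym (D₀-sum Δ regular σ-max ⟦ t ⟧ rel)) ⟩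
          ℤ.∣ Σℤ.sum (λ ρ → a ρ ℤ.* ⟦ t ⟧ ρ) ∣ ≡⟨ cong ℤ.∣_∣ (sum-single _ ρ′ (at≡0 t)) ⟩
          ℤ.∣ a ρ′ ℤ.* ⟦ t ⟧ ρ′ ∣        ≡⟨ ℤ.abs-* (a ρ′) (⟦ t ⟧ ρ′) ⟩
          ℤ.∣ a ρ′ ∣ ℕ.* lookup t ρ′     ≤⟨ ℕ.*-monoʳ-≤ ℤ.∣ a ρ′ ∣ t≤μ ⟩
          ℤ.∣ a ρ′ ∣ ℕ.* μ               ∎)) , z≤n
        where
        open ℕ.≤-Reasoning
        at≡0 : ∀ t ρ → ρ ≢ ρ′ → a ρ ℤ.* ⟦ t ⟧ ρ ≡ 0ℤ
        at≡0 t ρ ρ≢ρ′ with a ρ ℤ.≟ 0ℤ | ρ ∈? σ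
        ... | yes a≡0 | _       = trans (cong (ℤ._* ⟦ t ⟧ ρ) a≡0) (ℤ.*-zeroˡ (⟦ t ⟧ ρ))
        ... | no a≢0  | yes ρ∈σ = contradiction (D₀-zero Δ regular σ-max ρ∈σ) a≢0
        ... | no a≢0  | no ρ∉σ  = contradiction (ρ , ρ∉σ , ρ≢ρ′ , a≢0) none
      ... | yes k≤ = ∏ f₁ ,
        relations-bounded σ-max ρ′∉σ aρ′≢0 f₁ (λ (rel , sum≡ , _) → rel , sum≡)
          (update-elim (λ _ v → 1 ℕ.≤ v) (base k) ρ′ 1 ℕ.≤-refl (λ ρ _ → 1≤base k ρ))
          (λ { {t} (_ , sum≡ , _) ρ ρ∉σ ρ≢ρ′ →
            subst (lookup t ρ ℕ.<_) (sym (update-≢ (base k) 1 ρ≢ρ′)) (t≤k k t sum≡ ρ∉σ) }) ,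
        (begin
          ∏ f₁ ℕ.* (suc k ℕ.* suc k)
            ≡⟨ sym (ℕ.*-assoc (∏ f₁) (suc k) (suc k)) ⟩
          ∏ f₁ ℕ.* suc k ℕ.* suc k
            ≡⟨ cong (λ e → ∏ f₁ ℕ.* e ℕ.* suc k) (sym (base-∉ k ρ′∉σ)) ⟩
          ∏ f₁ ℕ.* base k ρ′ ℕ.* suc k
            ≡⟨ cong (ℕ._* suc k) (trans (∏-update (base k) ρ′ 1) (ℕ.*-identityʳ (∏ (base k)))) ⟩
          ∏ (base k) ℕ.* suc k
            ≤⟨ ℕ.*-mono-≤ (∏base≤ k) (s≤s k≤) ⟩
          suc k ℕ.^ r ℕ.* suc (ℤ.∣ a ρ′ ∣ ℕ.* μ)
            ≤⟨ ℕ.*-monoʳ-≤ (suc k ℕ.^ r) (ℕ.≤-trans (ℕ.m≤m+n _ (ℤ.∣ a ρ′ ∣ ℕ.+ μ))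
                 (ℕ.≤-reflexive (1+aμ≤ ℤ.∣ a ρ′ ∣ μ))) ⟩
          suc k ℕ.^ r ℕ.* (κ ℕ.* suc μ)
            ≡⟨ swap (suc k ℕ.^ r) κ (suc μ) ⟩
          κ ℕ.* suc k ℕ.^ r ℕ.* suc μ ∎)
        where
        open ℕ.≤-Reasoning
        f₁ = update (base k) ρ′ 1
        1+aμ≤ : ∀ a μ → suc (a ℕ.* μ) ℕ.+ (a ℕ.+ μ) ≡ suc a ℕ.* suc μ
        1+aμ≤ = solve-∀
        swap : ∀ a b c → a ℕ.* (b ℕ.* c) ≡ b ℕ.* a ℕ.* c
        swap = solve-∀

    -- The ray ρ′ lies off σ, so the complement of σ is nonempty. This is what gives `pred r` its
    -- meaning later.
    1≤rank : 1 ℕ.≤ r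
    1≤rank = ℕ.≤-trans (ℕ.≤-trans (s≤s z≤n) (ℕ.≤-reflexive (sym (∣p∣≡1+∣p∖x∣ (x∉p⇒x∈∁p ρ′∉σ)))))
      (∣∁σ∣≤r Δ regular pic σ-max)

    slice-bounded : ∃[ κ ] ∀ k μ → ∃[ F ] Bounded (Slice ρ′ k μ) F ×
      F ℕ.* (suc k ℕ.* suc k) ℕ.≤ κ ℕ.* suc k ℕ.^ r ℕ.* suc μ
    slice-bounded = κ , λ k μ → case other? of λ where
      (yes other) → with-other k μ other
      (no none)   → without-other k μ none

-- From monomials to linear inequalities between dyadic exponents

^-cancelʳ-≤ : ∀ {m n} → 2 ℕ.^ m ℕ.≤ 2 ℕ.^ n → m ℕ.≤ n
^-cancelʳ-≤ 2^m≤2^n = ℕ.≮⇒≥ λ n<m → ℕ.<⇒≱ (ℕ.^-monoʳ-< 2 (s≤s (s≤s z≤n)) n<m) 2^m≤2^n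

∥_∥ : ∀ {n} → Vector ℤ n → ℕ
∥_∥ {zero}  e = 0
∥_∥ {suc n} e = ℤ.∣ e zero ∣ ℕ.+ ∥ e ∘ suc ∥

infix 8 _⁻
-- The negative part measures the rounding loss: X < 2^(lg X + 1) costs a factor 2 per unit of
-- negative exponent, while 2^lg X ≤ X costs nothing for positive ones.
_⁻ : ℤ → ℕ
(+ k) ⁻    = 0
-[1+ k ] ⁻ = suc k

∥_∥⁻ : ∀ {n} → Vector ℤ n → ℕ
∥_∥⁻ {zero}  e = 0
∥_∥⁻ {suc n} e = e zero ⁻ ℕ.+ ∥ e ∘ suc ∥⁻

∥∥⁻≤∥∥ : ∀ {n} (e : Vector ℤ n) → ∥ e ∥⁻ ℕ.≤ ∥ e ∥
∥∥⁻≤∥∥ {zero}  e = z≤n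
∥∥⁻≤∥∥ {suc n} e = ℕ.+-mono-≤ (⁻≤∣∣ (e zero)) (∥∥⁻≤∥∥ (e ∘ suc))
  where
  ⁻≤∣∣ : ∀ i → i ⁻ ℕ.≤ ℤ.∣ i ∣
  ⁻≤∣∣ (+ k)    = z≤n
  ⁻≤∣∣ -[1+ k ] = ℕ.≤-refl

∥∥⁻≡0 : ∀ {n} (e : Vector ℤ n) → (∀ i → 0ℤ ℤ.≤ e i) → ∥ e ∥⁻ ≡ 0
∥∥⁻≡0 {zero}  e 0≤e = refl
∥∥⁻≡0 {suc n} e 0≤e = cong₂ ℕ._+_ (⁻≡0 (0≤e zero)) (∥∥⁻≡0 (e ∘ suc) (0≤e ∘ suc))
  where
  ⁻≡0 : ∀ {i} → 0ℤ ℤ.≤ i → i ⁻ ≡ 0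
  ⁻≡0 (ℤ.+≤+ _) = refl

∥∥-cong : ∀ {n} {e f : Vector ℤ n} → (∀ i → e i ≡ f i) → ∥ e ∥ ≡ ∥ f ∥
∥∥-cong {zero}  e≡f = refl
∥∥-cong {suc n} e≡f = cong₂ ℕ._+_ (cong ℤ.∣_∣ (e≡f zero)) (∥∥-cong (e≡f ∘ suc))

sum-≤-∥∥ : ∀ {n} (e : Vector ℤ n) (c : Vec ℕ n) →
  Σℤ.sum (λ i → e i ℤ.* ⟦ c ⟧ i) ℤ.≤ + (∥ e ∥ ℕ.* Vec.sum c)
sum-≤-∥∥ e []      = ℤ.≤-refl
sum-≤-∥∥ e (x ∷ c) = ℤ.≤-trans
  (ℤ.+-mono-≤ (ℤ.*-monoʳ-≤-nonNeg (+ x) (i≤∣i∣ (e zero))) (sum-≤-∥∥ (e ∘ suc) c))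
  (ℤ.≤-trans (ℤ.≤-reflexive (cong (ℤ._+ + (∥ e ∘ suc ∥ ℕ.* Vec.sum c)) (sym (ℤ.pos-* ℤ.∣ e zero ∣ x))))
    (ℤ.+≤+ (ℕ.≤-trans (ℕ.m≤m+n _ _) (ℕ.≤-reflexive (cross ℤ.∣ e zero ∣ x ∥ e ∘ suc ∥ (Vec.sum c))))))
  where
  i≤∣i∣ : ∀ i → i ℤ.≤ + ℤ.∣ i ∣
  i≤∣i∣ (+ k)    = ℤ.≤-refl
  i≤∣i∣ -[1+ k ] = ℤ.-≤+
  cross : ∀ a x b s → a ℕ.* x ℕ.+ b ℕ.* s ℕ.+ (a ℕ.* s ℕ.+ b ℕ.* x) ≡ (a ℕ.+ b) ℕ.* (x ℕ.+ s)
  cross = solve-∀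

lgᵛ : ∀ {n} → Vec ℕ n → Vec ℕ n
lgᵛ = Vec.map lg

-- X^e ≥ 2^(e x) for e ≥ 0 and X^e ≥ 2^(e (x + 1)) for e < 0, where x = lg X.
power-lower : ∀ {X} → 1 ℕ.≤ X → ∀ e → ∃[ A ] ∃[ B ] ι (2 ℕ.^ A) ℚ.≤ (X ^ℤ e) ℚ.* ι (2 ℕ.^ B) ×
  e ℤ.* + lg X ≡ + A ℤ.- + B ℤ.+ + (e ⁻)
power-lower {X} 1≤X (+ k) = lg X ℕ.* k , 0 , (begin
  ι (2 ℕ.^ (lg X ℕ.* k))
    ≡⟨ cong ι (sym (ℕ.^-*-assoc 2 (lg X) k)) ⟩
  ι ((2 ℕ.^ lg X) ℕ.^ k)
    ≤⟨ ι-mono-≤ (ℕ.^-monoˡ-≤ k (2^lg≤ 1≤X)) ⟩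
  ι (X ℕ.^ k)
    ≡⟨ trans (ι-homo-^ X k) (cong (_^ℚ k) (ι≡/1 X)) ⟩
  X ^ℤ (+ k)
    ≡⟨ sym (trans (cong ((X ^ℤ (+ k)) ℚ.*_) ι1) (ℚ.*-identityʳ (X ^ℤ (+ k)))) ⟩
  (X ^ℤ (+ k)) ℚ.* ι 1 ∎) ,
  trans (sym (ℤ.pos-* k (lg X))) (trans (cong +_ (ℕ.*-comm k (lg X)))
    (sym (trans (ℤ.+-identityʳ _) (ℤ.+-identityʳ _))))
  where open ℚ.≤-Reasoning
power-lower {suc X} 1≤X -[1+ k ] = 0 , suc (lg (suc X)) ℕ.* suc k , (begin
  ι 1
    ≡⟨ trans ι1 (sym (1^ℚ (suc k))) ⟩
  1ℚ ^ℚ suc k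
    ≡⟨ cong (_^ℚ suc k) (sym (trans (ℚ.*-comm _ (ι (suc X))) (recip-inverse X))) ⟩
  (recip (suc X) ℚ.* ι (suc X)) ^ℚ suc k
    ≤⟨ ^ℚ-mono-≤ (suc k) (ℚ.<⇒≤ (0<*ℚ 0<recip (0<ι X)))
         (ℚ.*-monoˡ-≤-nonNeg (recip (suc X)) {{ℚ.nonNegative (ℚ.<⇒≤ 0<recip)}} (ι-mono-≤ (ℕ.<⇒≤ (<2^1+lg 1≤X)))) ⟩
  (recip (suc X) ℚ.* ι (2 ℕ.^ suc (lg (suc X)))) ^ℚ suc k
    ≡⟨ ^ℚ-distrib-* (recip (suc X)) (ι (2 ℕ.^ suc (lg (suc X)))) (suc k) ⟩
  recip (suc X) ^ℚ suc k ℚ.* ι (2 ℕ.^ suc (lg (suc X))) ^ℚ suc k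
    ≡⟨ cong (recip (suc X) ^ℚ suc k ℚ.*_) (trans (sym (ι-homo-^ _ (suc k)))
         (cong ι (ℕ.^-*-assoc 2 (suc (lg (suc X))) (suc k)))) ⟩
  (suc X ^ℤ -[1+ k ]) ℚ.* ι (2 ℕ.^ (suc (lg (suc X)) ℕ.* suc k)) ∎) ,
  trans (cong (ℤ._* + lg (suc X)) (neg-suc k)) (trans (expand (+ suc k) (+ lg (suc X)))
    (cong (λ z → 0ℤ ℤ.- z ℤ.+ + suc k) (sym (ℤ.pos-* (suc (lg (suc X))) (suc k)))))
  where
  open ℚ.≤-Reasoning
  0<recip : 0ℚ ℚ.< recip (suc X)
  0<recip = ℚ.positive⁻¹ (recip (suc X)) {{ℚ.normalize-pos 1 (suc X)}}
  neg-suc : ∀ k → -[1+ k ] ≡ ℤ.- (+ suc k)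
  neg-suc k = refl
  expand : ∀ k l → (ℤ.- k) ℤ.* l ≡ 0ℤ ℤ.- (1ℤ ℤ.+ l) ℤ.* k ℤ.+ k
  expand = ℤ-solve-∀

-- An exponent of 2 that may be negative is stored as a difference A - B of naturals, and the
-- inequality is multiplied by 2^B, so only natural powers of 2 occur.
monomial-lower : ∀ {n} (X : Vec ℕ n) (e : Vector ℤ n) → (∀ ρ → 1 ℕ.≤ lookup X ρ) →
  ∃[ A ] ∃[ B ] ι (2 ℕ.^ A) ℚ.≤ monomial X e ℚ.* ι (2 ℕ.^ B) ×
    Σℤ.sum (λ ρ → e ρ ℤ.* ⟦ lgᵛ X ⟧ ρ) ≡ + A ℤ.- + B ℤ.+ + ∥ e ∥⁻
monomial-lower []      e 1≤X = 0 , 0 , ℚ.≤-reflexive (trans ι1 (sym (cong (ℚ._*_ 1ℚ) ι1))) , refl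
monomial-lower (x ∷ X) e 1≤X =
  let A₁ , B₁ , lower₁ , eq₁ = power-lower (1≤X zero) (e zero)
      A₂ , B₂ , lower₂ , eq₂ = monomial-lower X (e ∘ suc) (1≤X ∘ suc)
      p = x ^ℤ e zero
      q = monomial X (e ∘ suc)
  in A₁ ℕ.+ A₂ , B₁ ℕ.+ B₂ , (begin
    ι (2 ℕ.^ (A₁ ℕ.+ A₂))
      ≡⟨ ι2^+ A₁ A₂ ⟩
    ι (2 ℕ.^ A₁) ℚ.* ι (2 ℕ.^ A₂)
      ≤⟨ *-mono-≤ℚ (0≤ι (2 ℕ.^ A₁)) (ℚ.≤-trans (0≤ι (2 ℕ.^ A₂)) lower₂) lower₁ lower₂ ⟩
    p ℚ.* ι (2 ℕ.^ B₁) ℚ.* (q ℚ.* ι (2 ℕ.^ B₂))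
      ≡⟨ solve 4 (λ p b q c → p :* b :* (q :* c) := p :* q :* (b :* c)) refl p (ι (2 ℕ.^ B₁)) q (ι (2 ℕ.^ B₂)) ⟩
    p ℚ.* q ℚ.* (ι (2 ℕ.^ B₁) ℚ.* ι (2 ℕ.^ B₂))
      ≡⟨ cong (p ℚ.* q ℚ.*_) (sym (ι2^+ B₁ B₂)) ⟩
    p ℚ.* q ℚ.* ι (2 ℕ.^ (B₁ ℕ.+ B₂)) ∎) ,
  trans (cong₂ ℤ._+_ eq₁ eq₂) (collect (+ A₁) (+ A₂) (+ B₁) (+ B₂) (+ (e zero ⁻)) (+ ∥ e ∘ suc ∥⁻))
  where
  open ℚ.≤-Reasoning
  open ℚ-Solver
  ι2^+ : ∀ a b → ι (2 ℕ.^ (a ℕ.+ b)) ≡ ι (2 ℕ.^ a) ℚ.* ι (2 ℕ.^ b)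
  ι2^+ a b = trans (cong ι (ℕ.^-distribˡ-+-* 2 a b)) (ι-homo-* (2 ℕ.^ a) (2 ℕ.^ b))
  collect : ∀ a a′ b b′ e e′ → a ℤ.- b ℤ.+ e ℤ.+ (a′ ℤ.- b′ ℤ.+ e′) ≡ (a ℤ.+ a′) ℤ.- (b ℤ.+ b′) ℤ.+ (e ℤ.+ e′)
  collect = ℤ-solve-∀

-- For e ≥ 0 the error term is 0, which is why D₀(σ) gives |t| ≤ m without loss; for E it is bounded
-- by a constant.
exponent-bound : ∀ {n} (X : Vec ℕ n) e M → (∀ ρ → 1 ℕ.≤ lookup X ρ) → monomial X e ℚ.≤ ι (2 ℕ.^ M) →
  Σℤ.sum (λ ρ → e ρ ℤ.* ⟦ lgᵛ X ⟧ ρ) ℤ.≤ + (M ℕ.+ ∥ e ∥⁻)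
exponent-bound X e M 1≤X X^e≤ =
  let A , B , lower , eq = monomial-lower X e 1≤X
      A≤M+B = ^-cancelʳ-≤ (ι-cancel-≤ (ℚ.≤-trans lower (ℚ.≤-trans
        (ℚ.*-monoʳ-≤-nonNeg (ι (2 ℕ.^ B)) {{ℚ.nonNegative (0≤ι (2 ℕ.^ B))}} X^e≤)
        (ℚ.≤-reflexive (sym (trans (cong ι (ℕ.^-distribˡ-+-* 2 M B)) (ι-homo-* (2 ℕ.^ M) (2 ℕ.^ B))))))))
  in ℤ.≤-trans (ℤ.≤-reflexive eq) (ℤ.≤-trans
    (ℤ.+-monoˡ-≤ (+ ∥ e ∥⁻) (ℤ.+-monoˡ-≤ (ℤ.- + B) (ℤ.+≤+ A≤M+B)))
    (ℤ.≤-reflexive (cong (ℤ._+ + ∥ e ∥⁻) (cancel (+ M) (+ B)))))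
  where
  cancel : ∀ m b → m ℤ.+ b ℤ.- b ≡ m
  cancel = ℤ-solve-∀

bound-Fin : ∀ {n} (f : Fin n → ℕ) → ∃[ K ] ∀ i → f i ℕ.≤ K
bound-Fin {zero}  f = 0 , λ ()
bound-Fin {suc n} f =
  let K , f≤ = bound-Fin (f ∘ suc) in
  f zero ℕ.+ K , λ { zero → ℕ.m≤m+n _ K ; (suc i) → ℕ.≤-trans (f≤ i) (ℕ.m≤n+m K _) }

bound-Subset : ∀ {n} (f : Subset n → ℕ) → ∃[ K ] ∀ σ → f σ ℕ.≤ K
bound-Subset {zero}  f = f [] , λ { [] → ℕ.≤-refl }
bound-Subset {suc n} f =
  let K , f≤ = bound-Subset (f ∘ (inside ∷_))
      L , f≤′ = bound-Subset (f ∘ (outside ∷_)) in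
  K ℕ.+ L , λ { (inside ∷ σ) → ℕ.≤-trans (f≤ σ) (ℕ.m≤m+n K L)
              ; (outside ∷ σ) → ℕ.≤-trans (f≤′ σ) (ℕ.m≤n+m L K) }

-- An upper bound may assume a member, since the empty list satisfies every bound. The member
-- supplies the exponents `x` on a fibre that is described only through `t` and `c`.
bounded-inhabited : ∀ {S : Set} {P : S → Set} {N} → (∀ {x} → P x → Bounded P N) → Bounded P N
bounded-inhabited b []      _ _           = z≤n
bounded-inhabited b (x ∷ L) u (px ∷ pL) = b px (x ∷ L) u (px ∷ pL)

lookup-⊕ : ∀ {n} (s t : Vec ℕ n) i → lookup (zipWith ℕ._+_ s t) i ≡ lookup s i ℕ.+ lookup t i
lookup-⊕ s t i = Vec.lookup-zipWith ℕ._+_ i s t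

sum-⊕ : ∀ {n} (s t : Vec ℕ n) → Vec.sum (zipWith ℕ._+_ s t) ≡ Vec.sum s ℕ.+ Vec.sum t
sum-⊕ []      []      = refl
sum-⊕ (x ∷ s) (y ∷ t) = trans (cong (x ℕ.+ y ℕ.+_) (sum-⊕ s t)) (interchange x y (Vec.sum s) (Vec.sum t))
  where
  interchange : ∀ a b c d → a ℕ.+ b ℕ.+ (c ℕ.+ d) ≡ a ℕ.+ c ℕ.+ (b ℕ.+ d)
  interchange = solve-∀

-- There are 2^|x| vectors X with lg X = x.
shifted-fibre-bounded : ∀ {n} (c t : Vec ℕ n) →
  Bounded (λ X → (∀ i → 1 ℕ.≤ lookup X i) × zipWith ℕ._+_ (lgᵛ X) c ≡ t) (2^ Vec.sum t /2^ Vec.sum c)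
shifted-fibre-bounded {n} c t = bounded-inhabited λ {X₀} (1≤X₀ , eq₀) →
  let x = lgᵛ X₀ in
  bounded-mono
    (λ {X} (1≤X , eq) i →
      subst (λ e → 2 ℕ.^ e ℕ.≤ lookup X i × lookup X i ℕ.< 2 ℕ.^ e ℕ.+ 2 ℕ.^ e)
        (same-lg X X₀ (trans eq (sym eq₀)) i)
        (2^lg≤ (1≤X i) , subst (lookup X i ℕ.<_) (cong (2 ℕ.^ lg (lookup X i) ℕ.+_) (ℕ.+-identityʳ _)) (<2^1+lg (1≤X i))))
    (ℕ.≤-reflexive (trans (∏2^≡2^sum x) (trans (sym (2^/2^-+ (Vec.sum x) (Vec.sum c)))
      (cong (λ s → 2^ s /2^ Vec.sum c) (trans (sym (sum-⊕ x c)) (cong Vec.sum eq₀))))))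
    (bounded-Vec (λ i X → 2 ℕ.^ lookup x i ℕ.≤ X × X ℕ.< 2 ℕ.^ lookup x i ℕ.+ 2 ℕ.^ lookup x i)
      (λ i → 2 ℕ.^ lookup x i) ℕ._≟_ (λ i → bounded-interval (2 ℕ.^ lookup x i) (2 ℕ.^ lookup x i)))
  where
  same-lg : ∀ (X Y : Vec ℕ n) → zipWith ℕ._+_ (lgᵛ X) c ≡ zipWith ℕ._+_ (lgᵛ Y) c → ∀ i →
    lg (lookup X i) ≡ lookup (lgᵛ Y) i
  same-lg X Y eq i = trans (sym (Vec.lookup-map i lg X)) (ℕ.+-cancelʳ-≡ (lookup c i) _ _
    (trans (sym (lookup-⊕ (lgᵛ X) c i)) (trans (cong (λ v → lookup v i) eq) (lookup-⊕ (lgᵛ Y) c i))))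

-- Counting the exceptional vectors for dyadic thresholds

module Counting {d n : ℕ} (Δ : Fan d n) (regular : Regular Δ) (complete : Complete Δ)
                (gg : GloballyGenerated Δ (-K Δ)) {r} (pic : PicardRank Δ r) where
  open Fan Δ
  open DualBasis
  open Relations Δ regular

  -- `regular` takes the proof of maximality as an argument and might return different data for
  -- different proofs; uniqueness of coordinates shows that E depends on σ alone. This allows one
  -- bound per subset σ.
  E-irrelevant : ∀ {σ} (p q : Maximal Δ σ) ρ′ ρ → E Δ regular p ρ′ ρ ≡ E Δ regular q ρ′ ρ
  E-irrelevant {σ} p q ρ′ ρ with ρ ∈? σ
  ... | yes _ = refl
  ... | no _  = cong ℤ.-_ (trans (⟨dual,-⟩ b ρ′ (ray ρ)) (trans
      (B.unique (B.coord (ray ρ)) (B′.coord (ray ρ)) (B.supported (ray ρ)) (B′.supported (ray ρ))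
        (λ i → trans (B.expand (ray ρ) i) (sym (B′.expand (ray ρ) i))) ρ′)
      (sym (⟨dual,-⟩ b′ ρ′ (ray ρ)))))
    where
    b  = regular σ p
    b′ = regular σ q
    module B = IsBasis b
    module B′ = IsBasis b′

  E-bounded : ∃[ K ] ∀ {σ} (σ-max : Maximal Δ σ) ρ′ → ∥ E Δ regular σ-max ρ′ ∥ ℕ.≤ K
  E-bounded = proj₁ bound , λ {σ} σ-max ρ′ → ℕ.≤-trans (norm≤ σ σ-max ρ′) (proj₂ bound σ)
    where
    norm : Subset n → ℕ
    norm σ = case maximal? Δ σ of λ where
      (yes σ-max) → proj₁ (bound-Fin (λ ρ′ → ∥ E Δ regular σ-max ρ′ ∥))
      (no _)      → 0
    norm≤ : ∀ σ (σ-max : Maximal Δ σ) ρ′ → ∥ E Δ regular σ-max ρ′ ∥ ℕ.≤ norm σ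
    norm≤ σ σ-max ρ′ with maximal? Δ σ
    ... | yes σ-max′ = ℕ.≤-trans (ℕ.≤-reflexive (∥∥-cong (E-irrelevant σ-max σ-max′ ρ′)))
      (proj₂ (bound-Fin (λ ρ′ → ∥ E Δ regular σ-max′ ρ′ ∥)) ρ′)
    ... | no ¬max    = contradiction σ-max ¬max
    bound = bound-Subset norm

  -- The exceptional set with its real thresholds replaced by powers of 2: B by 2^m and (log B)^A by
  -- 2^Λ.
  Bad : ℕ → ℕ → Vec ℕ n → Set
  Bad m Λ X = (∀ ρ → 1 ℕ.≤ lookup X ρ) ×
    (∀ σ (σ-max : Maximal Δ σ) → monomial X (D₀ Δ regular σ-max) ℚ.≤ ι (2 ℕ.^ m)) ×
    ∃[ σ ] Σ (Maximal Δ σ) λ σ-max → ∃[ ρ′ ] ρ′ ∈ σ × monomial X (E Δ regular σ-max ρ′) ℚ.≤ ι (2 ℕ.^ Λ)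

  Cell : ℕ → Fin n → Vec ℕ n → ℕ → Vec ℕ n → Set
  Cell Λ ρ′ c k X = (∀ ρ → 1 ℕ.≤ lookup X ρ) ×
    Slice ρ′ k (Λ ℕ.+ proj₁ E-bounded ℕ.* Vec.sum c) (zipWith ℕ._+_ (lgᵛ X) c)

  -- With x = lg X, the point - Σ x_ρ n_ρ has coordinates c ≥ 0 on some maximal cone σ, and t = x + c is
  -- a relation whose total is the exponent of 2 in 2^(D₀(σ) x) ≤ X^D₀(σ).
  Bad⇒Cell : ∀ {m Λ X} → Bad m Λ X → ∃[ ρ′ ] ∃[ c ] ∃[ k ]
    c ∈ˡ box m n × k ∈ˡ downFrom (suc m) × Cell (Λ ℕ.+ proj₁ E-bounded) ρ′ c k X
  Bad⇒Cell {m} {Λ} {X} (1≤X , D₀≤ , σ′ , σ′-max , ρ′ , ρ′∈σ′ , E≤) =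
    ρ′ , c , Vec.sum t ,
    ∈-box c (λ i → ℕ.≤-trans (lookup≤sum c i) (ℕ.≤-trans (ℕ.m≤n+m (Vec.sum c) (Vec.sum x))
      (ℕ.≤-trans (ℕ.≤-reflexive (sym (sum-⊕ x c))) sum-t≤m))) ,
    Mem.∈-downFrom⁺ (s≤s sum-t≤m) ,
    1≤X , t-rel , refl , ℤ.drop‿+≤+ tρ′≤
    where
    open ℤ.≤-Reasoning
    K = proj₁ E-bounded
    x = lgᵛ X
    w : Lattice d
    w i = ℤ.- lincomb ray ⟦ x ⟧ i
    cover = maximal-cover Δ regular complete w
    σ     = proj₁ cover
    σ-max = proj₁ (proj₂ cover)
    b     = regular σ σ-max
    coord = IsBasis.coord b w
    c = tabulate (λ ρ → ℤ.∣ coord ρ ∣)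
    ⟦c⟧≡ : ∀ ρ → ⟦ c ⟧ ρ ≡ coord ρ
    ⟦c⟧≡ ρ = trans (cong +_ (Vec.lookup∘tabulate (λ ρ → ℤ.∣ coord ρ ∣) ρ)) (ℤ.0≤i⇒+∣i∣≡i (proj₂ (proj₂ cover) ρ))
    t = zipWith ℕ._+_ x c
    ⟦t⟧≡ : ∀ ρ → ⟦ t ⟧ ρ ≡ 1ℤ ℤ.* ⟦ x ⟧ ρ ℤ.+ 1ℤ ℤ.* ⟦ c ⟧ ρ
    ⟦t⟧≡ ρ = trans (cong +_ (lookup-⊕ x c ρ)) (sym (cong₂ ℤ._+_ (ℤ.*-identityˡ (⟦ x ⟧ ρ)) (ℤ.*-identityˡ (⟦ c ⟧ ρ))))
    t-rel : IsRelation t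
    t-rel i = trans (Σℤ.sum-cong-≗ (λ ρ → cong (ℤ._* ray ρ i) (⟦t⟧≡ ρ))) (trans
      (lincomb-linear ray 1ℤ 1ℤ ⟦ x ⟧ ⟦ c ⟧ i)
      (trans (cong (λ z → 1ℤ ℤ.* lincomb ray ⟦ x ⟧ i ℤ.+ 1ℤ ℤ.* z)
        (trans (Σℤ.sum-cong-≗ (λ ρ → cong (ℤ._* ray ρ i) (⟦c⟧≡ ρ))) (IsBasis.expand b w i)))
        (cancel (lincomb ray ⟦ x ⟧ i))))
      where
      cancel : ∀ z → 1ℤ ℤ.* z ℤ.+ 1ℤ ℤ.* (ℤ.- z) ≡ 0ℤ
      cancel = ℤ-solve-∀
    sum-et : ∀ (e : Vector ℤ n) → Σℤ.sum (λ ρ → e ρ ℤ.* ⟦ t ⟧ ρ) ≡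
      Σℤ.sum (λ ρ → e ρ ℤ.* ⟦ x ⟧ ρ) ℤ.+ Σℤ.sum (λ ρ → e ρ ℤ.* ⟦ c ⟧ ρ)
    sum-et e = trans (Σℤ.sum-cong-≗ (λ ρ → trans (cong (e ρ ℤ.*_) (⟦t⟧≡ ρ)) (distrib (e ρ) (⟦ x ⟧ ρ) (⟦ c ⟧ ρ))))
      (Σℤ.∑-distrib-+ (λ ρ → e ρ ℤ.* ⟦ x ⟧ ρ) (λ ρ → e ρ ℤ.* ⟦ c ⟧ ρ))
      where
      distrib : ∀ e x c → e ℤ.* (1ℤ ℤ.* x ℤ.+ 1ℤ ℤ.* c) ≡ e ℤ.* x ℤ.+ e ℤ.* c
      distrib = ℤ-solve-∀
    a = D₀ Δ regular σ-max
    -- The supports are disjoint: D₀(σ) vanishes on σ, and `c` vanishes off σ.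
    ac≡0 : Σℤ.sum (λ ρ → a ρ ℤ.* ⟦ c ⟧ ρ) ≡ 0ℤ
    ac≡0 = sum-zero (λ ρ → a ρ ℤ.* ⟦ c ⟧ ρ) λ ρ → case ρ ∈? σ of λ where
      (yes ρ∈σ) → trans (cong (ℤ._* ⟦ c ⟧ ρ) (D₀-zero Δ regular σ-max ρ∈σ)) (ℤ.*-zeroˡ (⟦ c ⟧ ρ))
      (no ρ∉σ)  → trans (cong (a ρ ℤ.*_) (trans (⟦c⟧≡ ρ) (IsBasis.supported b w ρ ρ∉σ))) (ℤ.*-zeroʳ (a ρ))
    sum-t≤m : Vec.sum t ℕ.≤ m
    sum-t≤m = ℤ.drop‿+≤+ (begin
      + Vec.sum t
        ≡⟨ sym (trans (D₀-sum Δ regular σ-max ⟦ t ⟧ t-rel) (sum-⟦⟧ t)) ⟩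
      Σℤ.sum (λ ρ → a ρ ℤ.* ⟦ t ⟧ ρ)
        ≡⟨ trans (sum-et a) (trans (cong (ℤ._+_ (Σℤ.sum (λ ρ → a ρ ℤ.* ⟦ x ⟧ ρ))) ac≡0) (ℤ.+-identityʳ _)) ⟩
      Σℤ.sum (λ ρ → a ρ ℤ.* ⟦ x ⟧ ρ)
        ≤⟨ exponent-bound X a m 1≤X (D₀≤ σ σ-max) ⟩
      + (m ℕ.+ ∥ a ∥⁻)
        ≡⟨ cong +_ (trans (cong (m ℕ.+_) (∥∥⁻≡0 a (D₀-nonNeg Δ regular gg σ-max))) (ℕ.+-identityʳ m)) ⟩
      + m ∎)
    e = E Δ regular σ′-max ρ′
    ∥e∥≤K = proj₂ E-bounded σ′-max ρ′
    -- The summand K pays for rounding the negative exponents in X^E, and K |c| for pairing E with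
    -- `c`.
    tρ′≤ : + lookup t ρ′ ℤ.≤ + (Λ ℕ.+ K ℕ.+ K ℕ.* Vec.sum c)
    tρ′≤ = begin
      + lookup t ρ′
        ≡⟨ sym (E-sum Δ regular σ′-max ρ′∈σ′ ⟦ t ⟧ t-rel) ⟩
      Σℤ.sum (λ ρ → e ρ ℤ.* ⟦ t ⟧ ρ)
        ≡⟨ sum-et e ⟩
      Σℤ.sum (λ ρ → e ρ ℤ.* ⟦ x ⟧ ρ) ℤ.+ Σℤ.sum (λ ρ → e ρ ℤ.* ⟦ c ⟧ ρ)
        ≤⟨ ℤ.+-mono-≤ (exponent-bound X e Λ 1≤X E≤) (sum-≤-∥∥ e c) ⟩
      + (Λ ℕ.+ ∥ e ∥⁻ ℕ.+ ∥ e ∥ ℕ.* Vec.sum c)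
        ≤⟨ ℤ.+≤+ (ℕ.+-mono-≤ (ℕ.+-monoʳ-≤ Λ (ℕ.≤-trans (∥∥⁻≤∥∥ e) ∥e∥≤K)) (ℕ.*-monoˡ-≤ (Vec.sum c) ∥e∥≤K)) ⟩
      + (Λ ℕ.+ K ℕ.+ K ℕ.* Vec.sum c) ∎

  slice : Fin n → ℕ → ℕ → ℕ
  slice ρ′ k μ = proj₁ (proj₂ (slice-bounded complete pic ρ′) k μ)

  private
    κ-bound = bound-Fin (λ ρ′ → proj₁ (slice-bounded complete pic ρ′))

  -- One of the two factors k + 1 is cancelled and the other stays for the summation over k: the
  -- exponent r - 1 is natural, whereas r - 2 may be negative.
  slice-≤ : ∀ ρ′ k μ → slice ρ′ k μ ℕ.* suc k ℕ.≤ proj₁ κ-bound ℕ.* suc k ℕ.^ pred r ℕ.* suc μ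
  slice-≤ ρ′ k μ = ℕ.*-cancelʳ-≤ _ _ (suc k) (begin
    slice ρ′ k μ ℕ.* suc k ℕ.* suc k
      ≡⟨ ℕ.*-assoc (slice ρ′ k μ) (suc k) (suc k) ⟩
    slice ρ′ k μ ℕ.* (suc k ℕ.* suc k)
      ≤⟨ proj₂ (proj₂ (proj₂ (slice-bounded complete pic ρ′) k μ)) ⟩
    proj₁ (slice-bounded complete pic ρ′) ℕ.* suc k ℕ.^ r ℕ.* suc μ
      ≤⟨ ℕ.*-monoˡ-≤ (suc μ) (ℕ.*-monoˡ-≤ (suc k ℕ.^ r) (proj₂ κ-bound ρ′)) ⟩
    κ ℕ.* suc k ℕ.^ r ℕ.* suc μ
      ≡⟨ cong (λ e → κ ℕ.* suc k ℕ.^ e ℕ.* suc μ) (sym (ℕ.suc-pred r {{ℕ.>-nonZero (1≤rank complete pic ρ′)}})) ⟩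
    κ ℕ.* (suc k ℕ.* suc k ℕ.^ pred r) ℕ.* suc μ
      ≡⟨ reorder κ (suc k) (suc k ℕ.^ pred r) (suc μ) ⟩
    κ ℕ.* suc k ℕ.^ pred r ℕ.* suc μ ℕ.* suc k ∎)
    where
    open ℕ.≤-Reasoning
    κ = proj₁ κ-bound
    reorder : ∀ a b c d → a ℕ.* (b ℕ.* c) ℕ.* d ≡ a ℕ.* c ℕ.* d ℕ.* b
    reorder = solve-∀

  Cell-bounded : ∀ Λ ρ′ c k → Bounded (Cell Λ ρ′ c k)
    (slice ρ′ k (Λ ℕ.+ proj₁ E-bounded ℕ.* Vec.sum c) ℕ.* (2^ k /2^ Vec.sum c))
  Cell-bounded Λ ρ′ c k = bounded-fibres (Vec.≡-dec ℕ._≟_) (λ X → zipWith ℕ._+_ (lgᵛ X) c) proj₂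
    (proj₁ (proj₂ (proj₂ (slice-bounded complete pic ρ′) k (Λ ℕ.+ proj₁ E-bounded ℕ.* Vec.sum c))))
    λ t → bounded-inhabited λ { ((_ , _ , sum≡k , _) , refl) →
      bounded-mono (λ ((1≤X , _) , eq) → 1≤X , eq) (ℕ.≤-reflexive (cong (λ s → 2^ s /2^ Vec.sum c) sum≡k))
        (shifted-fibre-bounded c t) }

  bad-count : ∃[ D ] ∀ m Λ → ∃[ N ] Bounded (Bad m Λ) N ×
    N ℕ.* suc m ℕ.≤ D ℕ.* suc Λ ℕ.* (2 ℕ.^ m ℕ.* suc m ℕ.^ pred r)
  bad-count = n ℕ.* (4 ℕ.^ suc n ℕ.* κ) ℕ.* (1 ℕ.+ 2 ℕ.* K) , λ m Λ →
    let W = λ ρ′ → weightedSum (slice ρ′) n m K (Λ ℕ.+ K) in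
    ∑ (allFin n) W ,
    bounded-⋃ (allFin n) (λ ρ′ X → ∃[ c ] c ∈ˡ box m n × ∃[ k ] k ∈ˡ downFrom (suc m) × Cell (Λ ℕ.+ K) ρ′ c k X) W
      (λ ρ′ _ → bounded-⋃ (box m n) (λ c X → ∃[ k ] k ∈ˡ downFrom (suc m) × Cell (Λ ℕ.+ K) ρ′ c k X) _
        (λ c _ → bounded-⋃ (downFrom (suc m)) (Cell (Λ ℕ.+ K) ρ′ c) _
          (λ k _ → Cell-bounded (Λ ℕ.+ K) ρ′ c k) id) id)
      (λ {X} bad → let ρ′ , c , k , c∈ , k∈ , cell = Bad⇒Cell {m} {Λ} {X} bad in
        ρ′ , Mem.∈-allFin ρ′ , c , c∈ , k , k∈ , cell) ,
    (begin
      ∑ (allFin n) W ℕ.* suc m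
        ≡⟨ trans (ℕ.*-comm (∑ (allFin n) W) (suc m)) (sym (∑-*ˡ (allFin n) (suc m) W)) ⟩
      ∑ (allFin n) (λ ρ′ → suc m ℕ.* W ρ′)
        ≤⟨ ∑-mono (allFin n) (λ ρ′ _ → ℕ.≤-trans (ℕ.≤-reflexive (ℕ.*-comm (suc m) (W ρ′)))
             (weightedSum-≤ (slice ρ′) n m K (Λ ℕ.+ K) κ (pred r) (slice-≤ ρ′))) ⟩
      ∑ (allFin n) (λ _ → V m Λ)
        ≡⟨ trans (∑-const (allFin n) (V m Λ)) (cong (ℕ._* V m Λ) (List.length-tabulate {n = n} id)) ⟩
      n ℕ.* V m Λ
        ≤⟨ ℕ.*-monoʳ-≤ n (ℕ.*-monoˡ-≤ (Q m) (ℕ.*-monoʳ-≤ (4 ℕ.^ suc n ℕ.* κ)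
             (ℕ.≤-trans (ℕ.m≤m+n _ _) (ℕ.≤-reflexive (absorb Λ K))))) ⟩
      n ℕ.* (4 ℕ.^ suc n ℕ.* κ ℕ.* ((1 ℕ.+ 2 ℕ.* K) ℕ.* suc Λ) ℕ.* Q m)
        ≡⟨ reorder n (4 ℕ.^ suc n ℕ.* κ) (1 ℕ.+ 2 ℕ.* K) (suc Λ) (Q m) ⟩
      n ℕ.* (4 ℕ.^ suc n ℕ.* κ) ℕ.* (1 ℕ.+ 2 ℕ.* K) ℕ.* suc Λ ℕ.* Q m ∎)
    where
    open ℕ.≤-Reasoning
    κ = proj₁ κ-bound
    K = proj₁ E-bounded
    Q : ℕ → ℕ
    Q m = 2 ℕ.^ m ℕ.* suc m ℕ.^ pred r
    V : ℕ → ℕ → ℕ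
    V m Λ = 4 ℕ.^ suc n ℕ.* κ ℕ.* (suc (Λ ℕ.+ K) ℕ.+ K) ℕ.* Q m
    absorb : ∀ Λ K → suc (Λ ℕ.+ K) ℕ.+ K ℕ.+ 2 ℕ.* K ℕ.* Λ ≡ (1 ℕ.+ 2 ℕ.* K) ℕ.* suc Λ
    absorb = solve-∀
    reorder : ∀ n a b l q → n ℕ.* (a ℕ.* (b ℕ.* l) ℕ.* q) ≡ n ℕ.* a ℕ.* b ℕ.* l ℕ.* q
    reorder = solve-∀

-- Real numbers and their logarithms

archimedean : ∀ q → ∃[ N ] q ℚ.≤ ι N
archimedean q@(mkℚ i d c) = ℤ.∣ i ∣ ,
  subst (q ℚ.≤_) (sym (trans (ι≡/1 ℤ.∣ i ∣) (/1≡mkℚ (+ ℤ.∣ i ∣)))) (ℚ.*≤* (begin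
    i ℤ.* 1ℤ
      ≡⟨ ℤ.*-identityʳ i ⟩
    i
      ≤⟨ i≤∣i∣ i ⟩
    + ℤ.∣ i ∣
      ≤⟨ ℤ.+≤+ (ℕ.m≤m*n ℤ.∣ i ∣ (suc d)) ⟩
    + (ℤ.∣ i ∣ ℕ.* suc d)
      ≡⟨ ℤ.pos-* ℤ.∣ i ∣ (suc d) ⟩
    + ℤ.∣ i ∣ ℤ.* + suc d ∎))
  where
  open ℤ.≤-Reasoning
  i≤∣i∣ : ∀ i → i ℤ.≤ + ℤ.∣ i ∣
  i≤∣i∣ (+ k)    = ℤ.≤-refl
  i≤∣i∣ -[1+ k ] = ℤ.-≤+

module _ {x : Cut} (x-real : IsReal x) where
  open IsReal x-real

  upper-mono : ∀ {p q} → upper x p → p ℚ.< q → upper x q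
  upper-mono {p} {q} xp p<q = Equivalence.from (upper-rounded q) (p , p<q , xp)

  lower<upper : ∀ {p q} → lower x p → upper x q → p ℚ.< q
  lower<upper {p} {q} p<x x<q = ℚ.≰⇒> λ q≤p → case q ℚ.≟ p of λ where
    (yes refl) → disjoint p (p<x , x<q)
    (no q≢p)   → disjoint q (Equivalence.from (lower-rounded q)
      (p , ℚ.≰⇒> (λ p≤q → q≢p (ℚ.≤-antisym q≤p p≤q)) , p<x) , x<q)

n<4^n : ∀ n → n ℕ.< 4 ℕ.^ n
n<4^n zero    = s≤s z≤n
n<4^n (suc n) = ℕ.≤-trans (s≤s (n<4^n n)) (ℕ.≤-trans
  (ℕ.+-monoˡ-≤ (4 ℕ.^ n) (ℕ.m^n>0 4 n)) (ℕ.+-monoʳ-≤ (4 ℕ.^ n) (ℕ.m≤m+n (4 ℕ.^ n) _)))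

4^-mono-< : ∀ {m n} → m ℕ.< n → 4 ℕ.^ m ℕ.< 4 ℕ.^ n
4^-mono-< = ℕ.^-monoʳ-< 4 (s≤s (s≤s z≤n))

-- A real `B` cannot be compared with a single number, but locatedness chooses between 4^(N+1) < B
-- and B < 4^(N+2). Descending from a large power until the first alternative occurs leaves a gap of
-- a factor 16.
window : ∀ K (B : ℝ) → 3 ℕ.≤ K → fromℕ (4 ℕ.^ K) ≤ᶜ cut B →
  ∃[ N ] K ℕ.≤ 3 ℕ.+ N × lower (cut B) (ι (4 ℕ.^ suc N)) × upper (cut B) (ι (4 ℕ.^ (3 ℕ.+ N)))
window K B 3≤K 4^K≤B =
  let u , B<u = upper-inhabited
      M , u≤M = archimedean u
  in descend M (upper-mono isReal B<u (ℚ.≤-<-trans u≤M (ι-mono-< (n<4^n M))))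
  where
  open ℝ B using (isReal)
  open IsReal isReal
  large : ∀ M → upper (cut B) (ι (4 ℕ.^ M)) → K ℕ.≤ M
  large M B<4^M = ℕ.≮⇒≥ λ M<K → 4^K≤B
    (ι (4 ℕ.^ M) , B<4^M , subst (ι (4 ℕ.^ M) ℚ.<_) (ι≡/1 (4 ℕ.^ K)) (ι-mono-< (4^-mono-< M<K)))
  small : ∀ {M} → M ℕ.< 3 → ¬ upper (cut B) (ι (4 ℕ.^ M))
  small M<3 B< = ℕ.<⇒≱ M<3 (ℕ.≤-trans 3≤K (large _ B<))
  descend : ∀ M → upper (cut B) (ι (4 ℕ.^ M)) →
    ∃[ N ] K ℕ.≤ 3 ℕ.+ N × lower (cut B) (ι (4 ℕ.^ suc N)) × upper (cut B) (ι (4 ℕ.^ (3 ℕ.+ N)))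
  descend 0 B< = contradiction B< (small (s≤s z≤n))
  descend 1 B< = contradiction B< (small (s≤s (s≤s z≤n)))
  descend 2 B< = contradiction B< (small (s≤s (s≤s (s≤s z≤n))))
  descend (suc (suc (suc N))) B< =
    [ (λ <B → N , large (3 ℕ.+ N) B< , <B , B<) , descend (suc (suc N)) ]′
      (located (ι (4 ℕ.^ suc N)) (ι (4 ℕ.^ (2 ℕ.+ N))) (ι-mono-< (4^-mono-< (ℕ.n<1+n (suc N)))))

log₄ : ∀ N → ∃[ ν ] 4 ℕ.^ ν ℕ.≤ suc N × suc N ℕ.< 4 ℕ.^ suc ν
log₄ zero = 0 , s≤s z≤n , s≤s (s≤s z≤n)
log₄ (suc N) =
  let ν , 4^≤ , <4^ = log₄ N in
  case suc (suc N) ℕ.<? 4 ℕ.^ suc ν of λ where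
    (yes <4^′) → ν , ℕ.≤-trans 4^≤ (ℕ.n≤1+n _) , <4^′
    (no ≮4^)   → suc ν , ℕ.≮⇒≥ ≮4^ , ℕ.≤-<-trans <4^ (4^-mono-< (ℕ.n<1+n (suc ν)))

module LogBounds (B : ℝ) where
  open ℝ B using (isReal)

  -- If log B < p ≤ N + 1, then B < 4^(N+1) because e < 4.
  log-upper : ∀ {p N} → lower (cut B) (ι (4 ℕ.^ suc N)) → upper (log (cut B)) p → ι (suc N) ℚ.< p
  log-upper {N = N} 4^N<B (q , q<eᵖ , B<q) = ℚ.≰⇒> λ p≤N →
    ℚ.<-asym (lower<upper isReal 4^N<B B<q) (<exp⇒<4^ N q<eᵖ p≤N)

  loglog-upper : ∀ {s N ν} → lower (cut B) (ι (4 ℕ.^ suc N)) → 4 ℕ.^ suc ν ℕ.≤ suc N →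
    upper (log (log (cut B))) s → ι (suc ν) ℚ.< s
  loglog-upper {ν = ν} 4^N<B 4^ν≤N (p , p<eˢ , logB<p) = ℚ.≰⇒> λ s≤ν →
    ℚ.<-asym (log-upper 4^N<B logB<p) (ℚ.<-≤-trans (<exp⇒<4^ ν p<eˢ s≤ν) (ι-mono-≤ 4^ν≤N))

  log-lower : ∀ {p m} → upper (cut B) (ι (2 ℕ.^ suc m)) → lower (log (cut B)) p → p ℚ.< ι (suc m)
  log-lower {m = m} B<2^m (q , eᵖ<q , q<B) = >exp⇒<ι m eᵖ<q (ℚ.<⇒≤ (lower<upper isReal q<B B<2^m))

  loglog-lower : ∀ {c m l} → upper (cut B) (ι (2 ℕ.^ suc m)) → suc m ℕ.≤ 2 ℕ.^ suc l →
    lower (log (log (cut B))) c → c ℚ.< ι (suc l)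
  loglog-lower {l = l} B<2^m m≤2^l (p , eᶜ<p , p<logB) =
    >exp⇒<ι l eᶜ<p (ℚ.<⇒≤ (ℚ.<-≤-trans (log-lower B<2^m p<logB) (ι-mono-≤ m≤2^l)))

  log-power-lower : ∀ (A : ℝ) → fromℕ 0 <ᶜ cut A → ∀ {A₀ m l q} → upper (cut A) (ι (suc A₀)) →
    upper (cut B) (ι (2 ℕ.^ suc m)) → suc m ℕ.≤ 2 ℕ.^ suc l →
    lower (log (cut B) ^ᶜ cut A) q → q ℚ.< ι (4 ℕ.^ (suc A₀ ℕ.* suc l))
  log-power-lower A (q₀ , 0<q₀ , q₀<A) {A₀} {m} {l} A<A₀ B<2^m m≤2^l
    (t , (a , b , c , d , (a<A , A<b , c<loglogB , _) , t<ac , _ , t<bc , _) , q<eᵗ) =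
    <exp⇒<4^ (l ℕ.+ A₀ ℕ.* suc l) q<eᵗ t≤
    where
    open ℚ.≤-Reasoning
    0<b : 0ℚ ℚ.< b
    0<b = ℚ.<-trans 0<q₀ (lower<upper (ℝ.isReal A) q₀<A A<b)
    c<l : c ℚ.< ι (suc l)
    c<l = loglog-lower B<2^m m≤2^l c<loglogB
    t≤ : t ℚ.≤ ι (suc A₀ ℕ.* suc l)
    -- The useful corner of the interval product depends on the sign of `c`: for c ≥ 0 the lower end
    -- `a` is below A₀ + 1; for c < 0 the product `b c` is at most 0 because b > A > 0.
    t≤ = case 0ℚ ℚ.≤? c of λ where
      (yes 0≤c) → begin
        t
          ≤⟨ ℚ.<⇒≤ t<ac ⟩
        a ℚ.* c
          ≤⟨ ℚ.*-monoʳ-≤-nonNeg c {{ℚ.nonNegative 0≤c}} (ℚ.<⇒≤ (lower<upper (ℝ.isReal A) a<A A<A₀)) ⟩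
        ι (suc A₀) ℚ.* c
          ≤⟨ ℚ.*-monoˡ-≤-nonNeg (ι (suc A₀)) {{ℚ.nonNegative (0≤ι (suc A₀))}} (ℚ.<⇒≤ c<l) ⟩
        ι (suc A₀) ℚ.* ι (suc l)
          ≡⟨ sym (ι-homo-* (suc A₀) (suc l)) ⟩
        ι (suc A₀ ℕ.* suc l) ∎
      (no 0≰c) → begin
        t
          ≤⟨ ℚ.<⇒≤ t<bc ⟩
        b ℚ.* c
          ≤⟨ ℚ.*-monoˡ-≤-nonNeg b {{ℚ.nonNegative (ℚ.<⇒≤ 0<b)}} (ℚ.<⇒≤ (ℚ.≰⇒> 0≰c)) ⟩
        b ℚ.* 0ℚ
          ≡⟨ ℚ.*-zeroʳ b ⟩
        0ℚ
          ≤⟨ 0≤ι (suc A₀ ℕ.* suc l) ⟩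
        ι (suc A₀ ℕ.* suc l) ∎

  log-power-upper-pos : ∀ {y q} → upper (log (cut B) ^ᶜ y) q → 0ℚ ℚ.< q
  log-power-upper-pos {q = q} (_ , _ , q>0 , _) = ℚ.positive⁻¹ q {{q>0}}

  log-power-upper-+ : ∀ {i q N} → lower (cut B) (ι (4 ℕ.^ suc N)) → 4 ℕ.≤ suc N →
    upper (log (cut B) ^ᶜ fromℤ (+ i)) q → ι (suc N ℕ.^ i) ℚ.≤ q
  log-power-upper-+ {i} {q} {N} 4^N<B 4≤N
    (t , (a , b , c , d , (_ , i<b , _ , p , p<eᵈ , logB<p) , _ , _ , _ , bd<t) , eᵗ<q) = lower-bound i refl
    where
    0<d : 0ℚ ℚ.< d
    0<d = ℚ.<-trans (0<ι 0) (loglog-upper 4^N<B 4≤N (p , p<eᵈ , logB<p))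
    N<p : ι (suc N) ℚ.< p
    N<p = log-upper 4^N<B logB<p
    id≤t : ι i ℚ.* d ℚ.≤ t
    id≤t = ℚ.≤-trans (ℚ.*-monoʳ-≤-nonNeg d {{ℚ.nonNegative (ℚ.<⇒≤ 0<d)}}
      (ℚ.≤-trans (ℚ.≤-reflexive (ι≡/1 i)) (ℚ.<⇒≤ i<b))) (ℚ.<⇒≤ bd<t)
    lower-bound : ∀ j → j ≡ i → ι (suc N ℕ.^ j) ℚ.≤ q
    -- Exponent 0 is outside the range of `<exp-^`. Here t ≥ 0 and every number below 1 is below
    -- e^0, so e^t < q forces q ≥ 1.
    lower-bound zero    refl = ℚ.≮⇒≥ λ q<1 → ℚ.<-irrefl refl
      (<exp⇒<>exp {q} {q} {0ℚ} {t} (0 , from-yes (0ℚ ℚ.<? 1ℚ) , subst (q ℚ.<_) ι1 q<1) eᵗ<q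
        (subst (ℚ._≤ t) (trans (cong (ℚ._* d) ι0) (ℚ.*-zeroˡ d)) id≤t))
    lower-bound (suc j) refl = ℚ.≤-trans
      (ℚ.≤-trans (ℚ.≤-reflexive (ι-homo-^ (suc N) (suc j))) (^ℚ-mono-≤ (suc j) (0≤ι (suc N)) (ℚ.<⇒≤ N<p)))
      (ℚ.<⇒≤ (<exp⇒<>exp {p ^ℚ suc j} {q} {ι (suc j) ℚ.* d} {t}
        (<exp-^ {p} {d} j (ℚ.≤-trans (0≤ι (suc N)) (ℚ.<⇒≤ N<p)) p<eᵈ) eᵗ<q id≤t))

  -- The case of rank 1, with (log B)^(-1) = exp (- log log B). The cut of log log B provides some p
  -- < log B with e^c < p, whose inverse lies below e^(-c) ≤ e^t < q.
  log-power-upper-−1 : ∀ {q m} → upper (cut B) (ι (2 ℕ.^ suc m)) →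
    upper (log (cut B) ^ᶜ fromℤ -[1+ 0 ]) q → 1ℚ ℚ.≤ q ℚ.* ι (suc m)
  log-power-upper-−1 {q} {m} B<2^m
    (t , (a , b , c , d , (a<-1 , -1<b , (p , (p>0 , p⁻¹<) , p<logB) , _) , ac<t , _ , bc<t , _) , eᵗ<q) = begin
    1ℚ
      ≡⟨ sym (inv-inverse p p>0) ⟩
    inv p p>0 ℚ.* p
      ≤⟨ *-mono-≤ℚ (ℚ.<⇒≤ (0<inv p p>0)) (0≤ι (suc m))
           (ℚ.<⇒≤ (<exp⇒<>exp {inv p p>0} {q} {ℚ.- c} {t} p⁻¹< eᵗ<q -c≤t)) (ℚ.<⇒≤ (log-lower B<2^m p<logB)) ⟩
    q ℚ.* ι (suc m) ∎
    where
    open ℚ.≤-Reasoning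
    -c≡ : ℚ.- c ≡ ℚ.- 1ℚ ℚ.* c
    -c≡ = trans (cong ℚ.-_ (sym (ℚ.*-identityˡ c))) (ℚ.neg-distribˡ-* 1ℚ c)
    -- The factor -1 lies strictly between `a` and `b`; the sign of `c` decides which of `a c` and
    -- `b c` is known to be at least `- c`.
    -c≤t : ℚ.- c ℚ.≤ t
    -c≤t = case ℚ.≤-total 0ℚ c of λ where
      (inj₁ 0≤c) → ℚ.≤-trans (ℚ.≤-reflexive -c≡) (ℚ.≤-trans
        (ℚ.*-monoʳ-≤-nonNeg c {{ℚ.nonNegative 0≤c}} (ℚ.<⇒≤ -1<b)) (ℚ.<⇒≤ bc<t))
      (inj₂ c≤0) → ℚ.≤-trans (ℚ.≤-reflexive -c≡) (ℚ.≤-trans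
        (ℚ.*-monoʳ-≤-nonPos c {{ℚ.nonPositive c≤0}} (ℚ.<⇒≤ a<-1)) (ℚ.<⇒≤ ac<t))

  -- Here `r` is one less than the Picard rank. The factor m + 1 makes up for the missing power of
  -- the logarithm, so that the left side is a natural power also when `r` is 0.
  log-power-upper : ∀ {r q N m} → lower (cut B) (ι (4 ℕ.^ suc N)) → 4 ℕ.≤ suc N → suc N ℕ.≤ suc m →
    upper (cut B) (ι (2 ℕ.^ suc m)) → upper (log (cut B) ^ᶜ fromℤ (+ suc r - + 2)) q →
    ι (suc N ℕ.^ r) ℚ.≤ q ℚ.* ι (suc m)
  log-power-upper {zero}  {q} {N} {m} 4^N<B 4≤N N≤m B<2^m q-upper =
    subst (ℚ._≤ q ℚ.* ι (suc m)) (sym ι1) (log-power-upper-−1 B<2^m q-upper)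
  log-power-upper {suc i} {q} {N} {m} 4^N<B 4≤N N≤m B<2^m q-upper = begin
    ι (suc N ℕ.^ suc i)
      ≡⟨ trans (cong ι (ℕ.*-comm (suc N) (suc N ℕ.^ i))) (ι-homo-* (suc N ℕ.^ i) (suc N)) ⟩
    ι (suc N ℕ.^ i) ℚ.* ι (suc N)
      ≤⟨ *-mono-≤ℚ (0≤ι (suc N ℕ.^ i)) (0≤ι (suc m))
           (log-power-upper-+ {i} 4^N<B 4≤N
             (subst (λ k → upper (log (cut B) ^ᶜ fromℤ k) q) (1+i-1 i) q-upper)) (ι-mono-≤ N≤m) ⟩
    q ℚ.* ι (suc m) ∎
    where
    open ℚ.≤-Reasoning
    1+i-1 : ∀ i → + suc (suc i) - + 2 ≡ + i
    1+i-1 i = refl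

-- The bound for real B

¬¬-All : ∀ {S : Set} {P : S → Set} {L : List S} → All (λ x → ¬ ¬ P x) L → ¬ ¬ All P L
¬¬-All []         k = k []
¬¬-All (¬¬p ∷ ¬¬L) k = ¬¬p λ p → ¬¬-All ¬¬L λ pL → k (p ∷ pL)

4^≡2^ : ∀ k → 4 ℕ.^ k ≡ 2 ℕ.^ (2 ℕ.* k)
4^≡2^ k = ℕ.^-*-assoc 2 2 k

module Main {d n r : ℕ} (Δ : Fan d n) (regular : Regular Δ) (complete : Complete Δ)
            (gg : GloballyGenerated Δ (-K Δ)) (pic : PicardRank Δ r)
            (A : ℝ) (0<A : fromℕ 0 <ᶜ cut A) where
  open Counting Δ regular complete gg pic

  A₀ : ℕ
  A₀ = proj₁ (archimedean (proj₁ (IsReal.upper-inhabited (ℝ.isReal A))))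

  A<A₀ : upper (cut A) (ι (suc A₀))
  A<A₀ = let u , A<u = IsReal.upper-inhabited (ℝ.isReal A) in
    upper-mono (ℝ.isReal A) A<u (ℚ.≤-<-trans (proj₂ (archimedean u)) (ι-mono-< (ℕ.n<1+n A₀)))

  Exceptional : ℝ → Vec ℕ n → Set
  Exceptional B X = 𝒜 Δ regular (cut B) X × ¬ 𝒜♭ Δ regular (cut A) (cut B) X

  -- Failing to lie in `𝒜♭` yields no violated inequality, only the impossibility that none is
  -- violated; hence the double negation. It is harmless because the final bound is itself a
  -- negation.
  exceptional-bad : ∀ B {m l X} → upper (cut B) (ι (2 ℕ.^ suc m)) → suc m ℕ.≤ 2 ℕ.^ suc l →
    Exceptional B X → ¬ ¬ Bad (suc m) (2 ℕ.* (suc A₀ ℕ.* suc l)) X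
  exceptional-bad B {m} {l} {X} B<2^m m≤2^l (X∈𝒜@(1≤X , D₀≤B) , X∉𝒜♭) ¬bad = X∉𝒜♭
    (X∈𝒜 , λ σ σ-max ρ′ ρ′∈σ (q , E<q , q<logB^A) → ¬bad
      (1≤X ,
       (λ σ σ-max → ℚ.≮⇒≥ λ 2^m<D₀ → D₀≤B σ σ-max (ι (2 ℕ.^ suc m) , B<2^m , 2^m<D₀)) ,
       σ , σ-max , ρ′ , ρ′∈σ ,
       ℚ.<⇒≤ (ℚ.<-trans E<q (subst (λ k → q ℚ.< ι k) (4^≡2^ (suc A₀ ℕ.* suc l))
         (LogBounds.log-power-lower B A 0<A {A₀} {m} {l} A<A₀ B<2^m m≤2^l q<logB^A)))))

  -- The factor 13 (A₀ + 1) comes from Λ + 1 ≤ 13 (A₀ + 1) ν, 16 from 2^m = 16 · 4^(N+1), and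
  -- 7^(r-1) from m + 1 ≤ 7 (N + 1).
  bound-constant : ℕ
  bound-constant = proj₁ bad-count ℕ.* (13 ℕ.* suc A₀) ℕ.* 16 ℕ.* 7 ℕ.^ pred r

  -- B lies between 4^(N+1) and 4^(N+3), so that log B is of order N + 1; and 4^ν ≤ N + 1 < 4^(ν+1), so that
  -- log log B is of order ν.
  bad-count-≤ : ∀ N ν → 1 ℕ.≤ ν → let m = 2 ℕ.* (3 ℕ.+ N) ; l = 2 ℕ.* (2 ℕ.+ ν) in
    ∃[ count ] Bounded (Bad m (2 ℕ.* (suc A₀ ℕ.* l))) count ×
      count ℕ.* suc m ℕ.≤ bound-constant ℕ.* (4 ℕ.^ suc N ℕ.* suc N ℕ.^ pred r) ℕ.* ν
  bad-count-≤ N ν 1≤ν =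
    let count , bounded , count≤ = proj₂ bad-count m Λ in
    count , bounded , (begin
      count ℕ.* suc m
        ≤⟨ count≤ ⟩
      D ℕ.* suc Λ ℕ.* (2 ℕ.^ m ℕ.* suc m ℕ.^ r′)
        ≤⟨ ℕ.*-mono-≤ (ℕ.*-monoʳ-≤ D Λ≤) (ℕ.*-monoʳ-≤ (2 ℕ.^ m) (ℕ.^-monoˡ-≤ r′ m≤)) ⟩
      D ℕ.* (13 ℕ.* suc A₀ ℕ.* ν) ℕ.* (2 ℕ.^ m ℕ.* (7 ℕ.* suc N) ℕ.^ r′)
        ≡⟨ cong₂ (λ x y → D ℕ.* (13 ℕ.* suc A₀ ℕ.* ν) ℕ.* (x ℕ.* y))
             (sym (4^≡2^ (3 ℕ.+ N))) (^-distribʳ-* r′ 7 (suc N)) ⟩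
      D ℕ.* (13 ℕ.* suc A₀ ℕ.* ν) ℕ.* (4 ℕ.* (4 ℕ.* 4 ℕ.^ suc N) ℕ.* (7 ℕ.^ r′ ℕ.* suc N ℕ.^ r′))
        ≡⟨ reorder D (13 ℕ.* suc A₀) ν (4 ℕ.^ suc N) (7 ℕ.^ r′) (suc N ℕ.^ r′) ⟩
      bound-constant ℕ.* (4 ℕ.^ suc N ℕ.* suc N ℕ.^ r′) ℕ.* ν ∎)
    where
    open ℕ.≤-Reasoning
    r′ = pred r
    D  = proj₁ bad-count
    m  = 2 ℕ.* (3 ℕ.+ N)
    Λ  = 2 ℕ.* (suc A₀ ℕ.* (2 ℕ.* (2 ℕ.+ ν)))
    expand-Λ : ∀ a ν → suc (2 ℕ.* (suc a ℕ.* (2 ℕ.* (2 ℕ.+ suc ν)))) ℕ.+ (9 ℕ.* suc a ℕ.* ν ℕ.+ a) ≡ 13 ℕ.* suc a ℕ.* suc ν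
    expand-Λ = solve-∀
    Λ≤ : suc Λ ℕ.≤ 13 ℕ.* suc A₀ ℕ.* ν
    Λ≤ = bound 1≤ν
      where
      bound : ∀ {ν} → 1 ℕ.≤ ν → suc (2 ℕ.* (suc A₀ ℕ.* (2 ℕ.* (2 ℕ.+ ν)))) ℕ.≤ 13 ℕ.* suc A₀ ℕ.* ν
      bound {suc ν} _ = ℕ.≤-trans (ℕ.m≤m+n _ (9 ℕ.* suc A₀ ℕ.* ν ℕ.+ A₀)) (ℕ.≤-reflexive (expand-Λ A₀ ν))
    expand-m : ∀ N → suc (2 ℕ.* (3 ℕ.+ N)) ℕ.+ 5 ℕ.* N ≡ 7 ℕ.* suc N
    expand-m = solve-∀
    m≤ : suc m ℕ.≤ 7 ℕ.* suc N
    m≤ = ℕ.≤-trans (ℕ.m≤m+n (suc m) (5 ℕ.* N)) (ℕ.≤-reflexive (expand-m N))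
    reorder : ∀ D a ν p s t → D ℕ.* (a ℕ.* ν) ℕ.* (4 ℕ.* (4 ℕ.* p) ℕ.* (s ℕ.* t)) ≡ D ℕ.* a ℕ.* 16 ℕ.* s ℕ.* (p ℕ.* t) ℕ.* ν
    reorder = solve-∀

  module _ (B : ℝ) {N ν} (4^N<B : lower (cut B) (ι (4 ℕ.^ suc N))) (B<4^N : upper (cut B) (ι (4 ℕ.^ (3 ℕ.+ N))))
           (4≤N : 4 ℕ.≤ suc N) (4^ν≤N : 4 ℕ.^ suc ν ℕ.≤ suc N) (N<4^ν : suc N ℕ.< 4 ℕ.^ (2 ℕ.+ ν)) where
    private
      open LogBounds B
      m = 2 ℕ.* (3 ℕ.+ N)
      -- 2^l = 4^(ν+3) is at least m = 2 (N + 3) because N + 2 ≤ 4^(ν+2); so `l` bounds log log B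
      -- from above.
      l = 2 ℕ.* (2 ℕ.+ suc ν)
      count-result = bad-count-≤ N (suc ν) (s≤s z≤n)
      count = proj₁ count-result

      B<2^m : upper (cut B) (ι (2 ℕ.^ m))
      B<2^m = subst (λ k → upper (cut B) (ι k)) (4^≡2^ (3 ℕ.+ N)) B<4^N

      m≤2^l : m ℕ.≤ 2 ℕ.^ l
      m≤2^l = ℕ.≤-trans (bound (4 ℕ.^ (2 ℕ.+ ν)) N<4^ν) (ℕ.≤-reflexive (4^≡2^ (2 ℕ.+ suc ν)))
        where
        expand-m : ∀ N → 2 ℕ.* (3 ℕ.+ N) ℕ.+ (2 ℕ.+ 2 ℕ.* N) ≡ 4 ℕ.* suc (suc N)
        expand-m = solve-∀
        bound : ∀ y → suc N ℕ.< y → m ℕ.≤ 4 ℕ.* y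
        bound y N<y = ℕ.≤-trans (ℕ.m≤m+n m (2 ℕ.+ 2 ℕ.* N)) (ℕ.≤-trans (ℕ.≤-reflexive (expand-m N)) (ℕ.*-monoʳ-≤ 4 N<y))

      N≤m : suc N ℕ.≤ m
      N≤m = ℕ.≤-trans (ℕ.m≤m+n (suc N) (5 ℕ.+ N)) (ℕ.≤-reflexive (expand-m N))
        where
        expand-m : ∀ N → suc N ℕ.+ (5 ℕ.+ N) ≡ 2 ℕ.* (3 ℕ.+ N)
        expand-m = solve-∀

    Bound : Cut
    Bound = fromℕ bound-constant *ᶜ (cut B *ᶜ log (cut B) ^ᶜ fromℤ (+ r - + 2) *ᶜ log (log (cut B)))

    -- A rational above an interval product lies above the product of the upper ends. These ends are
    -- replaced by lower bounds for the constant, B and log log B; only the end `p` for the power of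
    -- log B is kept, to be estimated together with a factor m + 1.
    Bound-upper : ∀ {q} → upper Bound q → ∃[ p ] upper (log (cut B) ^ᶜ fromℤ (+ r - + 2)) p × 0ℚ ℚ.< p ×
      ι bound-constant ℚ.* (ι (4 ℕ.^ suc N) ℚ.* p ℚ.* ι (suc ν)) ℚ.< q
    Bound-upper {q} (_ , b₁ , _ , d₁ , (_ , C<b₁ , _ ,
        (_ , b₂ , _ , d₂ , (_ , (_ , b₃ , _ , d₃ , (_ , B<b₃ , _ , log^<d₃) , _ , _ , _ , b₃d₃<b₂) , _ , loglog<d₂) ,
          _ , _ , _ , b₂d₂<d₁)) , _ , _ , _ , b₁d₁<q) =
      d₃ , log^<d₃ , 0<d₃ , ℚ.≤-<-trans product≤ b₁d₁<q
      where
      C = bound-constant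
      P = 4 ℕ.^ suc N
      0<d₃ : 0ℚ ℚ.< d₃
      0<d₃ = log-power-upper-pos {fromℤ (+ r - + 2)} log^<d₃
      0≤Pd₃ : 0ℚ ℚ.≤ ι P ℚ.* d₃
      0≤Pd₃ = 0≤*ℚ (0≤ι P) (ℚ.<⇒≤ 0<d₃)
      ν<d₂ : ι (suc ν) ℚ.< d₂
      ν<d₂ = loglog-upper 4^N<B 4^ν≤N loglog<d₂
      b₂≥ : ι P ℚ.* d₃ ℚ.≤ b₂
      b₂≥ = ℚ.≤-trans (ℚ.*-monoʳ-≤-nonNeg d₃ {{ℚ.nonNegative (ℚ.<⇒≤ 0<d₃)}}
        (ℚ.<⇒≤ (lower<upper (ℝ.isReal B) 4^N<B B<b₃))) (ℚ.<⇒≤ b₃d₃<b₂)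
      d₁≥ : ι P ℚ.* d₃ ℚ.* ι (suc ν) ℚ.≤ d₁
      d₁≥ = ℚ.≤-trans (*-mono-≤ℚ 0≤Pd₃ (ℚ.≤-trans (0≤ι (suc ν)) (ℚ.<⇒≤ ν<d₂)) b₂≥ (ℚ.<⇒≤ ν<d₂)) (ℚ.<⇒≤ b₂d₂<d₁)
      product≤ : ι C ℚ.* (ι P ℚ.* d₃ ℚ.* ι (suc ν)) ℚ.≤ b₁ ℚ.* d₁
      product≤ = *-mono-≤ℚ (0≤ι C) (ℚ.≤-trans (0≤*ℚ 0≤Pd₃ (0≤ι (suc ν))) d₁≥)
        (ℚ.<⇒≤ (subst (ℚ._< b₁) (sym (ι≡/1 C)) C<b₁)) d₁≥

    count<upper : 1 ℕ.≤ r → ∀ {q} → upper Bound q → ι count ℚ.< q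
    count<upper 1≤r {q} Bound<q =
      let p , log^<p , 0<p , product<q = Bound-upper Bound<q
          -- The count comes multiplied by m + 1, the power of log B only by m; relaxing the latter
          -- to m + 1 lets the factor cancel.
          T≤ = ℚ.≤-trans
            (log-power-upper {pred r} 4^N<B 4≤N N≤m B<2^m
              (subst (λ k → upper (log (cut B) ^ᶜ fromℤ (+ k - + 2)) p) (sym (ℕ.suc-pred r {{ℕ.>-nonZero 1≤r}})) log^<p))
            (ℚ.*-monoˡ-≤-nonNeg p {{ℚ.nonNegative (ℚ.<⇒≤ 0<p)}} (ι-mono-≤ (ℕ.n≤1+n m)))
      in ℚ.≤-<-trans (ℚ.*-cancelʳ-≤-pos (ι (suc m)) {{ℚ.positive (0<ι m)}} (begin
        ι count ℚ.* ι (suc m)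
          ≡⟨ sym (ι-homo-* count (suc m)) ⟩
        ι (count ℕ.* suc m)
          ≤⟨ ι-mono-≤ (proj₂ (proj₂ count-result)) ⟩
        ι (C ℕ.* (P ℕ.* T) ℕ.* suc ν)
          ≡⟨ trans (ι-homo-* (C ℕ.* (P ℕ.* T)) (suc ν)) (cong (ℚ._* ι (suc ν))
               (trans (ι-homo-* C (P ℕ.* T)) (cong (ι C ℚ.*_) (ι-homo-* P T)))) ⟩
        ι C ℚ.* (ι P ℚ.* ι T) ℚ.* ι (suc ν)
          ≤⟨ ℚ.*-monoʳ-≤-nonNeg (ι (suc ν)) {{ℚ.nonNegative (0≤ι (suc ν))}}
               (ℚ.*-monoˡ-≤-nonNeg (ι C) {{ℚ.nonNegative (0≤ι C)}}
                 (ℚ.*-monoˡ-≤-nonNeg (ι P) {{ℚ.nonNegative (0≤ι P)}} T≤)) ⟩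
        ι C ℚ.* (ι P ℚ.* (p ℚ.* ι (suc m))) ℚ.* ι (suc ν)
          ≡⟨ solve 5 (λ c P p m v → c :* (P :* (p :* m)) :* v := c :* (P :* p :* v) :* m) refl
               (ι C) (ι P) p (ι (suc m)) (ι (suc ν)) ⟩
        ι C ℚ.* (ι P ℚ.* p ℚ.* ι (suc ν)) ℚ.* ι (suc m) ∎)) product<q
      where
      open ℚ.≤-Reasoning
      open ℚ-Solver
      C = bound-constant
      P = 4 ℕ.^ suc N
      T = suc N ℕ.^ pred r

    exceptional-bound-in-window : # Exceptional B ≤ Bound
    exceptional-bound-in-window L unique exceptional (q , Bound<q , q<len) =
      ¬¬-All (All.map (λ {X} → exceptional-bad B {pred m} {pred l} {X} B<2^m m≤2^l) exceptional) λ bad → case 1 ℕ.≤? r of λ where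
        (yes 1≤r) → ℚ.<-asym (subst (q ℚ.<_) (sym (ι≡/1 (length L))) q<len)
          (ℚ.≤-<-trans (ι-mono-≤ (proj₁ (proj₂ count-result) L unique bad)) (count<upper 1≤r Bound<q))
        -- For r = 0 there can be no ray, hence no bad vector: the list is empty, and its length 0
        -- lies below every upper bound of `Bound`.
        (no 1≰r) → let p , _ , 0<p , product<q = Bound-upper Bound<q in
          ℚ.<-asym (subst (λ k → q ℚ.< + k / 1) (empty 1≰r bad) q<len)
            (ℚ.≤-<-trans (0≤*ℚ (0≤ι bound-constant)
              (0≤*ℚ (0≤*ℚ (0≤ι (4 ℕ.^ suc N)) (ℚ.<⇒≤ 0<p)) (0≤ι (suc ν)))) product<q)
      where
      empty : ∀ {L} → ¬ 1 ℕ.≤ r → All (Bad m (2 ℕ.* (suc A₀ ℕ.* l))) L → length L ≡ 0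
      empty 1≰r []                                      = refl
      empty 1≰r ((_ , _ , _ , _ , ρ′ , _) ∷ _) = contradiction (Relations.1≤rank Δ regular complete pic ρ′) 1≰r

  -- The condition K ≥ 6 ensures N + 1 ≥ 4, hence ν ≥ 1, so that log log B is bounded away from 0.
  exceptional-bound : ∀ K → 6 ℕ.≤ K → (B : ℝ) → fromℕ (4 ℕ.^ K) ≤ᶜ cut B → # Exceptional B ≤
    (fromℕ bound-constant *ᶜ (cut B *ᶜ log (cut B) ^ᶜ fromℤ (+ r - + 2) *ᶜ log (log (cut B))))
  exceptional-bound K 6≤K B 4^K≤B =
    let N , K≤3+N , 4^N<B , B<4^N = window K B (ℕ.≤-trans (s≤s (s≤s (s≤s z≤n))) 6≤K) 4^K≤B
        4≤N = s≤s (ℕ.+-cancelˡ-≤ 3 _ _ (ℕ.≤-trans 6≤K K≤3+N))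
    in from-log₄ N 4^N<B B<4^N 4≤N (log₄ N)
    where
    from-log₄ : ∀ N → lower (cut B) (ι (4 ℕ.^ suc N)) → upper (cut B) (ι (4 ℕ.^ (3 ℕ.+ N))) → 4 ℕ.≤ suc N →
      ∃[ ν ] 4 ℕ.^ ν ℕ.≤ suc N × suc N ℕ.< 4 ℕ.^ suc ν → # Exceptional B ≤
      (fromℕ bound-constant *ᶜ (cut B *ᶜ log (cut B) ^ᶜ fromℤ (+ r - + 2) *ᶜ log (log (cut B))))
    from-log₄ N 4^N<B B<4^N 4≤N (zero , _ , N<4)          = contradiction N<4 (ℕ.≤⇒≯ 4≤N)
    from-log₄ N 4^N<B B<4^N 4≤N (suc ν , 4^ν≤N , N<4^ν) =
      exceptional-bound-in-window B {N} {ν} 4^N<B B<4^N 4≤N 4^ν≤N N<4^ν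

theorem5p1 : ∀ {d n r : ℕ} (Δ : Fan d n) (regular : Regular Δ) →
    Complete Δ → Projective Δ → GloballyGenerated Δ (-K Δ) → PicardRank Δ r →
    (A : ℝ) → fromℕ 0 <ᶜ cut A →
    ∃[ C ] ∃[ B₀ ] ((B : ℝ) → cut B₀ ≤ᶜ cut B →
    (# (λ X → 𝒜 Δ regular (cut B) X × ¬ 𝒜♭ Δ regular (cut A) (cut B) X)
    ≤ (cut C *ᶜ (cut B *ᶜ log (cut B) ^ᶜ fromℤ (+ r - + 2) *ᶜ log (log (cut B))))))
theorem5p1 Δ regular complete _ gg pic A 0<A =
  record { cut = fromℕ bound-constant ; isReal = fromℚ-isReal (+ bound-constant / 1) } ,
  record { cut = fromℕ (4 ℕ.^ 6) ; isReal = fromℚ-isReal (+ (4 ℕ.^ 6) / 1) } ,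
  exceptional-bound 6 ℕ.≤-refl
  where open Main Δ regular complete gg pic A 0<A
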